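{- Let $p$ be an odd prime and let $\mathcal O$ be a complete discrete valuation ring with maximal ideal generated by $p$ and perfect residue field, with its unique $p$-derivation $\delta$. Let $G=GL_2$ over $\mathcal O$, let $d_1,d_2\in\mathcal O^\times$, $q_1=d_1\cdot 1_2$, $q_2=d_2\cdot 1_2\in G(\mathcal O)$, and let $(\delta_1^G,\delta_2^G)$ be the Levi-Civita connection on $G$ over $\mathcal O$ attached to $(q_1,q_2)$. Let $G'=GL_1^c\subset G$ and $G''=U_1^c\subset G'$. Then: 1) $G'$ is $\delta_i^G$-horizontal for $i=1,2$. 2) $G''$ is $\delta_i^G$-horizontal for $i=1,2$ if and only if $\delta d_1=\delta d_2=0$. 3) Assume $d_1=d_2=:d\in\mathbb Z$, $d\ne\pm1$, $d\not\equiv 0$ mod $p$. Then there is no closed connected proper subgroup scheme of $G'$ that is $\delta_i^G$-horizontal for $i=1,2$.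
   Context: For a matrix $a=(a_{ij})$, $a^t$ is the transpose and $a^{(p)}=(a_{ij}^p)$; set maps between rings are applied to matrices entrywise. A Frobenius lift on a ring $A$ is a ring endomorphism reducing mod $p$ to the $p$-power Frobenius of $A/pA$. On a $p$-torsion free ring a $p$-derivation $\delta$ is the same as a Frobenius lift $\phi$, via $\phi(a)=a^p+p\,\delta a$ ("attached" to each other). $\widehat{\ }$ is $p$-adic completion. $\mathcal O$ has a unique Frobenius lift $\phi$, hence a unique $p$-derivation $\delta$. Let $x$ be an $n\times n$ matrix of indeterminates (here $n=2$), $G=GL_n=\mathrm{Spec}\,\mathcal O[x,\det(x)^{ -1}]$, $\mathcal O(\widehat G)=\mathcal O[x,\det(x)^{ -1}]^{\widehat{\ }}$. A $p$-adic connection on $G$ is a $p$-derivation $\delta^G$ on $\mathcal O(\widehat G)$ extending $\delta$; its attached Frobenius lift is $\phi^G$. The trivial one has Frobenius lift $\phi_0^G$ with $\phi_0^G(x)=x^{(p)}$. For a symmetric $q\in GL_n(\mathcal O)$, let $\mathcal H_q:\mathcal O(\widehat G)\to\mathcal O(\widehat G)$ be the (continuous) $\mathcal O$-algebra map with $\mathcal H_q(x)=x^tqx$; $\delta^G$ is metric with respect to $q$ if $\phi^G\circ\mathcal H_q=\mathcal H_q\circ\phi_0^G$ as ring endomorphisms of $\mathcal O(\widehat G)$. Levi-Civita connection attached to symmetric $q_1,\dots,q_n\in GL_n(\mathcal O)$: the unique (it exists and is unique) $n$-tuple $(\delta_1^G,\dots,\delta_n^G)$ of $p$-adic connections on $G$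 such that each $\delta_i^G$ is metric with respect to $q_i$ and such that, with $\Gamma_i=(\Gamma_{ijk})_{j,k}:=(\delta_i^Gx)^t\cdot\phi(q_i)\cdot x^{(p)}$, one has $\Gamma_{ijk}=\Gamma_{jik}$ for all $i,j,k$. A closed subscheme $Y\subset G$ is $\delta^G$-horizontal if the ideal of $\mathcal O(\widehat G)$ defining $\widehat Y$ in $\widehat G$ is sent into itself by $\delta^G$. $G'=GL_1^c$ is the centralizer in $GL_2$ of $c=\begin{pmatrix}0&1\\-1&0\end{pmatrix}$; i.e. $G'=\mathrm{Spec}\,\mathcal O[\alpha,\beta,(\alpha^2+\beta^2)^{ -1}]$ embedded in $G$ via $x\mapsto\begin{pmatrix}\alpha&\beta\\-\beta&\alpha\end{pmatrix}$. $G''=U_1^c=\mathrm{Spec}\,\mathcal O[\alpha,\beta]/(\alpha^2+\beta^2-1)$ is the kernel of $\det:G'\to GL_1$. -}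

module Defs where

open import Level using (Level; _⊔_) renaming (suc to lsuc)
open import Algebra.Bundles using (CommutativeRing)
open import Algebra.Definitions.RawMagma using (_,_)
open import Algebra.Morphism.Bundles using (RingHomomorphism)
open import Algebra.Morphism.Structures using (IsRingHomomorphism)
open import Algebra.Structures using (IsCommutativeRing)
import Algebra.Morphism.Construct.Composition as Composition
import Algebra.Properties.AbelianGroup as AbelianGroupProperties
import Algebra.Properties.CommutativeMonoid.Sum as SumProperties
import Algebra.Properties.CommutativeSemiring.Binomial as BinomialProperties
import Algebra.Properties.CommutativeSemiring.Exp as ExpProperties
import Algebra.Properties.Group as GroupProperties
import Algebra.Properties.Ring as RingProperties
import Algebra.Properties.Semiring.Divisibility as DivisibilityProperties
import Algebra.Properties.Semiring.Mult as MultProperties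
open import Algebra.Solver.Ring.AlmostCommutativeRing using (_-Raw-AlmostCommutative⟶_; fromCommutativeRing)
import Algebra.Solver.Ring as RingSolver
open import Data.Fin.Base using (Fin; zero; suc; toℕ; fromℕ; inject₁)
open import Data.Fin.Patterns using (0F; 1F)
open import Data.Fin.Properties using (toℕ<n; toℕ-fromℕ; toℕ-inject₁)
open import Data.Integer.Base as ℤ using (ℤ; +_; -[1+_])
import Data.Integer.Properties as ℤ
open import Data.Maybe.Base using (Maybe; just; nothing)
open import Data.Nat.Base as ℕ using (ℕ; zero; suc; _!)
open import Data.Nat.Combinatorics using (_C_; nCk≡n!/k![n-k]!; k![n∸k]!∣n!; nCn≡1)
import Data.Nat.Divisibility as ℕ
open import Data.Nat.DivMod using (m/n*n≡m)
open import Data.Nat.Primality using (Prime; euclidsLemma; ¬prime[0]; ¬prime[1])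
import Data.Nat.Properties as ℕ
open import Data.Product.Base using (∃; ∃-syntax; _,_; proj₁; proj₂) renaming (_×_ to _∧_)
open import Data.Sum.Base using (_⊎_; inj₁; inj₂)
open import Data.Unit.Base using (⊤; tt)
open import Function.Definitions using (Bijective)
import Relation.Binary.Reasoning.Setoid as SetoidReasoning
open import Relation.Binary.PropositionalEquality.Core as ≡ using (_≡_)
open import Relation.Nullary.Decidable.Core using (yes; no)
open import Relation.Nullary.Negation.Core using (¬_; contradiction)

private
  variable
    a ℓa b ℓb c ℓ e ℓe i : Level

module CRing (A : CommutativeRing a ℓa) where
  open CommutativeRing A public hiding (zero)
  open DivisibilityProperties semiring public using (_∣_)
  open MultProperties semiring public renaming (_×_ to _×ℕ_)
  open ExpProperties commutativeSemiring public
  open RingProperties ring public using (-‿distribˡ-*)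
  open GroupProperties +-group public using (inverseˡ-unique; ε⁻¹≈ε; x∙y⁻¹≈ε⇒x≈y; x≈y⇒x∙y⁻¹≈ε; identityʳ-unique; ⁻¹-involutive)
  open AbelianGroupProperties +-abelianGroup public using (⁻¹-∙-comm)

  fromℤ : ℤ → Carrier
  fromℤ (+ n)     = n ×ℕ 1#
  fromℤ (-[1+ n ]) = - (suc n ×ℕ 1#)

  private
    open SetoidReasoning setoid

    fromℤ-⊖ : ∀ m n → fromℤ (m ℤ.⊖ n) ≈ m ×ℕ 1# - n ×ℕ 1#
    fromℤ-⊖ zero    zero    = sym (-‿inverseʳ 0#)
    fromℤ-⊖ zero    (suc n) = sym (+-identityˡ _)
    fromℤ-⊖ (suc m) zero    = sym (trans (+-congˡ ε⁻¹≈ε) (+-identityʳ _))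
    fromℤ-⊖ (suc m) (suc n) = begin
      fromℤ (suc m ℤ.⊖ suc n)                 ≡⟨ ≡.cong fromℤ (ℤ.[1+m]⊖[1+n]≡m⊖n m n) ⟩
      fromℤ (m ℤ.⊖ n)                         ≈⟨ fromℤ-⊖ m n ⟩
      M - N                                   ≈⟨ +-identityˡ _ ⟨
      0# + (M - N)                            ≈⟨ +-congʳ (-‿inverseʳ 1#) ⟨
      (1# - 1#) + (M - N)                     ≈⟨ +-assoc _ _ _ ⟩
      1# + (- 1# + (M - N))                   ≈⟨ +-congˡ (+-assoc _ _ _) ⟨
      1# + ((- 1# + M) - N)                   ≈⟨ +-congˡ (+-congʳ (+-comm _ _)) ⟩
      1# + ((M - 1#) - N)                     ≈⟨ +-congˡ (+-assoc _ _ _) ⟩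
      1# + (M + (- 1# - N))                   ≈⟨ +-assoc _ _ _ ⟨
      (1# + M) + (- 1# - N)                   ≈⟨ +-congˡ (⁻¹-∙-comm 1# N) ⟩
      (1# + M) - (1# + N)                     ∎
      where M = m ×ℕ 1# ; N = n ×ℕ 1#

    fromℤ-neg : ∀ j → fromℤ (ℤ.- j) ≈ - fromℤ j
    fromℤ-neg (+ zero)   = sym ε⁻¹≈ε
    fromℤ-neg (+ suc n)  = refl
    fromℤ-neg (-[1+ n ]) = sym (⁻¹-involutive _)

    fromℤ-+ : ∀ j k → fromℤ (j ℤ.+ k) ≈ fromℤ j + fromℤ k
    fromℤ-+ (+ m)      (+ n)      = ×-homo-+ 1# m n
    fromℤ-+ (+ m)      (-[1+ n ]) = fromℤ-⊖ m (suc n)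
    fromℤ-+ (-[1+ m ]) (+ n)      = trans (fromℤ-⊖ n (suc m)) (+-comm _ _)
    fromℤ-+ (-[1+ m ]) (-[1+ n ]) = begin
      - (suc (suc (m ℕ.+ n)) ×ℕ 1#)         ≡⟨ ≡.cong (λ k → - (k ×ℕ 1#)) (ℕ.+-suc (suc m) n) ⟨
      - ((suc m ℕ.+ suc n) ×ℕ 1#)           ≈⟨ -‿cong (×-homo-+ 1# (suc m) (suc n)) ⟩
      - (suc m ×ℕ 1# + suc n ×ℕ 1#)         ≈⟨ ⁻¹-∙-comm _ _ ⟨
      - (suc m ×ℕ 1#) - suc n ×ℕ 1#         ∎

    fromℤ-pos* : ∀ m k → fromℤ (+ m ℤ.* k) ≈ fromℤ (+ m) * fromℤ k
    fromℤ-pos* zero    k = trans (reflexive (≡.cong fromℤ (ℤ.*-zeroˡ k))) (sym (zeroˡ _))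
    fromℤ-pos* (suc m) k = begin
      fromℤ (+ suc m ℤ.* k)             ≡⟨ ≡.cong fromℤ (ℤ.suc-* (+ m) k) ⟩
      fromℤ (k ℤ.+ + m ℤ.* k)           ≈⟨ fromℤ-+ k (+ m ℤ.* k) ⟩
      fromℤ k + fromℤ (+ m ℤ.* k)       ≈⟨ +-cong (sym (*-identityˡ _)) (fromℤ-pos* m k) ⟩
      1# * fromℤ k + m ×ℕ 1# * fromℤ k  ≈⟨ distribʳ _ _ _ ⟨
      (1# + m ×ℕ 1#) * fromℤ k          ∎

    fromℤ-* : ∀ j k → fromℤ (j ℤ.* k) ≈ fromℤ j * fromℤ k
    fromℤ-* (+ m)      k = fromℤ-pos* m k
    fromℤ-* (-[1+ m ]) k = begin
      fromℤ (-[1+ m ] ℤ.* k)            ≡⟨ ≡.cong fromℤ (ℤ.neg-distribˡ-* (+ suc m) k) ⟨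
      fromℤ (ℤ.- (+ suc m ℤ.* k))       ≈⟨ fromℤ-neg (+ suc m ℤ.* k) ⟩
      - fromℤ (+ suc m ℤ.* k)           ≈⟨ -‿cong (fromℤ-pos* (suc m) k) ⟩
      - (suc m ×ℕ 1# * fromℤ k)         ≈⟨ -‿distribˡ-* _ _ ⟩
      - (suc m ×ℕ 1#) * fromℤ k         ∎

    ℤ⟶A : ℤ.+-*-rawRing -Raw-AlmostCommutative⟶ fromCommutativeRing A
    ℤ⟶A = record
      { ⟦_⟧    = fromℤ
      ; +-homo = fromℤ-+
      ; *-homo = fromℤ-*
      ; -‿homo = fromℤ-neg
      ; 0-homo = refl
      ; 1-homo = +-identityʳ 1#
      }

    coeff≟ : ∀ j k → Maybe (fromℤ j ≈ fromℤ k)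
    coeff≟ j k with j ℤ.≟ k
    ... | yes j≡k = just (reflexive (≡.cong fromℤ j≡k))
    ... | no _    = nothing

  module Solver = RingSolver ℤ.+-*-rawRing (fromCommutativeRing A) ℤ⟶A coeff≟

infix 4 _⟶_
_⟶_ : CommutativeRing a ℓa → CommutativeRing b ℓb → Set (a ⊔ ℓa ⊔ b ⊔ ℓb)
A ⟶ B = RingHomomorphism (CommutativeRing.rawRing A) (CommutativeRing.rawRing B)

infixr 9 _∘ʰ_
_∘ʰ_ : {A : CommutativeRing a ℓa} {B : CommutativeRing b ℓb} {E : CommutativeRing e ℓe} →
       B ⟶ E → A ⟶ B → A ⟶ E
_∘ʰ_ {A = A} {B} {E} g f = Composition.ringHomomorphism
  {M₁ = CommutativeRing.ring A} {M₂ = CommutativeRing.ring B} {M₃ = CommutativeRing.ring E} f g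

module _ {A : CommutativeRing a ℓa} {B : CommutativeRing b ℓb} where
  private
    module A = CRing A
    module B = CRing B

  mkHom : (f : A.Carrier → B.Carrier) →
          (∀ {x y} → x A.≈ y → f x B.≈ f y) →
          (∀ x y → f (x A.+ y) B.≈ f x B.+ f y) →
          (∀ x y → f (x A.* y) B.≈ f x B.* f y) →
          f A.1# B.≈ B.1# →
          A ⟶ B
  mkHom f f-cong f-+ f-* f-1 = record
    { ⟦_⟧ = f
    ; isRingHomomorphism = isHom }
    where
    abstract
      f-0 : f A.0# B.≈ B.0#
      f-0 = B.identityʳ-unique (f A.0#) (f A.0#)
        (B.trans (B.sym (f-+ _ _)) (f-cong (A.+-identityˡ A.0#)))

      isHom : IsRingHomomorphism A.rawRing B.rawRing f
      isHom = record
        { isSemiringHomomorphism = record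
          { isNearSemiringHomomorphism = record
            { +-isMonoidHomomorphism = record
              { isMagmaHomomorphism = record
                { isRelHomomorphism = record { cong = f-cong }
                ; homo = f-+ }
              ; ε-homo = f-0 }
            ; *-homo = f-* }
          ; 1#-homo = f-1 }
        ; -‿homo = λ x → B.inverseˡ-unique _ _
            (B.trans (B.sym (f-+ _ _)) (B.trans (f-cong (A.-‿inverseˡ x)) f-0)) }

  module Hom (f : A ⟶ B) where
    open RingHomomorphism f public

    -homo : ∀ x y → ⟦ x A.- y ⟧ B.≈ ⟦ x ⟧ B.- ⟦ y ⟧
    -homo x y = B.trans (+-homo x (A.- y)) (B.+-congˡ (-‿homo y))

    ×ℕ-homo : ∀ n x → ⟦ n A.×ℕ x ⟧ B.≈ n B.×ℕ ⟦ x ⟧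
    ×ℕ-homo zero    x = 0#-homo
    ×ℕ-homo (suc n) x = B.trans (+-homo _ _) (B.+-congˡ (×ℕ-homo n x))

    ^-homo : ∀ x n → ⟦ x A.^ n ⟧ B.≈ ⟦ x ⟧ B.^ n
    ^-homo x zero    = 1#-homo
    ^-homo x (suc n) = B.trans (*-homo _ _) (B.*-congˡ (^-homo x n))

record Ideal (A : CommutativeRing a ℓa) (i : Level) : Set (a ⊔ ℓa ⊔ lsuc i) where
  open CommutativeRing A
  infix 4 _∈I
  field
    _∈I  : Carrier → Set i
    resp : ∀ {x y} → x ≈ y → x ∈I → y ∈I
    0∈   : 0# ∈I
    +∈   : ∀ {x y} → x ∈I → y ∈I → x + y ∈I
    *∈   : ∀ x {y} → y ∈I → x * y ∈I

principal : (A : CommutativeRing a ℓa) → CommutativeRing.Carrier A → Ideal A (a ⊔ ℓa)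
principal A t = record
  { _∈I  = λ x → t ∣ x
  ; resp = λ { x≈y (q , eq) → q , trans eq x≈y }
  ; 0∈   = 0# , zeroˡ t
  ; +∈   = λ { (q , eq) (r , eq′) → q + r , trans (distribʳ t q r) (+-cong eq eq′) }
  ; *∈   = λ { x (q , eq) → x * q , trans (*-assoc x q t) (*-congˡ eq) }
  }
  where open CRing A

infixl 7 _/_
_/_ : (A : CommutativeRing a ℓa) → Ideal A i → CommutativeRing a i
A / I = record
  { Carrier = Carrier
  ; _≈_ = _≋_
  ; _+_ = _+_
  ; _*_ = _*_
  ; -_ = -_
  ; 0# = 0#
  ; 1# = 1#
  ; isCommutativeRing = isCommutativeRing/
  }
  where
  open CRing A
  open Solver
  open Ideal I
  infix 4 _≋_
  _≋_ : Carrier → Carrier → Set _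
  x ≋ y = x - y ∈I
  ≈⇒≋ : ∀ {x y} → x ≈ y → x ≋ y
  ≈⇒≋ x≈y = resp (sym (x≈y⇒x∙y⁻¹≈ε x≈y)) 0∈
  abstract
    isCommutativeRing/ : IsCommutativeRing _≋_ _+_ _*_ -_ 0# 1#
    isCommutativeRing/ = record
      { isRing = record
        { +-isAbelianGroup = record
          { isGroup = record
            { isMonoid = record
              { isSemigroup = record
                { isMagma = record
                  { isEquivalence = record
                    { refl = ≈⇒≋ refl
                    ; sym = λ {x} {y} x≋y → resp
                        (solve 2 (λ x y → con (ℤ.- (+ 1)) :* (x :- y) := y :- x) refl x y)
                        (*∈ _ x≋y)
                    ; trans = λ {x} {y} {z} x≋y y≋z → resp
                        (solve 3 (λ x y z → (x :- y) :+ (y :- z) := x :- z) refl x y z)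
                        (+∈ x≋y y≋z) }
                  ; ∙-cong = λ {x} {y} {u} {v} x≋y u≋v → resp
                      (solve 4 (λ x y u v → (x :- y) :+ (u :- v) := (x :+ u) :- (y :+ v)) refl x y u v)
                      (+∈ x≋y u≋v) }
                ; assoc = λ x y z → ≈⇒≋ (+-assoc x y z) }
              ; identity = (λ x → ≈⇒≋ (+-identityˡ x)) , (λ x → ≈⇒≋ (+-identityʳ x)) }
            ; inverse = (λ x → ≈⇒≋ (-‿inverseˡ x)) , (λ x → ≈⇒≋ (-‿inverseʳ x))
            ; ⁻¹-cong = λ {x} {y} x≋y → resp
                (solve 2 (λ x y → con (ℤ.- (+ 1)) :* (x :- y) := :- x :- :- y) refl x y)
                (*∈ _ x≋y) }
          ; comm = λ x y → ≈⇒≋ (+-comm x y) }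
        ; *-cong = λ {x} {y} {u} {v} x≋y u≋v → resp
            (solve 4 (λ x y u v → u :* (x :- y) :+ y :* (u :- v) := x :* u :- y :* v) refl x y u v)
            (+∈ (*∈ u x≋y) (*∈ y u≋v))
        ; *-assoc = λ x y z → ≈⇒≋ (*-assoc x y z)
        ; *-identity = (λ x → ≈⇒≋ (*-identityˡ x)) , (λ x → ≈⇒≋ (*-identityʳ x))
        ; distrib = (λ x y z → ≈⇒≋ (distribˡ x y z)) , (λ x y z → ≈⇒≋ (distribʳ x y z)) }
      ; *-comm = λ x y → ≈⇒≋ (*-comm x y) }

quotientMap : (A : CommutativeRing a ℓa) (I : Ideal A i) → A ⟶ A / I
quotientMap A I = mkHom {A = A} {B = A / I} (λ x → x)
  (λ x≈y → resp (sym (x≈y⇒x∙y⁻¹≈ε x≈y)) 0∈)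
  (λ _ _ → Q.refl) (λ _ _ → Q.refl) Q.refl
  where
  open CRing A
  open Ideal I
  module Q = CommutativeRing (A / I)

module PAdic (p : ℕ) where

  _mod_ : CommutativeRing a ℓa → ℕ → CommutativeRing a (a ⊔ ℓa)
  A mod n = A / principal A ((p ×ℕ 1#) ^ n)
    where open CRing A

  reduce : (A : CommutativeRing a ℓa) → ∀ n → A ⟶ A mod n
  reduce A n = quotientMap A (principal A ((p ×ℕ 1#) ^ n))
    where open CRing A

  -- The p-adic completion, as the inverse limit of the rings A/pⁿA: compatible
  -- sequences, compared componentwise.
  module _ (A : CommutativeRing a ℓa) where
    private
      module A = CRing A
      module M n = CRing (A mod n)
      module π n = Hom {A = A} {B = A mod n} (reduce A n)

    record Completed : Set (a ⊔ ℓa) where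
      field
        at       : ℕ → A.Carrier
        coherent : ∀ n → M._≈_ n (at (suc n)) (at n)
    open Completed

    infix 4 _≈̂_
    record _≈̂_ (x y : Completed) : Set (a ⊔ ℓa) where
      constructor componentwise
      field
        at-≈ : ∀ n → M._≈_ n (at x n) (at y n)
    open _≈̂_

    private
      _+̂_ _*̂_ : Completed → Completed → Completed
      x +̂ y = record
        { at = λ n → at x n A.+ at y n
        ; coherent = λ n → M.+-cong n (coherent x n) (coherent y n) }
      x *̂ y = record
        { at = λ n → at x n A.* at y n
        ; coherent = λ n → M.*-cong n (coherent x n) (coherent y n) }

      -̂_ : Completed → Completed
      -̂ x = record
        { at = λ n → A.- at x n
        ; coherent = λ n → M.-‿cong n (coherent x n) }

      constantSequence : A.Carrier → Completed
      constantSequence x = record { at = λ _ → x ; coherent = λ n → M.refl n }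

      abstract
        isCommutativeRinĝ : IsCommutativeRing _≈̂_ _+̂_ _*̂_ -̂_ (constantSequence A.0#) (constantSequence A.1#)
        isCommutativeRinĝ = record
          { isRing = record
            { +-isAbelianGroup = record
              { isGroup = record
                { isMonoid = record
                  { isSemigroup = record
                    { isMagma = record
                      { isEquivalence = record
                        { refl  = componentwise λ n → M.refl n
                        ; sym   = λ x≈y → componentwise λ n → M.sym n (at-≈ x≈y n)
                        ; trans = λ x≈y y≈z → componentwise λ n → M.trans n (at-≈ x≈y n) (at-≈ y≈z n) }
                      ; ∙-cong = λ x≈y u≈v → componentwise λ n → M.+-cong n (at-≈ x≈y n) (at-≈ u≈v n) }
                    ; assoc = λ x y z → componentwise λ n → M.+-assoc n (at x n) (at y n) (at z n) }
                  ; identity = (λ x → componentwise λ n → M.+-identityˡ n (at x n)) , (λ x → componentwise λ n → M.+-identityʳ n (at x n)) }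
                ; inverse = (λ x → componentwise λ n → M.-‿inverseˡ n (at x n)) , (λ x → componentwise λ n → M.-‿inverseʳ n (at x n))
                ; ⁻¹-cong = λ x≈y → componentwise λ n → M.-‿cong n (at-≈ x≈y n) }
              ; comm = λ x y → componentwise λ n → M.+-comm n (at x n) (at y n) }
            ; *-cong = λ x≈y u≈v → componentwise λ n → M.*-cong n (at-≈ x≈y n) (at-≈ u≈v n)
            ; *-assoc = λ x y z → componentwise λ n → M.*-assoc n (at x n) (at y n) (at z n)
            ; *-identity = (λ x → componentwise λ n → M.*-identityˡ n (at x n)) , (λ x → componentwise λ n → M.*-identityʳ n (at x n))
            ; distrib = (λ x y z → componentwise λ n → M.distribˡ n (at x n) (at y n) (at z n))
                      , (λ x y z → componentwise λ n → M.distribʳ n (at x n) (at y n) (at z n)) }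
          ; *-comm = λ x y → componentwise λ n → M.*-comm n (at x n) (at y n) }

    completion : CommutativeRing (a ⊔ ℓa) (a ⊔ ℓa)
    completion = record
      { Carrier = Completed
      ; _≈_ = _≈̂_
      ; _+_ = _+̂_
      ; _*_ = _*̂_
      ; -_ = -̂_
      ; 0# = constantSequence A.0#
      ; 1# = constantSequence A.1#
      ; isCommutativeRing = isCommutativeRinĝ }

    ι : A ⟶ completion
    ι = mkHom {A = A} {B = completion}
      constantSequence
      (λ x≈y → componentwise λ n → π.⟦⟧-cong n x≈y)
      (λ _ _ → componentwise λ n → M.refl n)
      (λ _ _ → componentwise λ n → M.refl n)
      (componentwise λ n → M.refl n)

  open Completed public
  open _≈̂_ public

  IsComplete : CommutativeRing a ℓa → Set (a ⊔ ℓa)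
  IsComplete A = Bijective (CommutativeRing._≈_ A) (CommutativeRing._≈_ (completion A))
    (RingHomomorphism.⟦_⟧ (ι A))

  module _ {A : CommutativeRing a ℓa} {B : CommutativeRing b ℓb} where
    private
      module A = CRing A
      module B = CRing B
      module M n = CRing (B mod n)

      abstract
        mod-cong : ∀ n (f : A ⟶ B mod n) {x y} →
                   CommutativeRing._≈_ (A mod n) x y →
                   M._≈_ n (RingHomomorphism.⟦_⟧ f x) (RingHomomorphism.⟦_⟧ f y)
        mod-cong n f {x} {y} (q , qP≈x-y) = N.x∙y⁻¹≈ε⇒x≈y _ _ (begin
          F.⟦ x ⟧ N.- F.⟦ y ⟧          ≈⟨ F.-homo x y ⟨
          F.⟦ x A.- y ⟧                ≈⟨ F.⟦⟧-cong qP≈x-y ⟨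
          F.⟦ q A.* Pᴬ A.^ n ⟧         ≈⟨ F.*-homo _ _ ⟩
          F.⟦ q ⟧ N.* F.⟦ Pᴬ A.^ n ⟧   ≈⟨ N.*-congˡ fP≈0 ⟩
          F.⟦ q ⟧ N.* N.0#             ≈⟨ N.zeroʳ _ ⟩
          N.0#                         ∎)
          where
          module N = CRing (B mod n)
          module F = Hom {A = A} {B = B mod n} f
          module π = Hom {A = B} {B = B mod n} (reduce B n)
          open SetoidReasoning N.setoid
          Pᴬ : A.Carrier
          Pᴬ = p A.×ℕ A.1#
          fP≈0 : F.⟦ Pᴬ A.^ n ⟧ N.≈ N.0#
          fP≈0 = begin
            F.⟦ Pᴬ A.^ n ⟧             ≈⟨ F.^-homo Pᴬ n ⟩
            F.⟦ Pᴬ ⟧ N.^ n             ≈⟨ N.^-congˡ n (N.trans (F.×ℕ-homo p A.1#) (N.×-congʳ p F.1#-homo)) ⟩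
            (p N.×ℕ N.1#) N.^ n        ≈⟨ N.^-congˡ n (π.×ℕ-homo p B.1#) ⟨
            (p B.×ℕ B.1#) N.^ n        ≈⟨ π.^-homo (p B.×ℕ B.1#) n ⟨
            (p B.×ℕ B.1#) B.^ n        ≈⟨ B.1# , B.trans (B.*-identityˡ _) (B.sym (B.trans (B.+-congˡ B.ε⁻¹≈ε) (B.+-identityʳ _))) ⟩
            N.0#                       ∎

      component : A ⟶ completion B → ∀ n → A ⟶ B mod n
      component g n = mkHom {A = A} {B = B mod n} (λ x → at G.⟦ x ⟧ n)
        (λ x≈y → at-≈ (G.⟦⟧-cong x≈y) n) (λ x y → at-≈ (G.+-homo x y) n)
        (λ x y → at-≈ (G.*-homo x y) n) (at-≈ G.1#-homo n)
        where module G = RingHomomorphism g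

    -- The continuous extension of g to the completion.
    extend : A ⟶ completion B → completion A ⟶ completion B
    extend g = mkHom {A = completion A} {B = completion B}
      (λ x → record
        { at = λ n → at G.⟦ at x n ⟧ n
        ; coherent = λ n → M.trans n
            (coherent G.⟦ at x (suc n) ⟧ n)
            (mod-cong n (component g n) (coherent x n)) })
      (λ x≈y → componentwise λ n → mod-cong n (component g n) (at-≈ x≈y n))
      (λ x y → componentwise λ n → at-≈ (G.+-homo (at x n) (at y n)) n)
      (λ x y → componentwise λ n → at-≈ (G.*-homo (at x n) (at y n)) n)
      (componentwise λ n → at-≈ G.1#-homo n)
      where module G = RingHomomorphism g

    completionMap : A ⟶ B → completion A ⟶ completion B
    completionMap f = extend (_∘ʰ_ {A = A} {B = B} {E = completion B} (ι B) f)

module Matrix (A : CommutativeRing a ℓa) where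
  open CRing A

  Mat : Set a
  Mat = Fin 2 → Fin 2 → Carrier

  infix 4 _≈ᴹ_
  _≈ᴹ_ : Mat → Mat → Set ℓa
  m ≈ᴹ n = ∀ i j → m i j ≈ n i j

  _ᵀ : Mat → Mat
  (m ᵀ) i j = m j i

  infixl 7 _*ᴹ_
  _*ᴹ_ : Mat → Mat → Mat
  (m *ᴹ n) i j = m i 0F * n 0F j + m i 1F * n 1F j

  mat : Carrier → Carrier → Carrier → Carrier → Mat
  mat x y z w 0F 0F = x
  mat x y z w 0F 1F = y
  mat x y z w 1F 0F = z
  mat x y z w 1F 1F = w

  det : Mat → Carrier
  det m = m 0F 0F * m 1F 1F - m 0F 1F * m 1F 0F

  record GL₂ : Set (a ⊔ ℓa) where
    field
      matrix : Mat
      det⁻¹  : Carrier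
      det*det⁻¹≈1 : det matrix * det⁻¹ ≈ 1#

  record Unit : Set (a ⊔ ℓa) where
    field
      value   : Carrier
      inverse : Carrier
      value*inverse≈1 : value * inverse ≈ 1#

  record SymGL₂ : Set (a ⊔ ℓa) where
    field
      gl₂ : GL₂
    open GL₂ gl₂ public
    field
      symmetric : matrix ᵀ ≈ᴹ matrix

  scalar : Unit → SymGL₂
  scalar u = record
    { gl₂ = record
      { matrix = mat value 0# 0# value
      ; det⁻¹ = inverse * inverse
      ; det*det⁻¹≈1 = unit }
    ; symmetric = λ { 0F 0F → refl ; 0F 1F → refl ; 1F 0F → refl ; 1F 1F → refl }
    }
    where
    open Unit u
    open Solver
    open SetoidReasoning setoid
    abstract
      unit : (value * value - 0# * 0#) * (inverse * inverse) ≈ 1#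
      unit = begin
        (value * value - 0# * 0#) * (inverse * inverse)
          ≈⟨ solve 2 (λ v w → (v :* v :- con (+ 0) :* con (+ 0)) :* (w :* w) := (v :* w) :* (v :* w)) refl value inverse ⟩
        (value * inverse) * (value * inverse)  ≈⟨ *-cong value*inverse≈1 value*inverse≈1 ⟩
        1# * 1#                                ≈⟨ *-identityˡ 1# ⟩
        1#                                     ∎

-- The 𝒪-algebra generated by Gen subject to the relations lhs r = rhs r: terms
-- modulo the congruence generated by the commutative ring axioms, the
-- arithmetic of 𝒪 and the relations. Thus 𝒪[x, det(x)⁻¹] is obtained from
-- generators xᵢⱼ, 1/det and the relation det(x) · 1/det = 1.
module Presented (𝒪 : CommutativeRing c ℓ) where
  private module 𝒪 = CommutativeRing 𝒪

  infixl 6 _⊕_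
  infixl 7 _⊗_
  data Term (X : Set) : Set c where
    var     : X → Term X
    con     : 𝒪.Carrier → Term X
    _⊕_ _⊗_ : Term X → Term X → Term X
    ⊝_      : Term X → Term X

  record Presentation : Set (lsuc c) where
    field
      Gen Rel : Set
      lhs rhs : Rel → Term Gen

  module _ (P : Presentation) where
    open Presentation P

    infix 4 _∼_
    data _∼_ : Term Gen → Term Gen → Set (c ⊔ ℓ) where
      ∼-refl  : ∀ {s} → s ∼ s
      ∼-sym   : ∀ {s t} → s ∼ t → t ∼ s
      ∼-trans : ∀ {s t u} → s ∼ t → t ∼ u → s ∼ u
      ⊕-cong  : ∀ {s t u v} → s ∼ t → u ∼ v → s ⊕ u ∼ t ⊕ v
      ⊗-cong  : ∀ {s t u v} → s ∼ t → u ∼ v → s ⊗ u ∼ t ⊗ v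
      ⊝-cong  : ∀ {s t} → s ∼ t → ⊝ s ∼ ⊝ t
      ⊕-assoc : ∀ s t u → (s ⊕ t) ⊕ u ∼ s ⊕ (t ⊕ u)
      ⊕-comm  : ∀ s t → s ⊕ t ∼ t ⊕ s
      ⊕-identity : ∀ s → con 𝒪.0# ⊕ s ∼ s
      ⊕-inverse  : ∀ s → ⊝ s ⊕ s ∼ con 𝒪.0#
      ⊗-assoc : ∀ s t u → (s ⊗ t) ⊗ u ∼ s ⊗ (t ⊗ u)
      ⊗-comm  : ∀ s t → s ⊗ t ∼ t ⊗ s
      ⊗-identity : ∀ s → con 𝒪.1# ⊗ s ∼ s
      distrib : ∀ s t u → s ⊗ (t ⊕ u) ∼ (s ⊗ t) ⊕ (s ⊗ u)
      con-cong : ∀ {x y} → x 𝒪.≈ y → con x ∼ con y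
      con-⊕   : ∀ x y → con (x 𝒪.+ y) ∼ con x ⊕ con y
      con-⊗   : ∀ x y → con (x 𝒪.* y) ∼ con x ⊗ con y
      relation : ∀ r → lhs r ∼ rhs r

    algebra : CommutativeRing c (c ⊔ ℓ)
    algebra = record
      { Carrier = Term Gen
      ; _≈_ = _∼_
      ; _+_ = _⊕_
      ; _*_ = _⊗_
      ; -_ = ⊝_
      ; 0# = con 𝒪.0#
      ; 1# = con 𝒪.1#
      ; isCommutativeRing = isCommutativeRing
      }
      where
      abstract
        isCommutativeRing : IsCommutativeRing _∼_ _⊕_ _⊗_ ⊝_ (con 𝒪.0#) (con 𝒪.1#)
        isCommutativeRing = record
          { isRing = record
            { +-isAbelianGroup = record
              { isGroup = record
                { isMonoid = record
                  { isSemigroup = record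
                    { isMagma = record
                      { isEquivalence = record { refl = ∼-refl ; sym = ∼-sym ; trans = ∼-trans }
                      ; ∙-cong = ⊕-cong }
                    ; assoc = ⊕-assoc }
                  ; identity = ⊕-identity , λ s → ∼-trans (⊕-comm _ _) (⊕-identity s) }
                ; inverse = ⊕-inverse , λ s → ∼-trans (⊕-comm _ _) (⊕-inverse s)
                ; ⁻¹-cong = ⊝-cong }
              ; comm = ⊕-comm }
            ; *-cong = ⊗-cong
            ; *-assoc = ⊗-assoc
            ; *-identity = ⊗-identity , λ s → ∼-trans (⊗-comm _ _) (⊗-identity s)
            ; distrib = distrib , λ s t u → ∼-trans (⊗-comm _ _)
                (∼-trans (distrib s t u) (⊕-cong (⊗-comm _ _) (⊗-comm _ _))) }
          ; *-comm = ⊗-comm }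

    structureMap : 𝒪 ⟶ algebra
    structureMap = mkHom {A = 𝒪} {B = algebra} con con-cong con-⊕ con-⊗ ∼-refl

    module _ (B : CommutativeRing b ℓb) (σ : 𝒪 ⟶ B) where
      private
        module B = CommutativeRing B
        module σ = RingHomomorphism σ

      ⟦_⟧ₜ : Term Gen → (Gen → B.Carrier) → B.Carrier
      ⟦ var x ⟧ₜ v = v x
      ⟦ con k ⟧ₜ v = σ.⟦ k ⟧
      ⟦ s ⊕ t ⟧ₜ v = ⟦ s ⟧ₜ v B.+ ⟦ t ⟧ₜ v
      ⟦ s ⊗ t ⟧ₜ v = ⟦ s ⟧ₜ v B.* ⟦ t ⟧ₜ v
      ⟦ ⊝ s ⟧ₜ v   = B.- ⟦ s ⟧ₜ v

      eval : (v : Gen → B.Carrier) → (∀ r → ⟦ lhs r ⟧ₜ v B.≈ ⟦ rhs r ⟧ₜ v) → algebra ⟶ B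
      eval v sat = mkHom {A = algebra} {B = B} (λ t → ⟦ t ⟧ₜ v) sound
        (λ _ _ → B.refl) (λ _ _ → B.refl) σ.1#-homo
        where
        abstract
         sound : ∀ {s t} → s ∼ t → ⟦ s ⟧ₜ v B.≈ ⟦ t ⟧ₜ v
         sound ∼-refl           = B.refl
         sound (∼-sym e)        = B.sym (sound e)
         sound (∼-trans e f)    = B.trans (sound e) (sound f)
         sound (⊕-cong e f)     = B.+-cong (sound e) (sound f)
         sound (⊗-cong e f)     = B.*-cong (sound e) (sound f)
         sound (⊝-cong e)       = B.-‿cong (sound e)
         sound (⊕-assoc _ _ _)  = B.+-assoc _ _ _
         sound (⊕-comm _ _)     = B.+-comm _ _
         sound (⊕-identity _)   = B.trans (B.+-congʳ σ.0#-homo) (B.+-identityˡ _)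
         sound (⊕-inverse _)    = B.trans (B.-‿inverseˡ _) (B.sym σ.0#-homo)
         sound (⊗-assoc _ _ _)  = B.*-assoc _ _ _
         sound (⊗-comm _ _)     = B.*-comm _ _
         sound (⊗-identity _)   = B.trans (B.*-congʳ σ.1#-homo) (B.*-identityˡ _)
         sound (distrib _ _ _)  = B.distribˡ _ _ _
         sound (con-cong x≈y)   = σ.⟦⟧-cong x≈y
         sound (con-⊕ x y)      = σ.+-homo x y
         sound (con-⊗ x y)      = σ.*-homo x y
         sound (relation r)     = sat r

module Groups (𝒪 : CommutativeRing c ℓ) where
  private module 𝒪 = CommutativeRing 𝒪
  open Presented 𝒪 public

  data GenG : Set where
    x     : Fin 2 → Fin 2 → GenG
    1/det : GenG

  𝒪[G]-presentation : Presentation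
  𝒪[G]-presentation = record
    { Gen = GenG
    ; Rel = ⊤
    ; lhs = λ _ → (var (x 0F 0F) ⊗ var (x 1F 1F) ⊕ ⊝ (var (x 0F 1F) ⊗ var (x 1F 0F))) ⊗ var 1/det
    ; rhs = λ _ → con 𝒪.1#
    }

  data GenG′ : Set where
    α β 1/N : GenG′

  -- 𝒪[α, β, (α² + β²)⁻¹]
  𝒪[G′]-presentation : Presentation
  𝒪[G′]-presentation = record
    { Gen = GenG′
    ; Rel = ⊤
    ; lhs = λ _ → (var α ⊗ var α ⊕ var β ⊗ var β) ⊗ var 1/N
    ; rhs = λ _ → con 𝒪.1#
    }

  data GenG″ : Set where
    α β : GenG″

  -- 𝒪[α, β] / (α² + β² - 1)
  𝒪[G″]-presentation : Presentation
  𝒪[G″]-presentation = record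
    { Gen = GenG″
    ; Rel = ⊤
    ; lhs = λ _ → var α ⊗ var α ⊕ var β ⊗ var β
    ; rhs = λ _ → con 𝒪.1#
    }

  𝒪[G] 𝒪[G′] 𝒪[G″] : CommutativeRing c (c ⊔ ℓ)
  𝒪[G]  = algebra 𝒪[G]-presentation
  𝒪[G′] = algebra 𝒪[G′]-presentation
  𝒪[G″] = algebra 𝒪[G″]-presentation

  universal : Matrix.GL₂ 𝒪[G]
  universal = record
    { matrix = λ i j → var (x i j)
    ; det⁻¹ = var 1/det
    ; det*det⁻¹≈1 = relation tt
    }

  evalG : (B : CommutativeRing b ℓb) → 𝒪 ⟶ B → Matrix.GL₂ B → 𝒪[G] ⟶ B
  evalG B σ g = eval 𝒪[G]-presentation B σ
    (λ { (x i j) → g.matrix i j ; 1/det → g.det⁻¹ })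
    (λ _ → B.trans g.det*det⁻¹≈1 (B.sym (RingHomomorphism.1#-homo σ)))
    where
    module B = CommutativeRing B
    module g = Matrix.GL₂ g

  record PointG′ (B : CommutativeRing b ℓb) : Set (b ⊔ ℓb) where
    open CommutativeRing B
    field
      a₁ a₂ n⁻¹ : Carrier
      norm*n⁻¹≈1 : (a₁ * a₁ + a₂ * a₂) * n⁻¹ ≈ 1#

  evalG′ : (B : CommutativeRing b ℓb) → 𝒪 ⟶ B → PointG′ B → 𝒪[G′] ⟶ B
  evalG′ B σ g = eval 𝒪[G′]-presentation B σ
    (λ { α → g.a₁ ; β → g.a₂ ; 1/N → g.n⁻¹ })
    (λ _ → B.trans g.norm*n⁻¹≈1 (B.sym (RingHomomorphism.1#-homo σ)))
    where
    module B = CommutativeRing B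
    module g = PointG′ g

  module _ {B : CommutativeRing b ℓb} where
    private
      module B = CRing B
      open B using (_≈_; _+_; _*_; _-_; -_; 0#; 1#)
      open B.Solver
      open SetoidReasoning B.setoid

    embed : PointG′ B → Matrix.GL₂ B
    embed g = record
      { matrix = Matrix.mat B a₁ a₂ (- a₂) a₁
      ; det⁻¹ = n⁻¹
      ; det*det⁻¹≈1 = unit
      }
      where
      open PointG′ g
      abstract
        unit : (a₁ * a₁ - a₂ * - a₂) * n⁻¹ ≈ 1#
        unit = B.trans
          (solve 3 (λ a b n → (a :* a :- b :* (:- b)) :* n := (a :* a :+ b :* b) :* n) B.refl a₁ a₂ n⁻¹)
          norm*n⁻¹≈1

    -- The group law is multiplication of the matrices embed g: as the centralizer
    -- of (0 1 ; -1 0), G′ is a subgroup of GL₂.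
    one : PointG′ B
    one = record
      { a₁ = 1# ; a₂ = 0# ; n⁻¹ = 1#
      ; norm*n⁻¹≈1 = unit
      }
      where
      abstract
        unit : (1# * 1# + 0# * 0#) * 1# ≈ 1#
        unit = B.trans (B.*-identityʳ _) (B.trans (B.+-cong (B.*-identityˡ 1#) (B.zeroˡ 0#)) (B.+-identityʳ 1#))

    infixl 7 _∙_
    _∙_ : PointG′ B → PointG′ B → PointG′ B
    g ∙ h = record
      { a₁ = g.a₁ * h.a₁ - g.a₂ * h.a₂
      ; a₂ = g.a₁ * h.a₂ + g.a₂ * h.a₁
      ; n⁻¹ = g.n⁻¹ * h.n⁻¹
      ; norm*n⁻¹≈1 = unit
      }
      where
      module g = PointG′ g
      module h = PointG′ h
      abstract
        unit : ((g.a₁ * h.a₁ - g.a₂ * h.a₂) * (g.a₁ * h.a₁ - g.a₂ * h.a₂) +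
                (g.a₁ * h.a₂ + g.a₂ * h.a₁) * (g.a₁ * h.a₂ + g.a₂ * h.a₁)) * (g.n⁻¹ * h.n⁻¹) ≈ 1#
        unit = begin
          _ ≈⟨ solve 6 (λ a b c d m n →
                 ((a :* c :- b :* d) :* (a :* c :- b :* d) :+ (a :* d :+ b :* c) :* (a :* d :+ b :* c)) :* (m :* n)
                 := ((a :* a :+ b :* b) :* m) :* ((c :* c :+ d :* d) :* n))
                 B.refl g.a₁ g.a₂ h.a₁ h.a₂ g.n⁻¹ h.n⁻¹ ⟩
          _ ≈⟨ B.*-cong g.norm*n⁻¹≈1 h.norm*n⁻¹≈1 ⟩
          1# * 1# ≈⟨ B.*-identityˡ 1# ⟩
          1# ∎

    infix 8 _⁻¹
    _⁻¹ : PointG′ B → PointG′ B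
    g ⁻¹ = record
      { a₁ = n⁻¹ * a₁
      ; a₂ = - (n⁻¹ * a₂)
      ; n⁻¹ = a₁ * a₁ + a₂ * a₂
      ; norm*n⁻¹≈1 = unit
      }
      where
      open PointG′ g
      abstract
        unit : ((n⁻¹ * a₁) * (n⁻¹ * a₁) + - (n⁻¹ * a₂) * - (n⁻¹ * a₂)) * (a₁ * a₁ + a₂ * a₂) ≈ 1#
        unit = begin
          _ ≈⟨ solve 3 (λ a b n →
                 ((n :* a) :* (n :* a) :+ (:- (n :* b)) :* (:- (n :* b))) :* (a :* a :+ b :* b)
                 := ((a :* a :+ b :* b) :* n) :* ((a :* a :+ b :* b) :* n))
                 B.refl a₁ a₂ n⁻¹ ⟩
          _ ≈⟨ B.*-cong norm*n⁻¹≈1 norm*n⁻¹≈1 ⟩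
          1# * 1# ≈⟨ B.*-identityˡ 1# ⟩
          1# ∎

  G′⊂G : 𝒪[G] ⟶ 𝒪[G′]
  G′⊂G = evalG 𝒪[G′] (structureMap 𝒪[G′]-presentation) (embed {B = 𝒪[G′]} record
    { a₁ = var α ; a₂ = var β ; n⁻¹ = var 1/N ; norm*n⁻¹≈1 = relation tt })

  G″⊂G′ : 𝒪[G′] ⟶ 𝒪[G″]
  G″⊂G′ = evalG′ 𝒪[G″] (structureMap 𝒪[G″]-presentation) record
    { a₁ = var α ; a₂ = var β ; n⁻¹ = con 𝒪.1#
    ; norm*n⁻¹≈1 = R.trans (R.*-identityʳ _) (relation tt) }
    where module R = CommutativeRing 𝒪[G″]

  G″⊂G : 𝒪[G] ⟶ 𝒪[G″]
  G″⊂G = _∘ʰ_ {A = 𝒪[G]} {B = 𝒪[G′]} {E = 𝒪[G″]} G″⊂G′ G′⊂G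

  module _ (q : Matrix.SymGL₂ 𝒪) where
    private
      module R = CRing 𝒪[G]
      module M = Matrix 𝒪[G]
      module q = Matrix.SymGL₂ q
      open Matrix.GL₂ universal renaming (matrix to X)
      open R.Solver

    -- The 𝒪-algebra map x ↦ xᵗ q x on 𝒪[G].
    ℋ-algebraic : 𝒪[G] ⟶ 𝒪[G]
    ℋ-algebraic = evalG 𝒪[G] (structureMap 𝒪[G]-presentation) record
      { matrix = X M.ᵀ M.*ᴹ Q M.*ᴹ X
      ; det⁻¹ = (det⁻¹ R.* det⁻¹) R.* con q.det⁻¹
      ; det*det⁻¹≈1 = unit
      }
      where
      open SetoidReasoning R.setoid
      module C = Hom {A = 𝒪} {B = 𝒪[G]} (structureMap 𝒪[G]-presentation)
      Q : M.Mat
      Q i j = con (q.matrix i j)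
      abstract
       detQ : M.det Q R.* con q.det⁻¹ R.≈ R.1#
       detQ = begin
         M.det Q R.* con q.det⁻¹  ≈⟨ R.*-congʳ (R.trans (C.-homo _ _) (R.+-cong (C.*-homo _ _) (R.-‿cong (C.*-homo _ _)))) ⟨
         con (Matrix.det 𝒪 q.matrix) R.* con q.det⁻¹ ≈⟨ C.*-homo _ _ ⟨
         con (Matrix.det 𝒪 q.matrix 𝒪.* q.det⁻¹) ≈⟨ C.⟦⟧-cong q.det*det⁻¹≈1 ⟩
         R.1# ∎

       unit : M.det (X M.ᵀ M.*ᴹ Q M.*ᴹ X) R.* ((det⁻¹ R.* det⁻¹) R.* con q.det⁻¹) R.≈ R.1#
       unit = begin
          _ ≈⟨ solve 10 (λ x y z w a b c d e f →
                  (((x :* a :+ z :* c) :* x :+ (x :* b :+ z :* d) :* z) :* ((y :* a :+ w :* c) :* y :+ (y :* b :+ w :* d) :* w)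
                :- ((x :* a :+ z :* c) :* y :+ (x :* b :+ z :* d) :* w) :* ((y :* a :+ w :* c) :* x :+ (y :* b :+ w :* d) :* z))
                :* ((e :* e) :* f)
                := (((x :* w :- y :* z) :* e) :* ((x :* w :- y :* z) :* e)) :* ((a :* d :- b :* c) :* f))
               R.refl (X 0F 0F) (X 0F 1F) (X 1F 0F) (X 1F 1F) (Q 0F 0F) (Q 0F 1F) (Q 1F 0F) (Q 1F 1F) det⁻¹ (con q.det⁻¹) ⟩
          _ ≈⟨ R.*-cong (R.*-cong det*det⁻¹≈1 det*det⁻¹≈1) detQ ⟩
          (R.1# R.* R.1#) R.* R.1# ≈⟨ R.trans (R.*-identityʳ _) (R.*-identityʳ _) ⟩
          R.1# ∎

module Frobenius (p : ℕ) (p-prime : Prime p) where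
  open PAdic p

  private
    p∤k! : ∀ k → k ℕ.< p → ¬ (p ℕ.∣ (k !))
    p∤k! zero    _   p∣1 with ℕ.∣1⇒≡1 p∣1
    ... | ≡.refl = contradiction p-prime ¬prime[1]
    p∤k! (suc k) k<p p∣k! with euclidsLemma (suc k) (k !) p-prime p∣k!
    ... | inj₁ p∣k = ℕ.<⇒≱ k<p (ℕ.∣⇒≤ p∣k)
    ... | inj₂ p∣  = p∤k! k (ℕ.<-trans (ℕ.n<1+n k) k<p) p∣

    p∣pCk : ∀ k → 0 ℕ.< k → k ℕ.< p → p ℕ.∣ (p C k)
    p∣pCk k 0<k k<p with euclidsLemma (p C k) (k ! ℕ.* (p ℕ.∸ k) !) p-prime p∣prod
      where
      p∣p! : ∀ m → 0 ℕ.< m → m ℕ.∣ (m !)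
      p∣p! (suc m) _ = ℕ.m∣m*n (m !)
      instance _ = k ℕ.!* (p ℕ.∸ k) !≢0
      p∣prod : p ℕ.∣ ((p C k) ℕ.* (k ! ℕ.* (p ℕ.∸ k) !))
      p∣prod = ≡.subst (p ℕ.∣_)
        (≡.sym (≡.trans (≡.cong (ℕ._* (k ! ℕ.* (p ℕ.∸ k) !)) (nCk≡n!/k![n-k]! (ℕ.<⇒≤ k<p)))
                        (m/n*n≡m (k![n∸k]!∣n! (ℕ.<⇒≤ k<p)))))
        (p∣p! p (ℕ.<-trans 0<k k<p))
    ... | inj₁ p∣C = p∣C
    ... | inj₂ p∣k![p-k]! with euclidsLemma (k !) ((p ℕ.∸ k) !) p-prime p∣k![p-k]!
    ...   | inj₁ p∣k!     = contradiction p∣k! (p∤k! k k<p)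
    ...   | inj₂ p∣[p-k]! = contradiction p∣[p-k]! (p∤k! (p ℕ.∸ k) (ℕ.∸-monoʳ-< 0<k (ℕ.<⇒≤ k<p)))

  module _ (A : CommutativeRing a ℓa) where
    private
      open CRing A
      open Ideal (principal A (p ×ℕ 1#))
      open SumProperties +-commutativeMonoid using (sum; sum-init-last)
      open SetoidReasoning setoid
      P = p ×ℕ 1#

      abstract
        sum∈ : ∀ n (t : Fin n → Carrier) → (∀ k → t k ∈I) → sum t ∈I
        sum∈ zero    t t∈ = 0∈
        sum∈ (suc n) t t∈ = +∈ (t∈ zero) (sum∈ n (λ k → t (suc k)) (λ k → t∈ (suc k)))

        multiple∈ : ∀ {n} z → p ℕ.∣ n → n ×ℕ z ∈I
        multiple∈ z (ℕ.divides q ≡.refl) = q ×ℕ z , (begin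
          (q ×ℕ z) * (p ×ℕ 1#)   ≈⟨ ×-comm-* p _ _ ⟩
          p ×ℕ ((q ×ℕ z) * 1#)   ≈⟨ ×-congʳ p (*-identityʳ _) ⟩
          p ×ℕ (q ×ℕ z)          ≈⟨ ×-assocˡ z p q ⟩
          (p ℕ.* q) ×ℕ z         ≡⟨ ≡.cong (_×ℕ z) (ℕ.*-comm p q) ⟩
          (q ℕ.* p) ×ℕ z         ∎)

    -- (x + y)ᵖ ≡ xᵖ + yᵖ mod p
    abstract
      frobenius-+ : ∀ x y → ∃ λ w → (x + y) ^ p ≈ (x ^ p + y ^ p) + w * P
      frobenius-+ x y = go p ≡.refl
        where
        open BinomialProperties commutativeSemiring using (binomialTerm; theorem)
        go : ∀ m → m ≡ p → ∃ λ w → (x + y) ^ p ≈ (x ^ p + y ^ p) + w * P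
        go zero ≡.refl = contradiction p-prime ¬prime[0]
        go (suc m) ≡.refl with sum∈ m (λ k → t (suc (inject₁ k))) middle
          where
          t : Fin (suc (suc m)) → Carrier
          t = binomialTerm x y (suc m)
          middle : ∀ k → t (suc (inject₁ k)) ∈I
          middle k = multiple∈ _ (p∣pCk _ (ℕ.s≤s ℕ.z≤n)
            (ℕ.s≤s (≡.subst (ℕ._< m) (≡.sym (toℕ-inject₁ k)) (toℕ<n k))))
        ... | w , wP≈ = w , (begin
          (x + y) ^ p                                      ≈⟨ theorem p x y ⟩
          t zero + sum (λ k → t (suc k))                   ≈⟨ +-cong first (sum-init-last (λ k → t (suc k))) ⟩
          y ^ p + (sum (λ k → t (suc (inject₁ k))) + t (fromℕ p)) ≈⟨ +-congˡ (+-cong (sym wP≈) last) ⟩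
          y ^ p + (w * P + x ^ p)
            ≈⟨ solve 3 (λ u v z → u :+ (v :+ z) := (z :+ u) :+ v) refl (y ^ p) (w * P) (x ^ p) ⟩
          (x ^ p + y ^ p) + w * P                          ∎)
          where
          open Solver
          t : Fin (suc p) → Carrier
          t = binomialTerm x y p
          first : t zero ≈ y ^ p
          first = trans (+-identityʳ _) (*-identityˡ _)
          last : t (fromℕ p) ≈ x ^ p
          last = begin
            (p C toℕ (fromℕ p)) ×ℕ (x ^ toℕ (fromℕ p) * y ^ (p ℕ.∸ toℕ (fromℕ p)))
              ≡⟨ ≡.cong (λ k → (p C k) ×ℕ (x ^ k * y ^ (p ℕ.∸ k))) (toℕ-fromℕ p) ⟩
            (p C p) ×ℕ (x ^ p * y ^ (p ℕ.∸ p))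
              ≡⟨ ≡.cong₂ (λ k l → k ×ℕ (x ^ p * y ^ l)) (nCn≡1 p) (ℕ.n∸n≡0 p) ⟩
            1 ×ℕ (x ^ p * 1#)   ≈⟨ +-identityʳ _ ⟩
            x ^ p * 1#          ≈⟨ *-identityʳ _ ⟩
            x ^ p               ∎

    -- If y * u ≡ 1 mod p then u is invertible in the completion, with inverse
    -- y * Σₖ (1 - y * u)ᵏ.
    module Inverse (u y r : Carrier) (yu≈1-rP : y * u ≈ 1# - r * P) where
      private
        module Â = CommutativeRing (completion A)
        module ι = RingHomomorphism (ι A)
        open Solver

        geometric : ℕ → Carrier
        geometric zero    = 0#
        geometric (suc n) = geometric n + (r * P) ^ n

        abstract
          geometric-sum : ∀ n → (1# - r * P) * geometric n ≈ 1# - (r * P) ^ n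
          geometric-sum zero    = trans (zeroʳ _) (sym (-‿inverseʳ 1#))
          geometric-sum (suc n) = begin
            (1# - s) * (geometric n + s ^ n)                ≈⟨ distribˡ _ _ _ ⟩
            (1# - s) * geometric n + (1# - s) * s ^ n       ≈⟨ +-congʳ (geometric-sum n) ⟩
            (1# - s ^ n) + (1# - s) * s ^ n
              ≈⟨ solve 3 (λ o s t → (o :- t) :+ (o :- s) :* t := o :+ (o :* t :- t) :- s :* t) refl 1# s (s ^ n) ⟩
            1# + (1# * s ^ n - s ^ n) - s * s ^ n
              ≈⟨ +-congʳ (trans (+-congˡ (x≈y⇒x∙y⁻¹≈ε (*-identityˡ _))) (+-identityʳ 1#)) ⟩
            1# - s * s ^ n                                  ∎
            where
            s : Carrier
            s = r * P

      inverse : Completed A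
      inverse = record
        { at = λ n → y * geometric n
        ; coherent = coherence }
        where
        abstract
          coherence : ∀ n → CommutativeRing._≈_ (A mod n) (y * geometric (suc n)) (y * geometric n)
          coherence n = y * r ^ n , (begin
            (y * r ^ n) * P ^ n            ≈⟨ *-assoc _ _ _ ⟩
            y * (r ^ n * P ^ n)            ≈⟨ *-congˡ (^-distrib-* r P n) ⟨
            y * (r * P) ^ n                ≈⟨ solve 3 (λ y g t → y :* t := y :* (g :+ t) :- y :* g) refl y (geometric n) _ ⟩
            y * (geometric n + (r * P) ^ n) - y * geometric n ∎)

      abstract
        isInverse : ι.⟦ u ⟧ Â.* inverse Â.≈ Â.1#
        isInverse = componentwise λ n → - (r ^ n) , (begin
          - (r ^ n) * P ^ n                       ≈⟨ -‿distribˡ-* _ _ ⟨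
          - (r ^ n * P ^ n)                       ≈⟨ -‿cong (^-distrib-* r P n) ⟨
          - ((r * P) ^ n)                         ≈⟨ solve 2 (λ o t → :- t := (o :- t) :- o) refl 1# _ ⟩
          (1# - (r * P) ^ n) - 1#                 ≈⟨ +-congʳ (geometric-sum n) ⟨
          (1# - r * P) * geometric n - 1#         ≈⟨ +-congʳ (*-congʳ yu≈1-rP) ⟨
          (y * u) * geometric n - 1#              ≈⟨ +-congʳ (solve 3 (λ y u g → (y :* u) :* g := u :* (y :* g)) refl y u _) ⟩
          u * (y * geometric n) - 1#              ∎)

    module _ (g : Matrix.GL₂ A) where
      open Matrix A using (det; Mat)
      open Matrix.GL₂ g

      private
        open Solver
        m^p : Mat
        m^p j k = matrix j k ^ p
        s = det matrix
        d₁ = matrix 0F 0F * matrix 1F 1F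
        d₂ = matrix 0F 1F * matrix 1F 0F

        abstract
          congruence : ∃ λ r → det⁻¹ ^ p * det m^p ≈ 1# - r * P
          congruence with frobenius-+ s d₂
          ... | w , eq = - (det⁻¹ ^ p * w) , (begin
            det⁻¹ ^ p * det m^p
              ≈⟨ *-congˡ (+-cong (^-distrib-* _ _ p) (-‿cong (^-distrib-* _ _ p))) ⟨
            det⁻¹ ^ p * (d₁ ^ p - d₂ ^ p)
              ≈⟨ *-congˡ (+-congʳ (^-congˡ p (solve 2 (λ a b → a := (a :- b) :+ b) refl d₁ d₂))) ⟩
            det⁻¹ ^ p * ((s + d₂) ^ p - d₂ ^ p)    ≈⟨ *-congˡ (+-congʳ eq) ⟩
            det⁻¹ ^ p * (((s ^ p + d₂ ^ p) + w * P) - d₂ ^ p)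
              ≈⟨ solve 5 (λ e s d w q → e :* (((s :+ d) :+ w :* q) :- d) := s :* e :- (:- (e :* w)) :* q)
                   refl (det⁻¹ ^ p) (s ^ p) (d₂ ^ p) w P ⟩
            s ^ p * det⁻¹ ^ p - (- (det⁻¹ ^ p * w)) * P
              ≈⟨ +-congʳ (trans (sym (^-distrib-* _ _ p)) (trans (^-congˡ p det*det⁻¹≈1) (1^ p))) ⟩
            1# - (- (det⁻¹ ^ p * w)) * P           ∎)
            where
            1^ : ∀ n → 1# ^ n ≈ 1#
            1^ zero    = refl
            1^ (suc n) = trans (*-identityˡ _) (1^ n)

      -- The matrix of p-th powers of entries of g, as a point of GL₂(Â).
      powerGL₂ : Matrix.GL₂ (completion A)
      powerGL₂ = record
        { matrix = λ j k → ι.⟦ m^p j k ⟧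
        ; det⁻¹ = I.inverse
        ; det*det⁻¹≈1 = componentwise λ n → at-≈ I.isInverse n
        }
        where
        module ι = RingHomomorphism (ι A)
        module I = Inverse (det m^p) (det⁻¹ ^ p) (proj₁ congruence) (proj₂ congruence)

record PrimeIdeal (A : CommutativeRing a ℓa) (i : Level) : Set (a ⊔ ℓa ⊔ lsuc i) where
  open CommutativeRing A
  field
    ideal : Ideal A i
  open Ideal ideal public
  field
    proper : ¬ 1# ∈I
    prime  : ∀ x y → x * y ∈I → x ∈I ⊎ y ∈I

-- Connectedness of the topological space Spec A: nonempty, and not the union
-- of two disjoint nonempty closed subsets V(J), V(K).
module Spec (A : CommutativeRing a ℓa) where
  open CommutativeRing A using (Carrier)

  Point : Set (lsuc (a ⊔ ℓa))
  Point = PrimeIdeal A (a ⊔ ℓa)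

  infix 4 _∈V_
  _∈V_ : Point → Ideal A (a ⊔ ℓa) → Set (a ⊔ ℓa)
  P ∈V J = ∀ {f} → f J.∈I → f P.∈I
    where
    module J = Ideal J
    module P = PrimeIdeal P

  IsConnected : Set (lsuc (a ⊔ ℓa))
  IsConnected = Point ∧
    ¬ (∃[ J ] ∃[ K ] (∃[ P ] P ∈V J) ∧ (∃[ P ] P ∈V K) ∧
                     (∀ P → P ∈V J ⊎ P ∈V K) ∧ (∀ P → ¬ (P ∈V J ∧ P ∈V K)))

-- A is a discrete valuation ring with uniformizer π, so with maximal ideal πA.
record IsDVR (A : CommutativeRing a ℓa) (π : CommutativeRing.Carrier A) : Set (a ⊔ ℓa) where
  open CRing A
  field
    isDomain      : ∀ x y → x * y ≈ 0# → x ≈ 0# ⊎ y ≈ 0#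
    nonzero       : ¬ π ≈ 0#
    nonunit       : ¬ π ∣ 1#
    factorization : ∀ x → ¬ x ≈ 0# → ∃[ n ] ∃[ u ] (u ∣ 1# ∧ x ≈ u * π ^ n)

record IsCompleteDVR (p : ℕ) (𝒪 : CommutativeRing c ℓ) : Set (c ⊔ ℓ) where
  open CRing 𝒪
  field
    isDVR      : IsDVR 𝒪 (p ×ℕ 1#)
    isComplete : PAdic.IsComplete p 𝒪
  module k = CRing (𝒪 / principal 𝒪 (p ×ℕ 1#))
  field
    residuePerfect : ∀ x → ∃[ y ] y k.^ p k.≈ x

-- A p-derivation, through the attached Frobenius lift φ(a) = aᵖ + p δa. This is
-- the notion of p-derivation on p-torsion free rings, the only ones on which it
-- is used; that φ reduces to the p-power Frobenius mod p is automatic.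
record PDerivation (p : ℕ) (A : CommutativeRing a ℓa) : Set (a ⊔ ℓa) where
  open CRing A
  field
    δ : Carrier → Carrier

  φ : Carrier → Carrier
  φ x = x ^ p + p ×ℕ δ x

  field
    δ-cong : ∀ {x y} → x ≈ y → δ x ≈ δ y
    φ-isRingHomomorphism : IsRingHomomorphism rawRing rawRing φ

  frobeniusLift : A ⟶ A
  frobeniusLift = record { isRingHomomorphism = φ-isRingHomomorphism }

module Connections (p : ℕ) (p-prime : Prime p) (𝒪 : CommutativeRing c ℓ) (δ𝒪 : PDerivation p 𝒪) where
  open PAdic p
  open Frobenius p p-prime
  open Groups 𝒪 public
  open Matrix 𝒪 using (Unit; SymGL₂; scalar) public

  private
    module 𝒪 = CRing 𝒪
    module δ = PDerivation δ𝒪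

  𝒪[Ĝ] : CommutativeRing (c ⊔ ℓ) (c ⊔ ℓ)
  𝒪[Ĝ] = completion 𝒪[G]

  private
    module Ĝ = CRing 𝒪[Ĝ]
    module M = Matrix 𝒪[Ĝ]

  constant : 𝒪 ⟶ 𝒪[Ĝ]
  constant = _∘ʰ_ {A = 𝒪} {B = 𝒪[G]} {E = 𝒪[Ĝ]} (ι 𝒪[G]) (structureMap 𝒪[G]-presentation)

  private module constant = RingHomomorphism constant

  X : M.Mat
  X i j = RingHomomorphism.⟦_⟧ (ι 𝒪[G]) (var (x i j))

  -- The Frobenius lift of the trivial connection: x ↦ x⁽ᵖ⁾.
  φ₀ : 𝒪[Ĝ] ⟶ 𝒪[Ĝ]
  φ₀ = extend {A = 𝒪[G]} {B = 𝒪[G]}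
    (evalG 𝒪[Ĝ] (_∘ʰ_ {A = 𝒪} {B = 𝒪} {E = 𝒪[Ĝ]} constant δ.frobeniusLift) (powerGL₂ 𝒪[G] universal))

  ℋ : SymGL₂ → 𝒪[Ĝ] ⟶ 𝒪[Ĝ]
  ℋ q = completionMap {A = 𝒪[G]} {B = 𝒪[G]} (ℋ-algebraic q)

  record Connection : Set (c ⊔ ℓ) where
    field
      pDerivation : PDerivation p 𝒪[Ĝ]
    open PDerivation pDerivation public
    field
      extends : ∀ a → δ constant.⟦ a ⟧ Ĝ.≈ constant.⟦ δ.δ a ⟧

  IsMetric : Connection → SymGL₂ → Set (c ⊔ ℓ)
  IsMetric ∇ q = ∀ f → ∇.φ (ℋ.⟦ f ⟧) Ĝ.≈ ℋ.⟦ φ₀.⟦ f ⟧ ⟧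
    where
    module ∇ = Connection ∇
    module ℋ = RingHomomorphism (ℋ q)
    module φ₀ = RingHomomorphism φ₀

  -- Γ = (δx)ᵗ · φ(q) · x⁽ᵖ⁾
  christoffel : Connection → SymGL₂ → M.Mat
  christoffel ∇ q = δX M.ᵀ M.*ᴹ φq M.*ᴹ X^p
    where
    δX φq X^p : M.Mat
    δX j k  = Connection.δ ∇ (X j k)
    φq j k  = constant.⟦ δ.φ (SymGL₂.matrix q j k) ⟧
    X^p j k = X j k Ĝ.^ p

  IsLeviCivita : (Fin 2 → SymGL₂) → (Fin 2 → Connection) → Set (c ⊔ ℓ)
  IsLeviCivita q ∇ = (∀ i → IsMetric (∇ i) (q i)) ∧ (∀ i j k → Γ i j k Ĝ.≈ Γ j i k)
    where
    Γ : Fin 2 → Fin 2 → Fin 2 → Ĝ.Carrier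
    Γ i = christoffel (∇ i) (q i)

  -- A closed subscheme Y of G is given by the surjection f : 𝒪[G] → 𝒪(Y); the
  -- ideal of Ŷ in Ĝ is the kernel of the completion of f.
  IsHorizontal : (Y : CommutativeRing b ℓb) → 𝒪[G] ⟶ Y → Connection → Set (c ⊔ ℓ ⊔ b ⊔ ℓb)
  IsHorizontal Y f ∇ = ∀ g → f̂.⟦ g ⟧ Ŷ.≈ Ŷ.0# → f̂.⟦ ∇.δ g ⟧ Ŷ.≈ Ŷ.0#
    where
    module ∇ = Connection ∇
    module Ŷ = CommutativeRing (completion Y)
    module f̂ = RingHomomorphism (completionMap {A = 𝒪[G]} {B = Y} f)

  -- The closed subscheme H of G′ with ideal I is a subgroup scheme: H(B) is a
  -- subgroup of G′(B) for all 𝒪-algebras B. The size of B is that of the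
  -- coordinate ring of H × H, so that the universal points are included.
  module _ (I : Ideal 𝒪[G′] (c ⊔ ℓ)) where
    open Ideal I using (_∈I)

    Contains : (B : CommutativeRing c (c ⊔ ℓ)) → 𝒪 ⟶ B → PointG′ B → Set (c ⊔ ℓ)
    Contains B σ g = ∀ f → f ∈I → RingHomomorphism.⟦_⟧ (evalG′ B σ g) f ≈ 0#
      where open CommutativeRing B

    IsSubgroup : Set (lsuc (c ⊔ ℓ))
    IsSubgroup = ∀ (B : CommutativeRing c (c ⊔ ℓ)) (σ : 𝒪 ⟶ B) →
      Contains B σ one ∧
      (∀ g h → Contains B σ g → Contains B σ h → Contains B σ (g ∙ h)) ∧
      (∀ g → Contains B σ g → Contains B σ (g ⁻¹))

    -- H ≠ G′
    IsProper : Set (c ⊔ ℓ)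
    IsProper = ¬ (∀ f → f ∈I → f ≈ 0#)
      where open CommutativeRing 𝒪[G′]

    𝒪[H] : CommutativeRing c (c ⊔ ℓ)
    𝒪[H] = 𝒪[G′] / I

    H⊂G : 𝒪[G] ⟶ 𝒪[H]
    H⊂G = _∘ʰ_ {A = 𝒪[G]} {B = 𝒪[G′]} {E = 𝒪[H]} (quotientMap 𝒪[G′] I) G′⊂G

-- Let Y be the restriction of φ(x) to Ĝ′, where xᵗx = N = α² + β². For q = d · 1, metricity
-- says φ(d) YᵗY = (d N)ᵖ, a scalar matrix μ φ(d). Hence det(Y)² = μ², while det Y ≡ μ mod p,
-- and det Y = μ since p is odd. So Y has the shape (a b ; -b a), which is 1), and
-- φ(d) (a² + b²) = dᵖ Nᵖ. On G″ one has N = 1, so φ preserves a² + b² = 1 iff φ(d) = dᵖ, that is,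
-- δ d = 0; for "only if" it suffices to look at the identity of G″. Stability of an ideal under
-- φ gives stability under δ, because 𝒪(Ĝ′) and 𝒪(Ĝ″) are p-torsion free; this holds because a
-- function which vanishes at all 𝒪-points is zero.
--
-- In 3), the symmetry of the Christoffel symbols forces the values of φ₁(x) and φ₂(x) at the
-- identity to be the points (1 + b , b) and (1 + b , -b) with p ∣ b and
-- m ((1 + b)² + b²) = mᵖ. They lie on the φ-twist of every horizontal subgroup H. Their product is
-- the scalar λ = mᵖ⁻¹, which is not a root of unity, and no power of (1 + b , b) is a scalar
-- since it is congruent to 1 mod p and b ≠ 0. So their products are infinitely many points
-- on each of infinitely many lines through the origin, and a function vanishing at them is 0.

module Submission where

open import Defs
open import Level using (Level)
open import Algebra.Bundles using (CommutativeRing; Monoid)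
open import Algebra.Definitions.RawMagma using (_,_)
open import Algebra.Morphism.Bundles using (RingHomomorphism)
open import Algebra.Morphism.Structures using (IsRingHomomorphism)
import Algebra.Properties.Monoid.Mult as MonoidMult
open import Data.Fin.Base using (Fin)
open import Data.Fin.Patterns using (0F; 1F)
open import Data.Integer.Base as ℤ using (ℤ; +_; -[1+_]; 1ℤ; -1ℤ)
import Data.Integer.Divisibility as ℤ
open import Data.List.Base using (List; []; _∷_; length; map)
open import Data.List.Relation.Unary.All as All using (All; []; _∷_)
import Data.List.Relation.Unary.All.Properties as All
open import Data.Nat.Base as ℕ using (ℕ; zero; suc)
open import Data.Nat.Coprimality using (Coprime; coprime-Bézout)
import Data.Nat.Divisibility as ℕ
open import Data.Nat.Divisibility using (divides; _∣?_; ∣⇒≤; m%n≡0⇒n∣m) renaming (_∣_ to _∣ᴺ_)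
open import Data.Nat.DivMod using (_%_; m≡m%n+[m/n]*n; m%n<n) renaming (_/_ to _/ᴺ_)
open import Data.Nat.GCD using (module Bézout)
open import Data.Nat.Induction using (<-wellFounded; Acc; acc)
open import Data.Nat.Primality using (Prime; prime⇒irreducible; ¬prime[0]; ¬prime[1])
import Data.Nat.Properties as ℕ
open import Data.Product.Base using (Σ; _×_; ∃-syntax; _,_; proj₁; proj₂)
open import Data.Sum.Base using (inj₁; inj₂)
open import Data.Unit.Base using (tt)
open import Function.Base using (id; _∘_)
open import Function.Bundles using (_⇔_; mk⇔)
open import Relation.Binary.Definitions using (tri<; tri≈; tri>)
open import Relation.Binary.PropositionalEquality.Core as ≡ using (_≡_; _≢_)
import Relation.Binary.Reasoning.Setoid as SetoidReasoning
open import Relation.Nullary.Decidable.Core using (yes; no)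
open import Relation.Nullary.Negation.Core using (¬_; contradiction)

-- The twist by `φ` is absorbed into the functor of points. `IsSubgroup` speaks of all algebras, so
-- 𝒪 is made an algebra over itself through `φ`; the points of the φ-twist of H then become ordinary
-- points of H and can be multiplied there. A function vanishing at enough of them has twisted
-- coefficients equal to 0, and is itself 0 because every endomorphism of 𝒪 is injective.
--
-- Equality in 𝒪 is not assumed decidable, and the coordinate rings are terms modulo relations,
-- without normal forms. This shapes the vanishing theorems: a function is represented by a list of
-- coefficients, and each coefficient is shown to be zero from points with regular differences,
-- without a degree or a leading coefficient. The sign of det Y is not found by cases either: e =
-- det Y - μ satisfies 2 μ e = - e² and p ∣ e, so e is p times a multiple of itself and lies in
-- every power of p.

private variable
  a b c ℓ ℓ′ : Level

-- Polynomials with many roots, in one and two variables.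

-- Polynomials are lists of (codes of) coefficients, evaluated by Horner's rule.
module Horner (A : CommutativeRing a ℓ) where
  open CRing A
  open Solver
  open SetoidReasoning setoid

  horner : {C : Set c} → (C → Carrier) → Carrier → List C → Carrier
  horner e x []       = 0#
  horner e x (c ∷ cs) = e c + x * horner e x cs

  horner-cong : {C : Set c} {e e′ : C → Carrier} {x x′ : Carrier} →
                (∀ c → e c ≈ e′ c) → x ≈ x′ → ∀ cs → horner e x cs ≈ horner e′ x′ cs
  horner-cong e≈ x≈ []       = refl
  horner-cong e≈ x≈ (c ∷ cs) = +-cong (e≈ c) (*-cong x≈ (horner-cong e≈ x≈ cs))

  horner-map : {C : Set c} {D : Set b} (e : D → Carrier) (f : C → D) (x : Carrier) →
               ∀ cs → horner (e ∘ f) x cs ≡ horner e x (map f cs)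
  horner-map e f x []       = ≡.refl
  horner-map e f x (c ∷ cs) = ≡.cong (λ y → e (f c) + x * y) (horner-map e f x cs)

  -- A subring is presented as the image of `e`, with a code for every sum, product and negative.
  -- `adjoin` produces the same kind of data with codes `List C`, so it can be iterated to reach
  -- polynomials in two elements.
  record IsSubring {C : Set c} (e : C → Carrier) : Set (c Level.⊔ a Level.⊔ ℓ) where
    field
      zero-closed : ∃[ z ] e z ≈ 0#
      +-closed    : ∀ c d → ∃[ z ] e z ≈ e c + e d
      *-closed    : ∀ c d → ∃[ z ] e z ≈ e c * e d
      neg-closed  : ∀ c → ∃[ z ] e z ≈ - e c

  module _ {C : Set c} {e : C → Carrier} (S : IsSubring e) (x : Carrier) where
    open IsSubring S

    private
      value : List C → Carrier
      value = horner e x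

      add : ∀ cs ds → ∃[ es ] (value es) ≈ (value cs) + (value ds)
      add []       ds       = ds , sym (+-identityˡ _)
      add (c ∷ cs) []       = c ∷ cs , sym (+-identityʳ _)
      add (c ∷ cs) (d ∷ ds) with +-closed c d | add cs ds
      ... | z , z≈ | zs , zs≈ = z ∷ zs , trans (+-cong z≈ (*-congˡ zs≈))
        (solve 5 (λ c d x s t → (c :+ d) :+ x :* (s :+ t) := (c :+ x :* s) :+ (d :+ x :* t))
          refl (e c) (e d) x (value cs) (value ds))

      scale : ∀ c ds → ∃[ es ] (value es) ≈ e c * (value ds)
      scale c []       = [] , sym (zeroʳ _)
      scale c (d ∷ ds) with *-closed c d | scale c ds
      ... | z , z≈ | zs , zs≈ = z ∷ zs , trans (+-cong z≈ (*-congˡ zs≈))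
        (solve 4 (λ c d x t → c :* d :+ x :* (c :* t) := c :* (d :+ x :* t)) refl (e c) (e d) x (value ds))

      mul : ∀ cs ds → ∃[ es ] (value es) ≈ (value cs) * (value ds)
      mul []       ds = [] , sym (zeroˡ _)
      mul (c ∷ cs) ds with scale c ds | mul cs ds | zero-closed
      ... | es , es≈ | fs , fs≈ | z , z≈ with add es (z ∷ fs)
      ... | gs , gs≈ = gs , (begin
        (value gs)                                      ≈⟨ gs≈ ⟩
        (value es) + (e z + x * (value fs))                 ≈⟨ +-cong es≈ (+-cong z≈ (*-congˡ fs≈)) ⟩
        e c * (value ds) + (0# + x * ((value cs) * (value ds)))
          ≈⟨ solve 4 (λ c x s t → c :* t :+ (con (+ 0) :+ x :* (s :* t)) := (c :+ x :* s) :* t)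
               refl (e c) x (value cs) (value ds) ⟩
        (e c + x * (value cs)) * (value ds)                 ∎)

      neg : ∀ cs → ∃[ es ] (value es) ≈ - (value cs)
      neg []       = [] , sym ε⁻¹≈ε
      neg (c ∷ cs) with neg-closed c | neg cs
      ... | z , z≈ | zs , zs≈ = z ∷ zs , trans (+-cong z≈ (*-congˡ zs≈))
        (solve 3 (λ c x t → :- c :+ x :* (:- t) := :- (c :+ x :* t)) refl (e c) x (value cs))

    adjoin : IsSubring (horner e x)
    adjoin = record
      { zero-closed = [] , refl ; +-closed = add ; *-closed = mul ; neg-closed = neg }

    constants⊂adjoin : ∀ c → ∃[ cs ] horner e x cs ≈ e c
    constants⊂adjoin c = c ∷ [] , trans (+-congˡ (zeroʳ x)) (+-identityʳ _)

    generator∈adjoin : ∀ {u} → e u ≈ 1# → ∃[ cs ] horner e x cs ≈ x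
    generator∈adjoin {u} u≈1 = proj₁ zero-closed ∷ u ∷ [] ,
      trans (+-cong (proj₂ zero-closed) (*-congˡ (trans (+-congʳ u≈1)
        (trans (+-congˡ (zeroʳ x)) (+-identityʳ 1#)))))
      (trans (+-identityˡ _) (*-identityʳ x))

  coef : List Carrier → ℕ → Carrier
  coef []       _       = 0#
  coef (c ∷ cs) zero    = c
  coef (c ∷ cs) (suc e) = coef cs e

  IsZero : List Carrier → Set ℓ
  IsZero cs = ∀ e → coef cs e ≈ 0#

  horner-zero : ∀ x cs → IsZero cs → horner id x cs ≈ 0#
  horner-zero x []       _  = refl
  horner-zero x (c ∷ cs) z = begin
    c + x * horner id x cs  ≈⟨ +-cong (z 0) (*-congˡ (horner-zero x cs (z ∘ suc))) ⟩
    0# + x * 0#             ≈⟨ trans (+-identityˡ _) (zeroʳ x) ⟩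
    0#                      ∎

  Regular : Carrier → Set (a Level.⊔ ℓ)
  Regular x = ∀ y → x * y ≈ 0# → y ≈ 0#

  private
    -- The quotient of X · T by X - a.
    quotient : Carrier → List Carrier → List Carrier
    quotient a []       = []
    quotient a (d ∷ ds) = horner id a (d ∷ ds) ∷ quotient a ds

    length-quotient : ∀ a ds → length (quotient a ds) ≡ length ds
    length-quotient a []       = ≡.refl
    length-quotient a (d ∷ ds) = ≡.cong suc (length-quotient a ds)

    division : ∀ a x ds → x * horner id x ds - a * horner id a ds ≈ (x - a) * horner id x (quotient a ds)
    division a x []       = solve 2 (λ a x → x :* con (+ 0) :- a :* con (+ 0) := (x :- a) :* con (+ 0)) refl a x
    division a x (d ∷ ds) = begin
      x * (d + x * T x) - a * (d + a * T a)
        ≈⟨ solve 5 (λ x a d t s → x :* (d :+ x :* t) :- a :* (d :+ a :* s)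
             := (x :- a) :* (d :+ a :* s) :+ x :* (x :* t :- a :* s)) refl x a d (T x) (T a) ⟩
      (x - a) * (d + a * T a) + x * (x * T x - a * T a)   ≈⟨ +-congˡ (*-congˡ (division a x ds)) ⟩
      (x - a) * (d + a * T a) + x * ((x - a) * horner id x (quotient a ds))
        ≈⟨ solve 4 (λ x y u q → y :* u :+ x :* (y :* q) := y :* (u :+ x :* q)) refl
             x (x - a) (d + a * T a) (horner id x (quotient a ds)) ⟩
      (x - a) * (d + a * T a + x * horner id x (quotient a ds))   ∎
      where
      T : Carrier → Carrier
      T y = horner id y ds

    -- Synthetic division is unitriangular: a coefficient of the quotient is one of `ds` plus `a`
    -- times the value of the part above it. So `ds` is recovered from the top down, without
    -- dividing.
    quotient-zero : ∀ a ds → IsZero (quotient a ds) → IsZero ds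
    quotient-zero a []       _ _       = refl
    quotient-zero a (d ∷ ds) z (suc e) = quotient-zero a ds (z ∘ suc) e
    quotient-zero a (d ∷ ds) z zero    = begin
      d                         ≈⟨ +-identityʳ d ⟨
      d + 0#                    ≈⟨ +-congˡ (trans (*-congˡ (horner-zero a ds (quotient-zero a ds (z ∘ suc)))) (zeroʳ a)) ⟨
      d + a * horner id a ds    ≈⟨ z 0 ⟩
      0#                        ∎

  -- The root `x 0` is divided out and the shifted sequence serves for the quotient. The induction
  -- is on the length because the quotient of the tail has the right length but is not a sublist.
  infinitely-many-roots : (x : ℕ → Carrier) → (∀ {i j} → i ≢ j → Regular (x i - x j)) →
                          ∀ cs → (∀ i → horner id (x i) cs ≈ 0#) → IsZero cs
  infinitely-many-roots x reg cs = go _ cs ≡.refl x reg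
    where
    go : ∀ n cs → length cs ≡ n → (x : ℕ → Carrier) → (∀ {i j} → i ≢ j → Regular (x i - x j)) →
         (∀ i → horner id (x i) cs ≈ 0#) → IsZero cs
    go n       []       _  x reg roots = λ _ → refl
    go (suc n) (c ∷ cs) eq x reg roots = zero-cs
      where
      r : Carrier
      r = x 0

      root : ∀ i → horner id (x (suc i)) (quotient r cs) ≈ 0#
      root i = reg (λ ()) _ (begin
        (x (suc i) - r) * horner id (x (suc i)) (quotient r cs)
          ≈⟨ division r (x (suc i)) cs ⟨
        x (suc i) * horner id (x (suc i)) cs - r * horner id r cs
          ≈⟨ solve 3 (λ c u v → u :- v := (c :+ u) :- (c :+ v)) refl c _ _ ⟩
        horner id (x (suc i)) (c ∷ cs) - horner id r (c ∷ cs)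
          ≈⟨ x≈y⇒x∙y⁻¹≈ε (trans (roots (suc i)) (sym (roots 0))) ⟩
        0# ∎)

      tail-zero : IsZero cs
      tail-zero = quotient-zero r cs
        (go n (quotient r cs) (≡.trans (length-quotient r cs) (ℕ.suc-injective eq))
          (x ∘ suc) (λ i≢j → reg (i≢j ∘ ℕ.suc-injective)) root)

      zero-cs : IsZero (c ∷ cs)
      zero-cs (suc e) = tail-zero e
      zero-cs zero    = begin
        c                      ≈⟨ +-identityʳ c ⟨
        c + 0#                 ≈⟨ +-congˡ (trans (*-congˡ (horner-zero r cs tail-zero)) (zeroʳ r)) ⟨
        c + r * horner id r cs ≈⟨ roots 0 ⟩
        0#                     ∎

  private
    infixl 6 _⊞_
    _⊞_ : List Carrier → List Carrier → List Carrier
    []       ⊞ ds       = ds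
    (c ∷ cs) ⊞ []       = c ∷ cs
    (c ∷ cs) ⊞ (d ∷ ds) = c + d ∷ cs ⊞ ds

    coef-⊞ : ∀ cs ds e → coef (cs ⊞ ds) e ≈ coef cs e + coef ds e
    coef-⊞ []       ds       e       = sym (+-identityˡ _)
    coef-⊞ (c ∷ cs) []       e       = sym (+-identityʳ _)
    coef-⊞ (c ∷ cs) (d ∷ ds) zero    = refl
    coef-⊞ (c ∷ cs) (d ∷ ds) (suc e) = coef-⊞ cs ds e

    horner-⊞ : ∀ x cs ds → horner id x (cs ⊞ ds) ≈ horner id x cs + horner id x ds
    horner-⊞ x []       ds       = sym (+-identityˡ _)
    horner-⊞ x (c ∷ cs) []       = sym (+-identityʳ _)
    horner-⊞ x (c ∷ cs) (d ∷ ds) = trans (+-congˡ (*-congˡ (horner-⊞ x cs ds)))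
      (solve 5 (λ c d x s t → (c :+ d) :+ x :* (s :+ t) := (c :+ x :* s) :+ (d :+ x :* t))
        refl c d x _ _)

    coef-scale : ∀ t cs e → coef (map (t *_) cs) e ≈ t * coef cs e
    coef-scale t []       e       = sym (zeroʳ t)
    coef-scale t (c ∷ cs) zero    = refl
    coef-scale t (c ∷ cs) (suc e) = coef-scale t cs e

    horner-scale : ∀ t x cs → horner id x (map (t *_) cs) ≈ t * horner id x cs
    horner-scale t x []       = sym (zeroʳ t)
    horner-scale t x (c ∷ cs) = trans (+-congˡ (*-congˡ (horner-scale t x cs)))
      (solve 4 (λ t c x s → t :* c :+ x :* (t :* s) := t :* (c :+ x :* s)) refl t c x _)

    -- For F = Σₗ cₗ(x) yˡ, the polynomial F(x, x t) in x ...
    substituted : Carrier → List (List Carrier) → List Carrier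
    substituted t []       = []
    substituted t (c ∷ cs) = c ⊞ (0# ∷ map (t *_) (substituted t cs))

    horner-substituted : ∀ x t css → horner id x (substituted t css) ≈ horner (horner id x) (x * t) css
    horner-substituted x t []       = refl
    horner-substituted x t (c ∷ cs) = begin
      horner id x (c ⊞ (0# ∷ map (t *_) (substituted t cs)))
        ≈⟨ horner-⊞ x c _ ⟩
      horner id x c + (0# + x * horner id x (map (t *_) (substituted t cs)))
        ≈⟨ +-congˡ (+-congˡ (*-congˡ (trans (horner-scale t x (substituted t cs)) (*-congˡ (horner-substituted x t cs))))) ⟩
      horner id x c + (0# + x * (t * horner (horner id x) (x * t) cs))
        ≈⟨ +-congˡ (trans (+-identityˡ _) (sym (*-assoc _ _ _))) ⟩
      horner id x c + x * t * horner (horner id x) (x * t) cs ∎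

    -- ... and its e-th coefficient, as a polynomial in t.
    antidiagonal : List (List Carrier) → ℕ → List Carrier
    antidiagonal []       e       = []
    antidiagonal (c ∷ cs) zero    = coef c 0 ∷ []
    antidiagonal (c ∷ cs) (suc e) = coef c (suc e) ∷ antidiagonal cs e

    coef-substituted : ∀ t css e → coef (substituted t css) e ≈ horner id t (antidiagonal css e)
    coef-substituted t []       e       = refl
    coef-substituted t (c ∷ cs) zero    = begin
      coef (c ⊞ (0# ∷ _)) 0   ≈⟨ coef-⊞ c _ 0 ⟩
      coef c 0 + 0#           ≈⟨ +-congˡ (zeroʳ t) ⟨
      coef c 0 + t * 0#       ∎
    coef-substituted t (c ∷ cs) (suc e) = begin
      coef (c ⊞ (0# ∷ map (t *_) (substituted t cs))) (suc e)   ≈⟨ coef-⊞ c _ (suc e) ⟩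
      coef c (suc e) + coef (map (t *_) (substituted t cs)) e
        ≈⟨ +-congˡ (trans (coef-scale t (substituted t cs) e) (*-congˡ (coef-substituted t cs e))) ⟩
      coef c (suc e) + t * horner id t (antidiagonal cs e)      ∎

    zero⇒All : ∀ cs → IsZero cs → All (_≈ 0#) cs
    zero⇒All []       _ = []
    zero⇒All (c ∷ cs) z = z 0 ∷ zero⇒All cs (z ∘ suc)

    -- An antidiagonal begins with a coefficient of the first list and continues with the preceding
    -- antidiagonal of the remaining lists, so every coefficient lies on one of them.
    antidiagonal-zero : ∀ css → (∀ e → IsZero (antidiagonal css e)) → All (All (_≈ 0#)) css
    antidiagonal-zero []       _ = []
    antidiagonal-zero (c ∷ cs) z = zero⇒All c c-zero ∷ antidiagonal-zero cs (λ e l → z (suc e) (suc l))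
      where
      c-zero : IsZero c
      c-zero zero    = z 0 0
      c-zero (suc e) = z (suc e) 0

  -- On the line y = t x the function is a polynomial in x with too many roots. Each of its
  -- coefficients is in turn a polynomial in t, vanishing at all the slopes.
  roots-on-infinitely-many-lines :
    (t : ℕ → Carrier) → (∀ {k l} → k ≢ l → Regular (t k - t l)) →
    (x : ℕ → ℕ → Carrier) → (∀ k {i j} → i ≢ j → Regular (x k i - x k j)) →
    ∀ css → (∀ k i → horner (horner id (x k i)) (x k i * t k) css ≈ 0#) → All (All (_≈ 0#)) css
  roots-on-infinitely-many-lines t t-reg x x-reg css roots =
    antidiagonal-zero css λ e → infinitely-many-roots t t-reg (antidiagonal css e) λ k →
      trans (sym (coef-substituted (t k) css e))
        (infinitely-many-roots (x k) (x-reg k) (substituted (t k) css)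
          (λ i → trans (horner-substituted (x k i) (t k) css) (roots k i)) e)

  infinitely-many-roots⇒All : (x : ℕ → Carrier) → (∀ {i j} → i ≢ j → Regular (x i - x j)) →
    ∀ cs → (∀ i → horner id (x i) cs ≈ 0#) → All (_≈ 0#) cs
  infinitely-many-roots⇒All x reg cs roots = zero⇒All cs (infinitely-many-roots x reg cs roots)

  horner-all-zero : {C : Set c} {e : C → Carrier} (x : Carrier) →
                    ∀ {cs} → All (λ c → e c ≈ 0#) cs → horner e x cs ≈ 0#
  horner-all-zero x []       = refl
  horner-all-zero x (z ∷ zs) = trans (+-cong z (*-congˡ (horner-all-zero x zs)))
    (trans (+-identityˡ _) (zeroʳ x))

horner-hom : {A : CommutativeRing a ℓ} {B : CommutativeRing b ℓ′} (f : A ⟶ B) →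
  let module A = CommutativeRing A
      module B = CommutativeRing B
      open RingHomomorphism f
  in {C : Set c} (e : C → A.Carrier) → ∀ x cs →
     ⟦ Horner.horner A e x cs ⟧ B.≈ Horner.horner B (⟦_⟧ ∘ e) ⟦ x ⟧ cs
horner-hom {B = B} f e x []       = RingHomomorphism.0#-homo f
horner-hom {A = A} {B} f e x (c ∷ cs) =
  B.trans (f.+-homo _ _) (B.+-congˡ (B.trans (f.*-homo _ _) (B.*-congˡ (horner-hom {A = A} {B} f e x cs))))
  where
  module B = CommutativeRing B
  module f = RingHomomorphism f

-- Separatedness, torsion and continuity in p-adic completions.

module PAdicProperties (p : ℕ) where
  open PAdic p

  TorsionFree : CommutativeRing a ℓ → Set (a Level.⊔ ℓ)
  TorsionFree A = ∀ x → p ×ℕ x ≈ 0# → x ≈ 0#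
    where open CRing A

  -- p-adic separatedness in the form in which it is applied: iterating the equation makes `x`
  -- divisible by every power of `p`.
  Contracting : CommutativeRing a ℓ → Set (a Level.⊔ ℓ)
  Contracting C = ∀ {x} s → x ≈ (p ×ℕ 1#) * (s * x) → x ≈ 0#
    where open CRing C

  module _ (A : CommutativeRing a ℓ) where
    open CRing A
    open SetoidReasoning setoid

    p×≈p1#* : ∀ x → p ×ℕ x ≈ (p ×ℕ 1#) * x
    p×≈p1#* x = begin
      p ×ℕ x            ≈⟨ ×-congʳ p (*-identityʳ x) ⟨
      p ×ℕ (x * 1#)     ≈⟨ ×-comm-* p x 1# ⟨
      x * (p ×ℕ 1#)     ≈⟨ *-comm _ _ ⟩
      (p ×ℕ 1#) * x     ∎

    regroup : ∀ q s u v x → q * (s * (u * (v * x))) ≈ (q * u) * ((s * v) * x)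
    regroup = solve 5 (λ q s u v x → q :* (s :* (u :* (v :* x))) := (q :* u) :* ((s :* v) :* x)) refl
      where open Solver

  module _ {A : CommutativeRing a ℓ} {B : CommutativeRing b ℓ′} (f : A ⟶ B) where
    private
      module A = CRing A
      module B = CRing B
      module f = Hom {A = A} {B = B} f

    p-homo : f.⟦ p A.×ℕ A.1# ⟧ B.≈ p B.×ℕ B.1#
    p-homo = B.trans (f.×ℕ-homo p A.1#) (B.×-congʳ p f.1#-homo)

    pⁿ-homo : ∀ n → f.⟦ (p A.×ℕ A.1#) A.^ n ⟧ B.≈ (p B.×ℕ B.1#) B.^ n
    pⁿ-homo n = B.trans (f.^-homo _ n) (B.^-congˡ n p-homo)

  module _ (A : CommutativeRing a ℓ) where
    private
      module Â = CRing (completion A)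
      module ι = Hom {A = A} {B = completion A} (ι A)
      module M n = CRing (A mod n)
      open CRing A
      open Solver
      open SetoidReasoning setoid
      P : Carrier
      P = p ×ℕ 1#
      P̂ : Â.Carrier
      P̂ = p Â.×ℕ Â.1#

    weaken : ∀ m n {x y} → M._≈_ (m ℕ.+ n) x y → M._≈_ n x y
    weaken m n {x} {y} (q , eq) = q * P ^ m , (begin
      (q * P ^ m) * P ^ n    ≈⟨ *-assoc _ _ _ ⟩
      q * (P ^ m * P ^ n)    ≈⟨ *-congˡ (^-homo-* P m n) ⟨
      q * P ^ (m ℕ.+ n)      ≈⟨ eq ⟩
      x - y                  ∎)

    stable-at : ∀ (x : Completed A) m n → M._≈_ n (at x (m ℕ.+ n)) (at x n)
    stable-at x zero    n = M.refl n
    stable-at x (suc m) n = M.trans n (weaken m n (coherent x (m ℕ.+ n))) (stable-at x m n)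

    -- The tail of x after its component at n is divisible by pⁿ; the quotient
    -- is the sequence of partial sums of the digits of x beyond n.
    private module Tail (x : Completed A) (n : ℕ) where
      digit : ℕ → Carrier
      digit k = proj₁′ (coherent x (k ℕ.+ n))
        where
        proj₁′ : ∀ {k} → M._≈_ k (at x (suc k)) (at x k) → Carrier
        proj₁′ (q , _) = q

      digit-≈ : ∀ k → digit k * P ^ (k ℕ.+ n) ≈ at x (suc k ℕ.+ n) - at x (k ℕ.+ n)
      digit-≈ k with coherent x (k ℕ.+ n)
      ... | _ , eq = eq

      partialSum : ℕ → Carrier
      partialSum zero    = 0#
      partialSum (suc m) = partialSum m + digit m * P ^ m

      partialSum-≈ : ∀ m → P ^ n * partialSum m ≈ at x (m ℕ.+ n) - at x n
      partialSum-≈ zero    = trans (zeroʳ _) (sym (-‿inverseʳ _))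
      partialSum-≈ (suc m) = begin
        P ^ n * (partialSum m + digit m * P ^ m)
          ≈⟨ solve 4 (λ u s d v → u :* (s :+ d :* v) := u :* s :+ d :* (v :* u)) refl (P ^ n) (partialSum m) (digit m) (P ^ m) ⟩
        P ^ n * partialSum m + digit m * (P ^ m * P ^ n)
          ≈⟨ +-cong (partialSum-≈ m) (trans (*-congˡ (sym (^-homo-* P m n))) (digit-≈ m)) ⟩
        (at x (m ℕ.+ n) - at x n) + (at x (suc m ℕ.+ n) - at x (m ℕ.+ n))
          ≈⟨ solve 3 (λ u v w → (u :- v) :+ (w :- u) := w :- v) refl (at x (m ℕ.+ n)) (at x n) (at x (suc m ℕ.+ n)) ⟩
        at x (suc m ℕ.+ n) - at x n  ∎

      tail : Completed A
      tail = record { at = partialSum ; coherent = λ m → digit m ,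
        solve 2 (λ s d → d := (s :+ d) :- s) refl (partialSum m) _ }

    -- Congruence of the components modulo `pⁿ` is turned into divisibility inside the completion,
    -- which a ring homomorphism can see.
    decompose : ∀ x n → ∃[ h ] x Â.≈ ι.⟦ at x n ⟧ Â.+ (P̂ Â.^ n) Â.* h
    decompose x n = tail , Â.trans eq (Â.+-congˡ (Â.*-congʳ (pⁿ-homo {A = A} {B = completion A} (ι A) n)))
      where
      open Tail x n
      eq : x Â.≈ ι.⟦ at x n ⟧ Â.+ ι.⟦ P ^ n ⟧ Â.* tail
      -- Modulo `pᵐ` the component at `m` may be replaced by the one at `m + n`, where the
      -- telescoping sum of digits is exact.
      eq = componentwise λ m → M.trans m
        (M.sym m (M.trans m (M.reflexive m (≡.cong (at x) (ℕ.+-comm m n))) (stable-at x n m)))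
        (RingHomomorphism.⟦⟧-cong (reduce A m) (begin
          at x (m ℕ.+ n)
            ≈⟨ solve 2 (λ u v → u := v :+ (u :- v)) refl (at x (m ℕ.+ n)) (at x n) ⟩
          at x n + (at x (m ℕ.+ n) - at x n)  ≈⟨ +-congˡ (partialSum-≈ m) ⟨
          at x n + P ^ n * partialSum m       ∎))

    multiple-at : ∀ n h → M._≈_ n (at ((P̂ Â.^ n) Â.* h) n) 0#
    multiple-at n h = M.trans n
      (at-≈ (Â.*-congʳ {h} (Â.sym (pⁿ-homo {A = A} {B = completion A} (ι A) n))) n)
      (at h n , solve 2 (λ h q → h :* q := q :* h :- con (+ 0)) refl (at h n) (P ^ n))

    separated : ∀ {x} → (∀ n → ∃[ h ] x Â.≈ (P̂ Â.^ n) Â.* h) → x Â.≈ Â.0#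
    separated dvd = componentwise λ n → M.trans n (at-≈ (proj₂ (dvd n)) n) (multiple-at n (proj₁ (dvd n)))

    p-contracting : Contracting (completion A)
    p-contracting {x} s eq = separated λ n → (s Â.^ n) Â.* x , go n
      where
      go : ∀ n → x Â.≈ (P̂ Â.^ n) Â.* ((s Â.^ n) Â.* x)
      go zero    = Â.sym (Â.trans (Â.*-identityˡ _) (Â.*-identityˡ x))
      go (suc n) = Â.trans eq (Â.trans (Â.*-congˡ (Â.*-congˡ (go n)))
        (regroup (completion A) P̂ s (P̂ Â.^ n) (s Â.^ n) x))

    at-×ℕ : ∀ k x n → at (k Â.×ℕ x) n ≈ k ×ℕ at x n
    at-×ℕ zero    x n = refl
    at-×ℕ (suc k) x n = +-congˡ (at-×ℕ k x n)

    -- Cancelling `p` costs one level of precision, so the component at `n` is read off from the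
    -- component at `suc n`.
    completion-torsionFree : TorsionFree A → TorsionFree (completion A)
    completion-torsionFree tf x px≈0 = componentwise λ n →
      M.trans n (M.sym n (coherent x n)) (go n (at-≈ px≈0 (suc n)))
      where
      go : ∀ n → M._≈_ (suc n) (at (p Â.×ℕ x) (suc n)) 0# → M._≈_ n (at x (suc n)) 0#
      go n (q , eq) = q , x∙y⁻¹≈ε⇒x≈y _ _ (tf _ (begin
        p ×ℕ (q * P ^ n - (y - 0#))  ≈⟨ p×≈p1#* A _ ⟩
        P * (q * P ^ n - (y - 0#))
          ≈⟨ solve 4 (λ r q u y → r :* (q :* u :- (y :- con (+ 0))) := q :* (r :* u) :- r :* y) refl P q (P ^ n) y ⟩
        q * P ^ suc n - P * y        ≈⟨ +-cong eq (-‿cong (sym (trans (at-×ℕ p x (suc n)) (p×≈p1#* A y)))) ⟩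
        at (p Â.×ℕ x) (suc n) - 0# - at (p Â.×ℕ x) (suc n)
          ≈⟨ solve 1 (λ u → u :- con (+ 0) :- u := con (+ 0)) refl (at (p Â.×ℕ x) (suc n)) ⟩
        0# ∎))
        where y = at x (suc n)

  module _ {A : CommutativeRing a ℓ} {B : CommutativeRing b ℓ′} where
    private
      module A = CRing A
      module B = CRing B
      module Â = CRing (completion A)
      module B̂ = CRing (completion B)

    -- Ring homomorphisms between completions are automatically continuous.
    module _ (g : A ⟶ completion B) (F : completion A ⟶ completion B)
             (F-ι : ∀ a → RingHomomorphism.⟦_⟧ F (RingHomomorphism.⟦_⟧ (ι A) a) B̂.≈ RingHomomorphism.⟦_⟧ g a) where
      private
        module F = Hom {A = completion A} {B = completion B} F
        module g = Hom {A = A} {B = completion B} g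
        module M n = CRing (B mod n)
        module ιA = RingHomomorphism (ι A)

      -- By `decompose`, `x` differs from a constant by a multiple of `pⁿ`, and every ring
      -- homomorphism preserves such multiples.
      at-continuous : ∀ x n → M._≈_ n (at F.⟦ x ⟧ n) (at g.⟦ at x n ⟧ n)
      at-continuous x n with decompose A x n
      ... | h , eq = M.trans n (at-≈ (B̂.trans (F.⟦⟧-cong eq) (B̂.trans (F.+-homo _ _)
          (B̂.+-cong (F-ι _) (B̂.trans (F.*-homo _ _) (B̂.*-congʳ (pⁿ-homo {A = completion A} {B = completion B} F n)))))) n)
        (M.trans n (M.+-congˡ n (multiple-at B n F.⟦ h ⟧)) (M.+-identityʳ n _))

      is-extend : ∀ x → F.⟦ x ⟧ B̂.≈ RingHomomorphism.⟦_⟧ (extend {A = A} {B = B} g) x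
      is-extend x = componentwise (at-continuous x)

-- Elementary facts on primes and powers.

0<prime : ∀ {p} → Prime p → 0 ℕ.< p
0<prime {zero}  pp = contradiction pp ¬prime[0]
0<prime {suc _} _  = ℕ.z<s

1<prime : ∀ {p} → Prime p → 1 ℕ.< p
1<prime {zero}        pp = contradiction pp ¬prime[0]
1<prime {suc zero}    pp = contradiction pp ¬prime[1]
1<prime {suc (suc _)} _  = ℕ.s≤s ℕ.z<s

prime∤2 : ∀ {p} → Prime p → p ≢ 2 → ¬ (p ∣ᴺ 2)
prime∤2 pp p≢2 p∣2 = p≢2 (ℕ.≤-antisym (∣⇒≤ p∣2) (1<prime pp))

^-injectiveʳ : ∀ {m} → 1 ℕ.< m → ∀ {i j} → m ℕ.^ i ≡ m ℕ.^ j → i ≡ j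
^-injectiveʳ {m} 1<m {i} {j} eq with ℕ.<-cmp i j
... | tri< i<j _ _ = contradiction eq (ℕ.<⇒≢ (ℕ.^-monoʳ-< m 1<m i<j))
... | tri≈ _ i≡j _ = i≡j
... | tri> _ _ j<i = contradiction (≡.sym eq) (ℕ.<⇒≢ (ℕ.^-monoʳ-< m 1<m j<i))

0^ : (A : CommutativeRing a ℓ) → let open CRing A in ∀ {n} → 0 ℕ.< n → 0# ^ n ≈ 0#
0^ A {suc n} _ = CRing.zeroˡ A _

1^ : (A : CommutativeRing a ℓ) → let open CRing A in ∀ n → 1# ^ n ≈ 1#
1^ A zero    = CRing.refl A
1^ A (suc n) = CRing.trans A (CRing.*-identityˡ A _) (1^ A n)

×1-homo-^ : (A : CommutativeRing a ℓ) → let open CRing A in ∀ m n → (m ℕ.^ n) ×ℕ 1# ≈ (m ×ℕ 1#) ^ n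
×1-homo-^ A m zero    = CRing.×-homo-1 A _
×1-homo-^ A m (suc n) = CRing.trans A (CRing.×1-homo-* A m (m ℕ.^ n)) (CRing.*-congˡ A (×1-homo-^ A m n))

-- Units, divisibility and integers in the complete discrete valuation ring.

module CompleteDVR (p : ℕ) (p-prime : Prime p) (𝒪 : CommutativeRing c ℓ) (dvr : IsCompleteDVR p 𝒪) where
  open CRing 𝒪
  open IsCompleteDVR dvr using (isDVR; isComplete)
  open IsDVR isDVR
  open Solver
  open SetoidReasoning setoid
  open PAdic p
  open PAdicProperties p
  open Horner 𝒪 using (Regular)

  P : Carrier
  P = p ×ℕ 1#

  open Ideal (principal 𝒪 P)

  nonzero⇒regular : ∀ {x} → ¬ x ≈ 0# → Regular x
  nonzero⇒regular x≉0 y xy≈0 with isDomain _ y xy≈0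
  ... | inj₁ x≈0 = contradiction x≈0 x≉0
  ... | inj₂ y≈0 = y≈0

  *-nonzero : ∀ {x y} → ¬ x ≈ 0# → ¬ y ≈ 0# → ¬ x * y ≈ 0#
  *-nonzero x≉0 y≉0 xy≈0 = y≉0 (nonzero⇒regular x≉0 _ xy≈0)

  ^-nonzero : ∀ {x} → ¬ x ≈ 0# → ∀ n → ¬ x ^ n ≈ 0#
  ^-nonzero x≉0 zero    1≈0 = nonunit (resp (sym 1≈0) 0∈)
  ^-nonzero x≉0 (suc n) = *-nonzero x≉0 (^-nonzero x≉0 n)

  cancelˡ : ∀ {x} → ¬ x ≈ 0# → ∀ {y z} → x * y ≈ x * z → y ≈ z
  cancelˡ {x} x≉0 {y} {z} eq = x∙y⁻¹≈ε⇒x≈y y z (nonzero⇒regular x≉0 _ (begin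
    x * (y - z)     ≈⟨ solve 3 (λ x y z → x :* (y :- z) := x :* y :- x :* z) refl x y z ⟩
    x * y - x * z   ≈⟨ x≈y⇒x∙y⁻¹≈ε eq ⟩
    0#              ∎))

  torsionFree : TorsionFree 𝒪
  torsionFree x px≈0 = nonzero⇒regular nonzero x (trans (sym (p×≈p1#* 𝒪 x)) px≈0)

  p∤⇒nonzero : ∀ {x} → ¬ P ∣ x → ¬ x ≈ 0#
  p∤⇒nonzero P∤x x≈0 = P∤x (resp (sym x≈0) 0∈)

  p∤⇒unit : ∀ {x} → ¬ P ∣ x → x ∣ 1#
  p∤⇒unit {x} P∤x with factorization x (p∤⇒nonzero P∤x)
  ... | zero  , u , (v , vu≈1) , x≈ = v , trans (*-congˡ (trans x≈ (*-identityʳ u))) vu≈1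
  ... | suc n , u , _          , x≈ = contradiction (resp (trans
    (solve 3 (λ u q r → u :* r :* q := u :* (q :* r)) refl u P (P ^ n)) (sym x≈)) (*∈ (u * P ^ n) (1# , *-identityˡ P))) P∤x

  unit⇒p∤ : ∀ {x} → x ∣ 1# → ¬ P ∣ x
  unit⇒p∤ (v , vx≈1) P∣x = nonunit (resp vx≈1 (*∈ v P∣x))

  p∤-* : ∀ {x y} → ¬ P ∣ x → ¬ P ∣ y → ¬ P ∣ x * y
  p∤-* P∤x P∤y P∣xy with p∤⇒unit P∤x
  ... | v , vx≈1 = P∤y (resp (begin
    v * (_ * _)  ≈⟨ *-assoc _ _ _ ⟨
    v * _ * _    ≈⟨ *-congʳ vx≈1 ⟩
    1# * _       ≈⟨ *-identityˡ _ ⟩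
    _            ∎) (*∈ v P∣xy))

  p∤-^ : ∀ {x} → ¬ P ∣ x → ∀ n → ¬ P ∣ x ^ n
  p∤-^ P∤x zero    = nonunit
  p∤-^ P∤x (suc n) = p∤-* P∤x (p∤-^ P∤x n)

  p∤-+ : ∀ {x y} → ¬ P ∣ x → P ∣ y → ¬ P ∣ x + y
  p∤-+ {x} {y} P∤x P∣y P∣x+y = P∤x (resp
    (solve 2 (λ x y → (x :+ y) :+ con (-[1+_] 0) :* y := x) refl x y)
    (+∈ P∣x+y (*∈ _ P∣y)))

  1+p∤ : ∀ {y} → P ∣ y → ¬ P ∣ 1# + y
  1+p∤ = p∤-+ nonunit

  -- If x is not nonzero then pⁿ + x is nonzero, of valuation n.
  ≈0-stable : ∀ {x} → ¬ ¬ x ≈ 0# → x ≈ 0#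
  -- Completeness enters through the injectivity of the map to the completion: an element divisible
  -- by all powers of `p` is zero.
  ≈0-stable {x} ¬¬x≈0 = proj₁ isComplete (componentwise divisible)
    where
    divisible : ∀ n → P ^ n ∣ x - 0#
    divisible n with factorization (P ^ n + x) (λ Pⁿ+x≈0 → ¬¬x≈0 λ x≈0 →
      ^-nonzero nonzero n (trans (sym (trans (+-congˡ x≈0) (+-identityʳ _))) Pⁿ+x≈0))
    ... | m , u , u∣1 , eq with m ℕ.≟ n
    ... | yes ≡.refl = u - 1# , (begin
      (u - 1#) * P ^ n        ≈⟨ solve 3 (λ o u q → (u :- o) :* q := u :* q :- o :* q) refl 1# u (P ^ n) ⟩
      u * P ^ n - 1# * P ^ n  ≈⟨ +-congˡ (-‿cong (*-identityˡ _)) ⟩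
      u * P ^ n - P ^ n       ≈⟨ +-congʳ (sym eq) ⟩
      (P ^ n + x) - P ^ n     ≈⟨ solve 2 (λ x q → (q :+ x) :- q := x :- con (+ 0)) refl x (P ^ n) ⟩
      x - 0#                  ∎)
    ... | no m≢n = contradiction (λ x≈0 → valuation (trans (sym (trans (+-congˡ x≈0) (+-identityʳ _))) eq)) ¬¬x≈0
      where
      cancel-power : ∀ m n {u v} → ¬ P ∣ u → ¬ P ∣ v → v * P ^ n ≈ u * P ^ m → m ≡ n
      cancel-power zero    zero    P∤u P∤v _  = ≡.refl
      cancel-power zero    (suc n) {u} {v} P∤u P∤v eq = contradiction
        (v * P ^ n , trans (solve 3 (λ v r q → v :* r :* q := v :* (q :* r)) refl v (P ^ n) P) (trans eq (*-identityʳ u))) P∤u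
      cancel-power (suc m) zero    {u} {v} P∤u P∤v eq = contradiction
        (u * P ^ m , trans (solve 3 (λ v r q → v :* r :* q := v :* (q :* r)) refl u (P ^ m) P) (trans (sym eq) (*-identityʳ v))) P∤v
      cancel-power (suc m) (suc n) {u} {v} P∤u P∤v eq = ≡.cong suc (cancel-power m n P∤u P∤v (cancelˡ nonzero (begin
        P * (v * P ^ n)   ≈⟨ solve 3 (λ v r q → q :* (v :* r) := v :* (q :* r)) refl v (P ^ n) P ⟩
        v * P ^ suc n     ≈⟨ eq ⟩
        u * P ^ suc m     ≈⟨ solve 3 (λ v r q → q :* (v :* r) := v :* (q :* r)) refl u (P ^ m) P ⟨
        P * (u * P ^ m)   ∎)))
      valuation : ¬ P ^ n ≈ u * P ^ m
      valuation eq′ = m≢n (cancel-power m n (unit⇒p∤ u∣1) nonunit (trans (*-identityˡ _) eq′))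

  -- A nonzero element is a unit times a power of `p`. Units go to units and powers of `p` are
  -- fixed, so its image is nonzero; `≈0-stable` yields the contrapositive.
  hom-injective : (f : 𝒪 ⟶ 𝒪) → ∀ {x} → RingHomomorphism.⟦_⟧ f x ≈ 0# → x ≈ 0#
  hom-injective f {x} fx≈0 = ≈0-stable λ x≉0 → nonzero-image x≉0 fx≈0
    where
    module f = Hom {A = 𝒪} {B = 𝒪} f
    nonzero-image : ¬ x ≈ 0# → ¬ f.⟦ x ⟧ ≈ 0#
    nonzero-image x≉0 fx≈0 with factorization x x≉0
    ... | n , u , (v , vu≈1) , x≈ = ^-nonzero nonzero n (begin
      P ^ n                         ≈⟨ *-identityˡ _ ⟨
      1# * P ^ n                    ≈⟨ *-congʳ (trans (f.⟦⟧-cong vu≈1) f.1#-homo) ⟨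
      f.⟦ v * u ⟧ * P ^ n           ≈⟨ *-cong (f.*-homo v u) (sym (pⁿ-homo {A = 𝒪} {B = 𝒪} f n)) ⟩
      f.⟦ v ⟧ * f.⟦ u ⟧ * f.⟦ P ^ n ⟧  ≈⟨ *-assoc _ _ _ ⟩
      f.⟦ v ⟧ * (f.⟦ u ⟧ * f.⟦ P ^ n ⟧)  ≈⟨ *-congˡ (f.*-homo _ _) ⟨
      f.⟦ v ⟧ * f.⟦ u * P ^ n ⟧     ≈⟨ *-congˡ (trans (f.⟦⟧-cong (sym x≈)) fx≈0) ⟩
      f.⟦ v ⟧ * 0#                  ≈⟨ zeroʳ _ ⟩
      0#                            ∎)

  -- A Bézout identity between `p` and `n`, read in 𝒪, would make 1 divisible by `p`.
  p∤n⇒P∤n : ∀ {n} → ¬ (p ∣ᴺ n) → ¬ P ∣ n ×ℕ 1#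
  p∤n⇒P∤n {n} p∤n P∣n = bézout (coprime-Bézout coprime)
    where
    coprime : Coprime p n
    coprime (d∣p , d∣n) with prime⇒irreducible p-prime d∣p
    ... | inj₁ d≡1    = d≡1
    ... | inj₂ ≡.refl = contradiction d∣n p∤n
    multiple : ∀ y {m} → P ∣ m ×ℕ 1# → P ∣ (y ℕ.* m) ×ℕ 1#
    multiple y {m} P∣m = resp (sym (×1-homo-* y m)) (*∈ (y ×ℕ 1#) P∣m)
    P∣P : P ∣ P
    P∣P = 1# , *-identityˡ P
    difference : ∀ k l → P ∣ k ×ℕ 1# → P ∣ l ×ℕ 1# → 1 ℕ.+ k ≡ l → ¬ ¬ P ∣ 1#
    difference k l P∣k P∣l eq P∤1 = 1+p∤ P∣k (resp (reflexive (≡.cong (_×ℕ 1#) (≡.sym eq))) P∣l)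
    bézout : ¬ Bézout.Identity 1 p n
    bézout (Bézout.+- x y eq) = difference _ _ (multiple y P∣n) (multiple x P∣P) eq nonunit
    bézout (Bézout.-+ x y eq) = difference _ _ (multiple x P∣P) (multiple y P∣n) eq nonunit

  -- The factors `p` of `n` are split off one at a time, each nonzero in 𝒪, until a number prime to
  -- `p` remains.
  characteristic-zero : ∀ n → 0 ℕ.< n → ¬ n ×ℕ 1# ≈ 0#
  characteristic-zero n = go n (<-wellFounded n)
    where
    go : ∀ n → Acc ℕ._<_ n → 0 ℕ.< n → ¬ n ×ℕ 1# ≈ 0#
    go n _ 0<n n≈0 with p ∣? n
    ... | no p∤n = p∤⇒nonzero (p∤n⇒P∤n p∤n) n≈0
    go _ _ () _ | yes (divides zero ≡.refl)
    go n (acc rec) 0<n n≈0 | yes (divides q@(suc _) ≡.refl) =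
      *-nonzero (go q (rec (ℕ.m<m*n q p (1<prime p-prime))) ℕ.z<s) nonzero (trans (sym (×1-homo-* q p)) n≈0)

  ×1-injective : ∀ m n → m ×ℕ 1# ≈ n ×ℕ 1# → m ≡ n
  ×1-injective zero    zero    _  = ≡.refl
  ×1-injective zero    (suc n) eq = contradiction (sym eq) (characteristic-zero (suc n) ℕ.z<s)
  ×1-injective (suc m) zero    eq = contradiction eq (characteristic-zero (suc m) ℕ.z<s)
  ×1-injective (suc m) (suc n) eq = ≡.cong suc (×1-injective m n (begin
    m ×ℕ 1#                 ≈⟨ cancel (m ×ℕ 1#) ⟨
    - 1# + suc m ×ℕ 1#      ≈⟨ +-congˡ eq ⟩
    - 1# + suc n ×ℕ 1#      ≈⟨ cancel (n ×ℕ 1#) ⟩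
    n ×ℕ 1#                 ∎))
    where
    cancel : ∀ x → - 1# + (1# + x) ≈ x
    cancel x = solve 2 (λ u x → :- u :+ (u :+ x) := x) refl 1# x

  nonzero-difference : ∀ {x y} → ¬ x ≈ y → Regular (x - y)
  nonzero-difference x≉y = nonzero⇒regular λ eq → x≉y (x∙y⁻¹≈ε⇒x≈y _ _ eq)

-- Powers of a matrix (a b ; -b a).

-- The pair (a , b) stands for the matrix (a b ; -b a).
module Gaussian (A : CommutativeRing a ℓ) where
  open CRing A
  open Solver
  open SetoidReasoning setoid

  gaussianMonoid : Monoid a ℓ
  gaussianMonoid = record
    { Carrier = Carrier × Carrier
    ; _≈_ = λ { (a , b) (c , d) → a ≈ c × b ≈ d }
    ; _∙_ = λ { (a , b) (c , d) → a * c - b * d , a * d + b * c }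
    ; ε = 1# , 0#
    ; isMonoid = record
      { isSemigroup = record
        { isMagma = record
          { isEquivalence = record
            { refl = refl , refl
            ; sym = λ { (r , s) → sym r , sym s }
            ; trans = λ { (r , s) (t , u) → trans r t , trans s u } }
          ; ∙-cong = λ { (r , s) (t , u) →
              +-cong (*-cong r t) (-‿cong (*-cong s u)) , +-cong (*-cong r u) (*-cong s t) } }
        ; assoc = λ { (a , b) (c , d) (e , f) →
            solve 6 (λ a b c d e f → (a :* c :- b :* d) :* e :- (a :* d :+ b :* c) :* f
              := a :* (c :* e :- d :* f) :- b :* (c :* f :+ d :* e)) refl a b c d e f ,
            solve 6 (λ a b c d e f → (a :* c :- b :* d) :* f :+ (a :* d :+ b :* c) :* e
              := a :* (c :* f :+ d :* e) :+ b :* (c :* e :- d :* f)) refl a b c d e f } }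
      ; identity =
          (λ { (a , b) → trans (+-cong (*-identityˡ a) (trans (-‿cong (zeroˡ b)) ε⁻¹≈ε)) (+-identityʳ a) ,
                         trans (+-cong (*-identityˡ b) (zeroˡ a)) (+-identityʳ b) }) ,
          (λ { (a , b) → trans (+-cong (*-identityʳ a) (trans (-‿cong (zeroʳ b)) ε⁻¹≈ε)) (+-identityʳ a) ,
                         trans (+-cong (zeroʳ a) (*-identityʳ b)) (+-identityˡ b) }) } }

  open Monoid gaussianMonoid public using () renaming (_∙_ to _⋆_; _≈_ to _≈ᵍ_)
  open MonoidMult gaussianMonoid public using () renaming (_×_ to _×ᵍ_; ×-assocˡ to ×ᵍ-assocˡ; ×-homo-+ to ×ᵍ-homo-+)

  re im : ℕ → Carrier × Carrier → Carrier
  re n g = proj₁ (n ×ᵍ g)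
  im n g = proj₂ (n ×ᵍ g)

  im-multiple : ∀ n a b → ∃[ t ] im n (a , b) ≈ b * t
  im-multiple zero    a b = 0# , sym (zeroʳ b)
  im-multiple (suc n) a b with im-multiple n a b
  ... | t , t≈ = a * t + re n (a , b) , trans (+-congʳ (*-congˡ t≈))
    (solve 4 (λ a b t r → a :* (b :* t) :+ b :* r := b :* (a :* t :+ r)) refl a b t _)

  -- The binomial expansion of (a + ib)ⁿ modulo b². Since `b` will be divisible by `p`, the first
  -- term decides whether the real part is a unit.
  re-expansion : ∀ n a b → ∃[ r ] re n (a , b) ≈ a ^ n + b * b * r
  re-expansion zero    a b = 0# , sym (trans (+-congˡ (zeroʳ _)) (+-identityʳ 1#))
  re-expansion (suc n) a b with re-expansion n a b | im-multiple n a b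
  ... | r , r≈ | t , t≈ = a * r - t , (begin
    a * re n (a , b) - b * im n (a , b)       ≈⟨ +-cong (*-congˡ r≈) (-‿cong (*-congˡ t≈)) ⟩
    a * (a ^ n + b * b * r) - b * (b * t)
      ≈⟨ solve 5 (λ a b u r t → a :* (u :+ b :* b :* r) :- b :* (b :* t) := a :* u :+ b :* b :* (a :* r :- t))
           refl a b (a ^ n) r t ⟩
    a ^ suc n + b * b * (a * r - t)           ∎)

  -- The odd part of the same expansion, with `b` taken out. The exponent `suc n` avoids a
  -- predecessor in the leading term.
  im-expansion : ∀ n a b → ∃[ s ] im (suc n) (a , b) ≈ b * (suc n ×ℕ a ^ n + b * b * s)
  im-expansion zero    a b = 0# , (begin
    a * 0# + b * 1#                     ≈⟨ +-cong (zeroʳ a) (*-identityʳ b) ⟩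
    0# + b                              ≈⟨ +-identityˡ b ⟩
    b                                   ≈⟨ *-identityʳ b ⟨
    b * 1#                              ≈⟨ *-congˡ (trans (+-cong (+-identityʳ 1#) (zeroʳ _)) (+-identityʳ 1#)) ⟨
    b * (1 ×ℕ 1# + b * b * 0#)          ∎)
  im-expansion (suc n) a b with im-expansion n a b | re-expansion (suc n) a b
  ... | s , s≈ | r , r≈ = a * s + r , (begin
    a * im (suc n) (a , b) + b * re (suc n) (a , b)   ≈⟨ +-cong (*-congˡ s≈) (*-congˡ r≈) ⟩
    a * (b * (suc n ×ℕ a ^ n + b * b * s)) + b * (a ^ suc n + b * b * r)
      ≈⟨ solve 6 (λ a b u s v r → a :* (b :* (u :+ b :* b :* s)) :+ b :* (v :+ b :* b :* r)
           := b :* ((v :+ a :* u) :+ b :* b :* (a :* s :+ r))) refl a b (suc n ×ℕ a ^ n) s (a ^ suc n) r ⟩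
    b * ((a ^ suc n + a * (suc n ×ℕ a ^ n)) + b * b * (a * s + r))
      ≈⟨ *-congˡ (+-congʳ (+-congˡ (×-comm-* (suc n) a (a ^ n)))) ⟩
    b * (suc (suc n) ×ℕ a ^ suc n + b * b * (a * s + r))   ∎)

module GaussianDVR (p : ℕ) (p-prime : Prime p) (𝒪 : CommutativeRing c ℓ) (dvr : IsCompleteDVR p 𝒪) where
  open CRing 𝒪
  open CompleteDVR p p-prime 𝒪 dvr
  open IsDVR (IsCompleteDVR.isDVR dvr) using (nonzero)
  open Ideal (principal 𝒪 P)
  open Gaussian 𝒪
  open Solver
  open SetoidReasoning setoid

  re-p∤ : ∀ n {a b} → ¬ P ∣ a → P ∣ b → ¬ P ∣ re n (a , b)
  re-p∤ n {a} {b} P∤a P∣b P∣re with re-expansion n a b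
  ... | r , r≈ = p∤-+ (p∤-^ P∤a n)
    (resp (solve 2 (λ b r → (b :* r) :* b := b :* b :* r) refl b r) (*∈ (b * r) P∣b)) (resp r≈ P∣re)

  im-p∣ : ∀ n {a b} → P ∣ b → P ∣ im n (a , b)
  im-p∣ n {a} {b} P∣b with im-multiple n a b
  ... | t , t≈ = resp (trans (*-comm t b) (sym t≈)) (*∈ t P∣b)

  private
    ×-as-* : ∀ n x → n ×ℕ x ≈ (n ×ℕ 1#) * x
    ×-as-* n x = trans (×-congʳ n (sym (*-identityˡ x))) (sym (×-assoc-* n 1# x))

    im-nonzero-coprime : ∀ n {a b} → 0 ℕ.< n → ¬ (p ∣ᴺ n) → ¬ P ∣ a → P ∣ b → ¬ b ≈ 0# → ¬ im n (a , b) ≈ 0#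
    im-nonzero-coprime (suc n) {a} {b} _ p∤n P∤a P∣b b≉0 im≈0 with im-expansion n a b
    ... | s , s≈ = *-nonzero b≉0 (p∤⇒nonzero (p∤-+
      (λ P∣ → p∤-* (p∤n⇒P∤n p∤n) (p∤-^ P∤a n) (resp (×-as-* (suc n) (a ^ n)) P∣))
      (resp (solve 2 (λ b r → (b :* r) :* b := b :* b :* r) refl b s) (*∈ (b * s) P∣b))))
      (trans (sym s≈) im≈0)

    -- For the exponent `p` the leading term p aᵖ⁻¹ is no longer a unit. But b² is divisible by `p`
    -- with a quotient that is still divisible by `p`, so the second factor is `p` times a unit.
    im-nonzero-p : ∀ n {a b} → suc n ≡ p → ¬ P ∣ a → P ∣ b → ¬ b ≈ 0# → ¬ im (suc n) (a , b) ≈ 0#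
    im-nonzero-p n {a} {b} ≡.refl P∤a (b′ , b′P≈b) b≉0 im≈0 with im-expansion n a b
    ... | s , s≈ = *-nonzero b≉0 (λ eq → *-nonzero nonzero (p∤⇒nonzero (p∤-+ {y = b′ * (b * s)} (p∤-^ P∤a n)
        (resp (solve 3 (λ b c s → (c :* s) :* b := c :* (b :* s)) refl b b′ s) (*∈ (b′ * s) (b′ , b′P≈b))))) (begin
          P * (a ^ n + b′ * (b * s))             ≈⟨ solve 5 (λ q u c b s → q :* (u :+ c :* (b :* s)) := q :* u :+ (c :* q) :* b :* s) refl P (a ^ n) b′ b s ⟩
          P * a ^ n + (b′ * P) * b * s           ≈⟨ +-cong (sym (×-as-* p (a ^ n))) (*-congʳ (*-congʳ b′P≈b)) ⟩
          p ×ℕ a ^ n + b * b * s                 ≈⟨ eq ⟩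
          0# ∎)) (trans (sym s≈) im≈0)

  -- A factor `p` of the exponent is removed by passing to the p-th power of (a , b), which
  -- satisfies the same hypotheses. Thus only the exponents prime to `p` and `p` itself require the
  -- expansion.
  im-nonzero : ∀ n {a b} → ¬ P ∣ a → P ∣ b → ¬ b ≈ 0# → 0 ℕ.< n → ¬ im n (a , b) ≈ 0#
  im-nonzero n = go n (<-wellFounded n)
    where
    go : ∀ n → Acc ℕ._<_ n → ∀ {a b} → ¬ P ∣ a → P ∣ b → ¬ b ≈ 0# → 0 ℕ.< n → ¬ im n (a , b) ≈ 0#
    go n (acc rec) {a} {b} P∤a P∣b b≉0 0<n im≈0 with p ∣? n
    ... | no p∤n = im-nonzero-coprime n 0<n p∤n P∤a P∣b b≉0 im≈0
    ... | yes (divides zero ≡.refl) = ℕ.n≮0 0<n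
    ... | yes (divides q@(suc _) ≡.refl) =
      go q (rec (ℕ.m<m*n q p (1<prime p-prime))) (re-p∤ p P∤a P∣b) (im-p∣ p P∣b) imₚ≉0 ℕ.z<s
        (trans (proj₂ (×ᵍ-assocˡ (a , b) q p)) im≈0)
      where
      imₚ≉0 : ¬ im p (a , b) ≈ 0#
      imₚ≉0 with ℕ.suc-pred p {{ℕ.>-nonZero (0<prime p-prime)}}
      ... | eq = λ imₚ≈0 → im-nonzero-p (ℕ.pred p) eq P∤a P∣b b≉0
        (trans (reflexive (≡.cong (λ k → im k (a , b)) eq)) imₚ≈0)

  -- With j = l - k, the determinant of the two coordinate vectors is the norm of the k-th power, a
  -- unit, times the imaginary part of the j-th power, which is nonzero.
  powers-independent : ∀ {a b} → ¬ P ∣ a → P ∣ b → ¬ b ≈ 0# → ∀ {k l} → k ℕ.< l →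
    ¬ re k (a , b) * im l (a , b) ≈ re l (a , b) * im k (a , b)
  powers-independent {a} {b} P∤a P∣b b≉0 {k} {l} k<l eq with ℕ.m∸n+n≡m (ℕ.<⇒≤ k<l)
  ... | j+k≡l = *-nonzero
      (p∤⇒nonzero (p∤-+ (p∤-* re-k re-k) (*∈ (im k g) (im-p∣ k P∣b))))
      (im-nonzero (l ℕ.∸ k) P∤a P∣b b≉0 (ℕ.m<n⇒0<n∸m k<l)) (begin
    (re k g * re k g + im k g * im k g) * im j g
      ≈⟨ solve 4 (λ r s t u → (r :* r :+ s :* s) :* t
           := r :* (u :* s :+ t :* r) :- (u :* r :- t :* s) :* s) refl (re k g) (im k g) (im j g) (re j g) ⟩
    re k g * (re j g * im k g + im j g * re k g) - (re j g * re k g - im j g * im k g) * im k g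
      ≈⟨ +-cong (*-congˡ (proj₂ l-power)) (-‿cong (*-congʳ (proj₁ l-power))) ⟨
    re k g * im l g - re l g * im k g   ≈⟨ x≈y⇒x∙y⁻¹≈ε eq ⟩
    0#                                  ∎)
    where
    g = a , b
    j = l ℕ.∸ k
    re-k = re-p∤ k P∤a P∣b
    l-power : re l g ≈ re j g * re k g - im j g * im k g × im l g ≈ re j g * im k g + im j g * re k g
    l-power = ≡.subst (λ l → (re l g ≈ re j g * re k g - im j g * im k g × im l g ≈ re j g * im k g + im j g * re k g))
      j+k≡l (×ᵍ-homo-+ g j k)

idʰ : (A : CommutativeRing a ℓ) → A ⟶ A
idʰ A = mkHom {A = A} {B = A} id id (λ _ _ → refl) (λ _ _ → refl) refl
  where open CommutativeRing A

-- Polynomial identities for the coordinate rings.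

module Identities (A : CommutativeRing a ℓ) where
  open CRing A
  open Solver

  clear-sum : ∀ s t u v → (s + t) * (u * v) ≈ (s * u) * v + (t * v) * u
  clear-sum = solve 4 (λ s t u v → (s :+ t) :* (u :* v) := (s :* u) :* v :+ (t :* v) :* u) refl

  clear-product : ∀ s t u v → (s * t) * (u * v) ≈ (s * u) * (t * v)
  clear-product = solve 4 (λ s t u v → (s :* t) :* (u :* v) := (s :* u) :* (t :* v)) refl

  clear-neg : ∀ s u → (- s) * u ≈ - (s * u)
  clear-neg = solve 2 (λ s u → (:- s) :* u := :- (s :* u)) refl

  linear-sum : ∀ s t u v b → (s + b * t) + (u + b * v) ≈ (s + u) + b * (t + v)
  linear-sum = solve 5 (λ s t u v b → (s :+ b :* t) :+ (u :+ b :* v) := (s :+ u) :+ b :* (t :+ v)) refl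

  linear-neg : ∀ s t b → - (s + b * t) ≈ - s + b * - t
  linear-neg = solve 3 (λ s t b → :- (s :+ b :* t) := :- s :+ b :* (:- t)) refl

  -- The square of `b` is written as the norm minus `a * a`. In this form the identity holds in
  -- every ring, and on G″, where the norm is 1, it removes the squares of β.
  linear-product : ∀ s t u v a b → (s + b * t) * (u + b * v) ≈
    (s * u + ((a * a + b * b) - a * a) * (t * v)) + b * (s * v + t * u)
  linear-product = solve 6 (λ s t u v a b → (s :+ b :* t) :* (u :+ b :* v) :=
    (s :* u :+ ((a :* a :+ b :* b) :- a :* a) :* (t :* v)) :+ b :* (s :* v :+ t :* u)) refl

  norm-scaled : ∀ x t v w → (x * x + (x * t) * (x * t)) * ((v * v) * w) ≈
    ((v * x) * (v * x)) * (w * ((t * t) + 1# * 1#))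
  norm-scaled x t v w = trans
    (solve 4 (λ x t v w → (x :* x :+ (x :* t) :* (x :* t)) :* ((v :* v) :* w) :=
      ((v :* x) :* (v :* x)) :* (w :* (t :* t)) :+ ((v :* x) :* (v :* x)) :* w) refl x t v w)
    (trans (+-congˡ (*-congˡ (sym (trans (*-congˡ (*-identityˡ 1#)) (*-identityʳ w)))))
      (solve 4 (λ o t u w → u :* (w :* (t :* t)) :+ u :* (w :* (o :* o)) := u :* (w :* (t :* t :+ o :* o))) refl
        1# t ((v * x) * (v * x)) w))

  stereographic : ∀ s u → let r = (1# - s * s) * u ; i = (s + s) * u
    in r * r + i * i ≈ (u * (1# + s * s)) * (u * (1# + s * s))
  stereographic s u = trans
    (solve 3 (λ o s u → ((o :- s :* s) :* u) :* ((o :- s :* s) :* u) :+ ((s :+ s) :* u) :* ((s :+ s) :* u) :=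
      (u :* (o :+ s :* s)) :* (u :* (o :+ s :* s)) :+ (con (+ 4) :* (s :* s) :* (u :* u) :- con (+ 4) :* o :* (s :* s) :* (u :* u)))
      refl 1# s u)
    (trans (+-congˡ (x≈y⇒x∙y⁻¹≈ε (*-congʳ (*-congʳ (sym (*-identityʳ _)))))) (+-identityʳ _))

-- Functions on G′ and G″ are determined by their values at points.

module Density (p : ℕ) (p-prime : Prime p) (𝒪 : CommutativeRing c ℓ) (dvr : IsCompleteDVR p 𝒪) where
  open Groups 𝒪 renaming (x to entry)
  open CompleteDVR p p-prime 𝒪 dvr
  open PAdicProperties p
  private
    module 𝒪 = CRing 𝒪
  open Horner 𝒪 using (Regular; horner; horner-map; horner-cong; roots-on-infinitely-many-lines; infinitely-many-roots⇒All)

  module _ (𝒫 : Presentation) where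
    private
      module R = CRing (algebra 𝒫)
      module con = RingHomomorphism (structureMap 𝒫)
      open Presentation 𝒫
      module H = Horner (algebra 𝒫)

    constants-subring : H.IsSubring {C = 𝒪.Carrier} con
    constants-subring = record
      { zero-closed = 𝒪.0# , R.refl
      ; +-closed = λ x y → x 𝒪.+ y , con-⊕ x y
      ; *-closed = λ x y → x 𝒪.* y , con-⊗ x y
      ; neg-closed = λ x → 𝒪.- x , con.-‿homo x }

    term-induction : (S : Term Gen → Set ℓ′) →
      (∀ x → S (con x)) → (∀ g → S (var g)) →
      (∀ s t → S s → S t → S (s ⊕ t)) → (∀ s t → S s → S t → S (s ⊗ t)) → (∀ s → S s → S (⊝ s)) →
      ∀ t → S t
    term-induction S S-con S-var S-⊕ S-⊗ S-⊝ = go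
      where
      go : ∀ t → S t
      go (var g) = S-var g
      go (con x) = S-con x
      go (s ⊕ t) = S-⊕ s t (go s) (go t)
      go (s ⊗ t) = S-⊗ s t (go s) (go t)
      go (⊝ s)   = S-⊝ s (go s)

    con-zero : (σ : 𝒪 ⟶ 𝒪) → ∀ {c} → RingHomomorphism.⟦_⟧ σ c 𝒪.≈ 𝒪.0# → con c R.≈ R.0#
    con-zero σ σc≈0 = con-cong (hom-injective σ σc≈0)

    module _ (σ : 𝒪 ⟶ 𝒪) (f : algebra 𝒫 ⟶ 𝒪)
             (f-con : ∀ c → RingHomomorphism.⟦_⟧ f (con c) 𝒪.≈ RingHomomorphism.⟦_⟧ σ c) where
      private
        module σ = RingHomomorphism σ
        module f = RingHomomorphism f

      hom-horner : ∀ x {x′} → f.⟦ x ⟧ 𝒪.≈ x′ → ∀ cs → f.⟦ H.horner con x cs ⟧ 𝒪.≈ horner id x′ (map σ.⟦_⟧ cs)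
      hom-horner x {x′} x≈ cs = 𝒪.trans (horner-hom {A = algebra 𝒫} {B = 𝒪} f con x cs)
        (𝒪.trans (horner-cong f-con x≈ cs) (𝒪.reflexive (horner-map id σ.⟦_⟧ x′ cs)))

      hom-horner₂ : ∀ x y {x′ y′} → f.⟦ x ⟧ 𝒪.≈ x′ → f.⟦ y ⟧ 𝒪.≈ y′ → ∀ css →
        f.⟦ H.horner (H.horner con x) y css ⟧ 𝒪.≈ horner (horner id x′) y′ (map (map σ.⟦_⟧) css)
      hom-horner₂ x y {x′} {y′} x≈ y≈ css = 𝒪.trans (horner-hom {A = algebra 𝒫} {B = 𝒪} f (H.horner con x) y css)
        (𝒪.trans (horner-cong (hom-horner x x≈) y≈ css) (𝒪.reflexive (horner-map (horner id x′) (map σ.⟦_⟧) y′ css)))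

  module _ where
    private
      module R = CRing 𝒪[G′]
      module H = Horner 𝒪[G′]
      open Identities 𝒪[G′]
      N n : R.Carrier
      N = var α R.* var α R.+ var β R.* var β
      n = var 1/N

      S₁ : H.IsSubring (H.horner con (var α))
      S₁ = H.adjoin (constants-subring 𝒪[G′]-presentation) (var α)
      S₂ : H.IsSubring (H.horner (H.horner con (var α)) (var β))
      S₂ = H.adjoin S₁ (var β)
      open H.IsSubring S₂

      polynomial : List (List 𝒪.Carrier) → R.Carrier
      polynomial = H.horner (H.horner con (var α)) (var β)

      con-code : ∀ c → ∃[ css ] polynomial css R.≈ con c
      con-code c with H.constants⊂adjoin (constants-subring 𝒪[G′]-presentation) (var α) c
      ... | cs , cs≈ with H.constants⊂adjoin S₁ (var β) cs
      ... | css , css≈ = css , R.trans css≈ cs≈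

      α-code : ∃[ css ] polynomial css R.≈ var α
      α-code with H.generator∈adjoin (constants-subring 𝒪[G′]-presentation) (var α) {𝒪.1#} R.refl
      ... | cs , cs≈ with H.constants⊂adjoin S₁ (var β) cs
      ... | css , css≈ = css , R.trans css≈ cs≈

      β-code : ∃[ css ] polynomial css R.≈ var β
      β-code with H.constants⊂adjoin (constants-subring 𝒪[G′]-presentation) (var α) 𝒪.1#
      ... | u , u≈1 = H.generator∈adjoin S₁ (var β) {u} u≈1

      _·_ : ∀ {s t} → ∃[ css ] polynomial css R.≈ s → ∃[ css ] polynomial css R.≈ t → ∃[ css ] polynomial css R.≈ s R.* t
      (cs , s≈) · (ds , t≈) with *-closed cs ds
      ... | es , es≈ = es , R.trans es≈ (R.*-cong s≈ t≈)

      _∔_ : ∀ {s t} → ∃[ css ] polynomial css R.≈ s → ∃[ css ] polynomial css R.≈ t → ∃[ css ] polynomial css R.≈ s R.+ t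
      (cs , s≈) ∔ (ds , t≈) with +-closed cs ds
      ... | es , es≈ = es , R.trans es≈ (R.+-cong s≈ t≈)

      N^-code : ∀ k → ∃[ css ] polynomial css R.≈ N R.^ k
      N^-code zero    = con-code 𝒪.1#
      N^-code (suc k) = ((α-code · α-code) ∔ (β-code · β-code)) · N^-code k

      -- Denominators are cleared by a power of the norm, so that a function on G′ acquires
      -- coefficients to which the root counting applies.
      Fraction : R.Carrier → Set (c Level.⊔ ℓ)
      Fraction t = ∃[ k ] ∃[ css ] polynomial css R.≈ t R.* N R.^ k

      integral : ∀ {t} → ∃[ css ] polynomial css R.≈ t → Fraction t
      integral (css , eq) = 0 , css , R.trans eq (R.sym (R.*-identityʳ _))

      fraction : ∀ t → Fraction t
      fraction = term-induction 𝒪[G′]-presentation Fraction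
        (λ x → integral (con-code x))
        (λ { α → integral α-code
           ; β → integral β-code
           ; 1/N → 1 , proj₁ (con-code 𝒪.1#) , R.trans (proj₂ (con-code 𝒪.1#)) (R.sym
               (R.trans (R.*-congˡ (R.*-identityʳ N)) (R.trans (R.*-comm n N) (relation tt)))) })
        (λ { s t (k , cs , cs≈) (l , ds , ds≈) →
          let es , es≈ = ((cs , cs≈) · N^-code l) ∔ ((ds , ds≈) · N^-code k)
          in k ℕ.+ l , es , R.trans es≈ (R.sym (R.trans (R.*-congˡ (R.^-homo-* N k l)) (clear-sum s t _ _))) })
        (λ { s t (k , cs , cs≈) (l , ds , ds≈) →
          let es , es≈ = (cs , cs≈) · (ds , ds≈)
          in k ℕ.+ l , es , R.trans es≈ (R.sym (R.trans (R.*-congˡ (R.^-homo-* N k l)) (clear-product s t _ _))) })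
        (λ { s (k , cs , cs≈) →
          let es , es≈ = neg-closed cs
          in k , es , R.trans es≈ (R.trans (R.-‿cong cs≈) (R.sym (clear-neg s _))) })

    -- The points are semilinear over `σ`, so the root counting kills the images under `σ` of the
    -- coefficients. Injectivity of `σ` kills the coefficients, and the power of the norm used to
    -- clear denominators is invertible.
    vanishing-on-G′ : (σ : 𝒪 ⟶ 𝒪) →
      (t : ℕ → 𝒪.Carrier) → (∀ {k l} → k ≢ l → Regular (t k 𝒪.- t l)) →
      (x : ℕ → ℕ → 𝒪.Carrier) → (∀ k {i j} → i ≢ j → Regular (x k i 𝒪.- x k j)) →
      (f : ℕ → ℕ → 𝒪[G′] ⟶ 𝒪) → let module f k i = RingHomomorphism (f k i) in
      (∀ k i c → f.⟦_⟧ k i (con c) 𝒪.≈ RingHomomorphism.⟦_⟧ σ c) →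
      (∀ k i → f.⟦_⟧ k i (var α) 𝒪.≈ x k i) →
      (∀ k i → f.⟦_⟧ k i (var β) 𝒪.≈ x k i 𝒪.* t k) →
      ∀ s → (∀ k i → f.⟦_⟧ k i s 𝒪.≈ 𝒪.0#) → s R.≈ R.0#
    vanishing-on-G′ σ t t-reg x x-reg f f-con f-α f-β s fs≈0 with fraction s
    ... | m , css , css≈ = begin
      s                          ≈⟨ R.*-identityʳ s ⟨
      s R.* R.1#                 ≈⟨ R.*-congˡ (R.trans (R.^-congˡ m (relation tt)) (1^ 𝒪[G′] m)) ⟨
      s R.* (N R.* n) R.^ m      ≈⟨ R.*-congˡ (R.^-distrib-* N n m) ⟩
      s R.* (N R.^ m R.* n R.^ m)  ≈⟨ R.*-assoc _ _ _ ⟨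
      (s R.* N R.^ m) R.* n R.^ m  ≈⟨ R.*-congʳ (R.trans (R.sym css≈) polynomial≈0) ⟩
      R.0# R.* n R.^ m           ≈⟨ R.zeroˡ _ ⟩
      R.0#                       ∎
      where
      open SetoidReasoning R.setoid
      module f k i = RingHomomorphism (f k i)
      roots : ∀ k i → horner (horner id (x k i)) (x k i 𝒪.* t k) (map (map (RingHomomorphism.⟦_⟧ σ)) css) 𝒪.≈ 𝒪.0#
      roots k i = 𝒪.trans (𝒪.sym (hom-horner₂ 𝒪[G′]-presentation σ (f k i) (f-con k i) (var α) (var β) (f-α k i) (f-β k i) css))
        (𝒪.trans (f.⟦⟧-cong k i css≈) (𝒪.trans (f.*-homo k i s _) (𝒪.trans (𝒪.*-congʳ (fs≈0 k i)) (𝒪.zeroˡ _))))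
      polynomial≈0 : polynomial css R.≈ R.0#
      polynomial≈0 = H.horner-all-zero (var β) (All.map (λ z → H.horner-all-zero (var α) (All.map (con-zero 𝒪[G′]-presentation σ) (All.map⁻ z)))
        (All.map⁻ (roots-on-infinitely-many-lines t t-reg x x-reg (map (map (RingHomomorphism.⟦_⟧ σ)) css) roots)))

  module _ where
    private
      module R = CRing 𝒪[G″]
      module H = Horner 𝒪[G″]
      open Identities 𝒪[G″]
      N : R.Carrier
      N = var α R.* var α R.+ var β R.* var β

      polynomial : List 𝒪.Carrier → R.Carrier
      polynomial = H.horner con (var α)

      S₁ : H.IsSubring polynomial
      S₁ = H.adjoin (constants-subring 𝒪[G″]-presentation) (var α)
      open H.IsSubring S₁

      -- On G″ one has β² = 1 - α², so a function is linear in β over the polynomials in α.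
      Linear : R.Carrier → Set (c Level.⊔ ℓ)
      Linear t = ∃[ cs ] ∃[ ds ] polynomial cs R.+ var β R.* polynomial ds R.≈ t

      linear : ∀ t → Linear t
      linear = term-induction 𝒪[G″]-presentation Linear
        (λ c → con-linear c)
        (λ { α → α-code , [] , R.trans (R.+-cong α≈ (R.zeroʳ _)) (R.+-identityʳ _)
           ; β → [] , one-code , R.trans (R.+-identityˡ _) (R.trans (R.*-congˡ one≈) (R.*-identityʳ _)) })
        (λ { s t (cs , ds , s≈) (es , fs , t≈) →
          let us , us≈ = +-closed cs es
              vs , vs≈ = +-closed ds fs
          in us , vs , R.trans (R.+-cong us≈ (R.*-congˡ vs≈))
            (R.trans (R.sym (linear-sum _ _ _ _ (var β))) (R.+-cong s≈ t≈)) })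
        (λ { s t (cs , ds , s≈) (es , fs , t≈) →
          let k₁ , k₁≈ = *-closed cs es
              k₂ , k₂≈ = *-closed ds fs
              k₃ , k₃≈ = *-closed β²-code k₂
              k₄ , k₄≈ = +-closed k₁ k₃
              l₁ , l₁≈ = *-closed cs fs
              l₂ , l₂≈ = *-closed ds es
              l₃ , l₃≈ = +-closed l₁ l₂
          in k₄ , l₃ , R.trans
            (R.+-cong (R.trans k₄≈ (R.+-cong k₁≈ (R.trans k₃≈ (R.*-cong β²≈ k₂≈))))
              (R.*-congˡ (R.trans l₃≈ (R.+-cong l₁≈ l₂≈))))
            (R.trans (R.sym (linear-product _ _ _ _ (var α) (var β))) (R.*-cong s≈ t≈)) })
        (λ { s (cs , ds , s≈) →
          let us , us≈ = neg-closed cs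
              vs , vs≈ = neg-closed ds
          in us , vs , R.trans (R.+-cong us≈ (R.*-congˡ vs≈))
            (R.trans (R.sym (linear-neg _ _ (var β))) (R.-‿cong s≈)) })
        where
        constants = H.constants⊂adjoin (constants-subring 𝒪[G″]-presentation) (var α)
        con-linear : ∀ c → Linear (con c)
        con-linear c with constants c
        ... | cs , cs≈ = cs , [] , R.trans (R.+-cong cs≈ (R.zeroʳ _)) (R.+-identityʳ _)
        one-code = proj₁ (constants 𝒪.1#)
        one≈ = proj₂ (constants 𝒪.1#)
        α-generator = H.generator∈adjoin (constants-subring 𝒪[G″]-presentation) (var α) {𝒪.1#} R.refl
        α-code = proj₁ α-generator
        α≈ = proj₂ α-generator
        α² = *-closed α-code α-code
        -α² = neg-closed (proj₁ α²)
        β²-sum = +-closed one-code (proj₁ -α²)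
        β²-code = proj₁ β²-sum
        β²≈ : polynomial β²-code R.≈ N R.- var α R.* var α
        β²≈ = R.trans (proj₂ β²-sum) (R.+-cong (R.trans one≈ (R.sym (relation tt)))
          (R.trans (proj₂ -α²) (R.-‿cong (R.trans (proj₂ α²) (R.*-cong α≈ α≈)))))

    module _ (2-reg : Regular (2 𝒪.×ℕ 𝒪.1#)) where
      private
        open SetoidReasoning 𝒪.setoid
        open 𝒪.Solver using (solve; _:+_; _:*_; _:-_; :-_; _:=_)

        plus-minus : ∀ {u v b} → Regular b → u 𝒪.+ b 𝒪.* v 𝒪.≈ 𝒪.0# → u 𝒪.+ 𝒪.- b 𝒪.* v 𝒪.≈ 𝒪.0# →
                     u 𝒪.≈ 𝒪.0# × v 𝒪.≈ 𝒪.0#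
        plus-minus {u} {v} {b} b-reg eq eq′ = u≈0 , b-reg v (begin
          b 𝒪.* v                   ≈⟨ 𝒪.+-identityˡ _ ⟨
          𝒪.0# 𝒪.+ b 𝒪.* v          ≈⟨ 𝒪.+-congʳ u≈0 ⟨
          u 𝒪.+ b 𝒪.* v             ≈⟨ eq ⟩
          𝒪.0#                      ∎)
          where
          u≈0 = 2-reg u (begin
            (2 𝒪.×ℕ 𝒪.1#) 𝒪.* u     ≈⟨ 𝒪.×-assoc-* 2 𝒪.1# u ⟩
            2 𝒪.×ℕ (𝒪.1# 𝒪.* u)     ≈⟨ 𝒪.+-cong (𝒪.*-identityˡ u) (𝒪.trans (𝒪.+-identityʳ _) (𝒪.*-identityˡ u)) ⟩
            u 𝒪.+ u                 ≈⟨ solve 3 (λ u v b → u :+ u := (u :+ b :* v) :+ (u :+ (:- b) :* v)) 𝒪.refl u v b ⟩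
            (u 𝒪.+ b 𝒪.* v) 𝒪.+ (u 𝒪.+ 𝒪.- b 𝒪.* v) ≈⟨ 𝒪.+-cong eq eq′ ⟩
            𝒪.0# 𝒪.+ 𝒪.0#           ≈⟨ 𝒪.+-identityˡ _ ⟩
            𝒪.0#                    ∎)

      -- The two points with the same α and opposite β separate the part free of β from the
      -- coefficient of β. Each part is then a polynomial in α with infinitely many roots.
      vanishing-on-G″ :
        (a b : ℕ → 𝒪.Carrier) → (∀ {i j} → i ≢ j → Regular (a i 𝒪.- a j)) → (∀ i → Regular (b i)) →
        (f f⁻ : ℕ → 𝒪[G″] ⟶ 𝒪) →
        let module f i = RingHomomorphism (f i)
            module f⁻ i = RingHomomorphism (f⁻ i) in
        (∀ i c → f.⟦_⟧ i (con c) 𝒪.≈ c) → (∀ i c → f⁻.⟦_⟧ i (con c) 𝒪.≈ c) →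
        (∀ i → f.⟦_⟧ i (var α) 𝒪.≈ a i) → (∀ i → f⁻.⟦_⟧ i (var α) 𝒪.≈ a i) →
        (∀ i → f.⟦_⟧ i (var β) 𝒪.≈ b i) → (∀ i → f⁻.⟦_⟧ i (var β) 𝒪.≈ 𝒪.- b i) →
        ∀ s → (∀ i → f.⟦_⟧ i s 𝒪.≈ 𝒪.0#) → (∀ i → f⁻.⟦_⟧ i s 𝒪.≈ 𝒪.0#) → s R.≈ R.0#
      vanishing-on-G″ a b a-reg b-reg f f⁻ f-con f⁻-con f-α f⁻-α f-β f⁻-β s fs≈0 f⁻s≈0 with linear s
      ... | cs , ds , s≈ = R.trans (R.sym s≈)
        (R.trans (R.+-cong (polynomial-zero cs (λ i → proj₁ (both i))) (R.*-congˡ (polynomial-zero ds (λ i → proj₂ (both i)))))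
        (R.trans (R.+-identityˡ _) (R.zeroʳ _)))
        where
        σ = RingHomomorphism.⟦_⟧ (idʰ 𝒪)
        value : ℕ → List 𝒪.Carrier → 𝒪.Carrier
        value i es = horner id (a i) (map σ es)
        at-point : (g : 𝒪[G″] ⟶ 𝒪) → let module g = RingHomomorphism g in (∀ c → g.⟦ con c ⟧ 𝒪.≈ c) → ∀ i {b′} →
          g.⟦ var α ⟧ 𝒪.≈ a i → g.⟦ var β ⟧ 𝒪.≈ b′ → g.⟦ s ⟧ 𝒪.≈ 𝒪.0# → value i cs 𝒪.+ b′ 𝒪.* value i ds 𝒪.≈ 𝒪.0#
        at-point g g-con i {b′} g-α g-β gs≈0 = begin
          value i cs 𝒪.+ b′ 𝒪.* value i ds
            ≈⟨ 𝒪.+-cong (eval-poly cs) (𝒪.*-cong g-β (eval-poly ds)) ⟨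
          g.⟦ polynomial cs ⟧ 𝒪.+ g.⟦ var β ⟧ 𝒪.* g.⟦ polynomial ds ⟧   ≈⟨ 𝒪.+-congˡ (g.*-homo _ _) ⟨
          g.⟦ polynomial cs ⟧ 𝒪.+ g.⟦ var β R.* polynomial ds ⟧         ≈⟨ g.+-homo _ _ ⟨
          g.⟦ polynomial cs R.+ var β R.* polynomial ds ⟧               ≈⟨ g.⟦⟧-cong s≈ ⟩
          g.⟦ s ⟧                                                       ≈⟨ gs≈0 ⟩
          𝒪.0#                                                          ∎
          where
          module g = RingHomomorphism g
          eval-poly = hom-horner 𝒪[G″]-presentation (idʰ 𝒪) g g-con (var α) g-α
        both : ∀ i → value i cs 𝒪.≈ 𝒪.0# × value i ds 𝒪.≈ 𝒪.0#
        both i = plus-minus (b-reg i) (at-point (f i) (f-con i) i (f-α i) (f-β i) (fs≈0 i))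
          (at-point (f⁻ i) (f⁻-con i) i (f⁻-α i) (f⁻-β i) (f⁻s≈0 i))
        polynomial-zero : ∀ es → (∀ i → value i es 𝒪.≈ 𝒪.0#) → polynomial es R.≈ R.0#
        polynomial-zero es es≈0 = H.horner-all-zero (var α)
          (All.map (con-zero 𝒪[G″]-presentation (idʰ 𝒪)) (All.map⁻ (infinitely-many-roots⇒All a a-reg (map σ es) es≈0)))

  private
    -- The residue field may be finite, so the points are taken near a fixed residue: multiples of
    -- `p` are infinitely many, and adding one to 1 leaves a unit.
    multiple : ℕ → 𝒪.Carrier
    multiple k = (k ℕ.* p) 𝒪.×ℕ 𝒪.1#

    p∣multiple : ∀ k → P 𝒪.∣ multiple k
    p∣multiple k = k 𝒪.×ℕ 𝒪.1# , 𝒪.sym (𝒪.×1-homo-* k p)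

    multiple-injective : ∀ {k l} → multiple k 𝒪.≈ multiple l → k ≡ l
    multiple-injective {k} {l} eq = ℕ.*-cancelʳ-≡ k l p {{ℕ.>-nonZero (0<prime p-prime)}} (×1-injective _ _ eq)

    p∣* : ∀ x {y} → P 𝒪.∣ y → P 𝒪.∣ x 𝒪.* y
    p∣* = Ideal.*∈ (principal 𝒪 P)

    module id = RingHomomorphism (idʰ 𝒪)

  𝒪[G′]-torsionFree : TorsionFree 𝒪[G′]
  𝒪[G′]-torsionFree f pf≈0 = vanishing-on-G′ (idʰ 𝒪)
    multiple (λ k≢l → nonzero-difference (k≢l ∘ multiple-injective))
    (λ _ → x) (λ _ i≢j → nonzero-difference λ eq → i≢j (multiple-injective (+-cancelˡ eq)))
    (λ k i → evalG′ 𝒪 (idʰ 𝒪) (point k i)) (λ _ _ _ → 𝒪.refl) (λ _ _ → 𝒪.refl) (λ _ _ → 𝒪.refl)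
    f (λ k i → torsionFree _ (𝒪.trans
      (𝒪.sym (Hom.×ℕ-homo {A = 𝒪[G′]} {B = 𝒪} (evalG′ 𝒪 (idʰ 𝒪) (point k i)) p f))
      (𝒪.trans (RingHomomorphism.⟦⟧-cong (evalG′ 𝒪 (idʰ 𝒪) (point k i)) pf≈0) 𝒪.refl)))
    where
    x : ℕ → 𝒪.Carrier
    x i = 𝒪.1# 𝒪.+ multiple i
    +-cancelˡ : ∀ {u v} → 𝒪.1# 𝒪.+ u 𝒪.≈ 𝒪.1# 𝒪.+ v → u 𝒪.≈ v
    +-cancelˡ {u} {v} eq = 𝒪.trans (𝒪.sym (cancel u)) (𝒪.trans (𝒪.+-congˡ eq) (cancel v))
      where
      open 𝒪.Solver using (solve; _:+_; :-_; _:=_)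
      cancel : ∀ u → 𝒪.- 𝒪.1# 𝒪.+ (𝒪.1# 𝒪.+ u) 𝒪.≈ u
      cancel u = solve 2 (λ o u → :- o :+ (o :+ u) := u) 𝒪.refl 𝒪.1# u
    point : ℕ → ℕ → PointG′ 𝒪
    -- The norm of (x , x t) is x² (1 + t²). Here x is 1 plus a multiple of `p` and t is a multiple
    -- of `p`, so both factors are units.
    point k i with p∤⇒unit (1+p∤ (p∣multiple i)) | p∤⇒unit (1+p∤ (p∣* (multiple k) (p∣multiple k)))
    ... | v , vx≈1 | w , wm≈1 = record
      { a₁ = x i ; a₂ = x i 𝒪.* multiple k ; n⁻¹ = (v 𝒪.* v) 𝒪.* w
      ; norm*n⁻¹≈1 = 𝒪.trans (Identities.norm-scaled 𝒪 (x i) (multiple k) v w)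
          (𝒪.trans (𝒪.*-cong (𝒪.trans (𝒪.*-cong vx≈1 vx≈1) (𝒪.*-identityˡ 𝒪.1#))
            (𝒪.trans (𝒪.*-congˡ (𝒪.trans (𝒪.+-comm _ _) (𝒪.+-congʳ (𝒪.*-identityˡ 𝒪.1#)))) wm≈1)) (𝒪.*-identityˡ 𝒪.1#)) }

  module _ (2-reg : Regular (2 𝒪.×ℕ 𝒪.1#)) where
    private
      -- Parameters for the rational parametrisation of the circle by lines through (-1 , 0). The
      -- shift by one excludes s = 0, where the second coordinate would vanish.
      s : ℕ → 𝒪.Carrier
      s k = multiple (suc k)

      double : ∀ x → (2 𝒪.×ℕ 𝒪.1#) 𝒪.* x 𝒪.≈ x 𝒪.+ x
      double x = 𝒪.trans (𝒪.×-assoc-* 2 𝒪.1# x)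
        (𝒪.+-cong (𝒪.*-identityˡ x) (𝒪.trans (𝒪.+-identityʳ _) (𝒪.*-identityˡ x)))

      inverse : ∀ k → (𝒪.1# 𝒪.+ s k 𝒪.* s k) 𝒪.∣ 𝒪.1#
      inverse k = p∤⇒unit (1+p∤ (p∣* (s k) (p∣multiple (suc k))))

      u ξ η : ℕ → 𝒪.Carrier
      u k with inverse k
      ... | v , _ = v
      ξ k = (𝒪.1# 𝒪.- s k 𝒪.* s k) 𝒪.* u k
      η k = (s k 𝒪.+ s k) 𝒪.* u k

      u-inverse : ∀ k → u k 𝒪.* (𝒪.1# 𝒪.+ s k 𝒪.* s k) 𝒪.≈ 𝒪.1#
      u-inverse k with inverse k
      ... | _ , eq = eq

      norm : ∀ k → ξ k 𝒪.* ξ k 𝒪.+ η k 𝒪.* η k 𝒪.≈ 𝒪.1#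
      norm k = 𝒪.trans (Identities.stereographic 𝒪 (s k) (u k))
        (𝒪.trans (𝒪.*-cong (u-inverse k) (u-inverse k)) (𝒪.*-identityˡ 𝒪.1#))

      conjugate-norm : ∀ k → ξ k 𝒪.* ξ k 𝒪.+ 𝒪.- η k 𝒪.* 𝒪.- η k 𝒪.≈ 𝒪.1#
      conjugate-norm k = 𝒪.trans (𝒪.+-congˡ (solve 1 (λ b → (:- b) :* (:- b) := b :* b) 𝒪.refl (η k))) (norm k)
        where open 𝒪.Solver using (solve; _:*_; :-_; _:=_)

      square-injective : ∀ {m n} → m ℕ.* m ≡ n ℕ.* n → m ≡ n
      square-injective {m} {n} eq with ℕ.<-cmp m n
      ... | tri< m<n _ _ = contradiction eq (ℕ.<⇒≢ (ℕ.*-mono-< m<n m<n))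
      ... | tri≈ _ m≡n _ = m≡n
      ... | tri> _ _ n<m = contradiction (≡.sym eq) (ℕ.<⇒≢ (ℕ.*-mono-< n<m n<m))

      -- Since ξ + 1 = 2 u, the first coordinate determines `u`, hence its inverse 1 + s² and hence
      -- s². The parameters are natural numbers, and these are determined by their squares.
      ξ-injective : ∀ {k l} → ξ k 𝒪.≈ ξ l → k ≡ l
      ξ-injective {k} {l} ξ≈ = ℕ.suc-injective (ℕ.*-cancelʳ-≡ (suc k) (suc l) p {{ℕ.>-nonZero (0<prime p-prime)}}
        (square-injective (×1-injective _ _ (𝒪.trans (𝒪.×1-homo-* n n) (𝒪.trans s²≈ (𝒪.sym (𝒪.×1-homo-* m m)))))))
        where
        open SetoidReasoning 𝒪.setoid
        open 𝒪.Solver using (solve; _:+_; _:*_; _:-_; :-_; _:=_)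
        n = suc k ℕ.* p
        m = suc l ℕ.* p
        2u : ∀ k → (2 𝒪.×ℕ 𝒪.1#) 𝒪.* u k 𝒪.≈ ξ k 𝒪.+ 𝒪.1#
        2u k = begin
          (2 𝒪.×ℕ 𝒪.1#) 𝒪.* u k      ≈⟨ double (u k) ⟩
          u k 𝒪.+ u k                ≈⟨ 𝒪.+-cong (𝒪.*-identityˡ (u k)) (𝒪.*-identityˡ (u k)) ⟨
          𝒪.1# 𝒪.* u k 𝒪.+ 𝒪.1# 𝒪.* u k
            ≈⟨ solve 3 (λ o s u → o :* u :+ o :* u := (o :- s :* s) :* u :+ u :* (o :+ s :* s)) 𝒪.refl 𝒪.1# (s k) (u k) ⟩
          ξ k 𝒪.+ u k 𝒪.* (𝒪.1# 𝒪.+ s k 𝒪.* s k)  ≈⟨ 𝒪.+-congˡ (u-inverse k) ⟩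
          ξ k 𝒪.+ 𝒪.1#               ∎
        u≈ : u k 𝒪.≈ u l
        u≈ = cancelˡ (characteristic-zero 2 ℕ.z<s) (𝒪.trans (2u k) (𝒪.trans (𝒪.+-congʳ ξ≈) (𝒪.sym (2u l))))
        S = 𝒪.1# 𝒪.+ s k 𝒪.* s k
        T = 𝒪.1# 𝒪.+ s l 𝒪.* s l
        S≈T : S 𝒪.≈ T
        S≈T = begin
          S                        ≈⟨ 𝒪.*-identityʳ S ⟨
          S 𝒪.* 𝒪.1#               ≈⟨ 𝒪.*-congˡ (𝒪.trans (𝒪.*-congʳ u≈) (u-inverse l)) ⟨
          S 𝒪.* (u k 𝒪.* T)        ≈⟨ solve 3 (λ s u t → s :* (u :* t) := (u :* s) :* t) 𝒪.refl S (u k) T ⟩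
          (u k 𝒪.* S) 𝒪.* T        ≈⟨ 𝒪.*-congʳ (u-inverse k) ⟩
          𝒪.1# 𝒪.* T               ≈⟨ 𝒪.*-identityˡ T ⟩
          T                        ∎
        s²≈ : s k 𝒪.* s k 𝒪.≈ s l 𝒪.* s l
        s²≈ = begin
          s k 𝒪.* s k     ≈⟨ solve 2 (λ o s → s := :- o :+ (o :+ s)) 𝒪.refl 𝒪.1# (s k 𝒪.* s k) ⟩
          𝒪.- 𝒪.1# 𝒪.+ S  ≈⟨ 𝒪.+-congˡ S≈T ⟩
          𝒪.- 𝒪.1# 𝒪.+ T  ≈⟨ solve 2 (λ o s → s := :- o :+ (o :+ s)) 𝒪.refl 𝒪.1# (s l 𝒪.* s l) ⟨
          s l 𝒪.* s l     ∎

      η-regular : ∀ k → Regular (η k)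
      η-regular k = nonzero⇒regular (*-nonzero
        (λ 2s≈0 → contradiction (multiple-injective {suc k} {0} (2-reg _ (𝒪.trans (double (s k)) 2s≈0))) λ ())
        (λ u≈0 → p∤⇒nonzero (1+p∤ (𝒪.0# , 𝒪.zeroˡ P)) (𝒪.trans (𝒪.+-identityʳ 𝒪.1#)
          (𝒪.trans (𝒪.sym (u-inverse k)) (𝒪.trans (𝒪.*-congʳ u≈0) (𝒪.zeroˡ _))))))

      at⁺ at⁻ : ℕ → 𝒪[G″] ⟶ 𝒪
      at⁺ k = eval 𝒪[G″]-presentation 𝒪 (idʰ 𝒪) (λ { α → ξ k ; β → η k }) (λ _ → norm k)
      at⁻ k = eval 𝒪[G″]-presentation 𝒪 (idʰ 𝒪) (λ { α → ξ k ; β → 𝒪.- η k }) (λ _ → conjugate-norm k)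

    𝒪[G″]-torsionFree : TorsionFree 𝒪[G″]
    𝒪[G″]-torsionFree f pf≈0 = vanishing-on-G″ 2-reg ξ η
      (λ i≢j → nonzero-difference (i≢j ∘ ξ-injective)) η-regular at⁺ at⁻
      (λ _ _ → 𝒪.refl) (λ _ _ → 𝒪.refl) (λ _ → 𝒪.refl) (λ _ → 𝒪.refl) (λ _ → 𝒪.refl) (λ _ → 𝒪.refl)
      f (zero-at at⁺) (zero-at at⁻)
      where
      zero-at : (g : ℕ → 𝒪[G″] ⟶ 𝒪) → ∀ k → RingHomomorphism.⟦_⟧ (g k) f 𝒪.≈ 𝒪.0#
      zero-at g k = torsionFree _ (𝒪.trans (𝒪.sym (Hom.×ℕ-homo {A = 𝒪[G″]} {B = 𝒪} (g k) p f))
        (𝒪.trans (RingHomomorphism.⟦⟧-cong (g k) pf≈0) (RingHomomorphism.0#-homo (g k))))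

-- Scaled orthogonal matrices and the sign of their determinant.

prime-odd : ∀ {p} → Prime p → p ≢ 2 → ∃[ h ] p ≡ suc (h ℕ.* 2)
prime-odd {p} pp p≢2 with p % 2 in eq | m%n<n p 2
... | zero | _ with prime⇒irreducible pp (m%n≡0⇒n∣m p 2 eq)
...   | inj₁ ()
...   | inj₂ 2≡p = contradiction (≡.sym 2≡p) p≢2
prime-odd {p} pp p≢2 | suc zero | _ = p /ᴺ 2 , ≡.trans (m≡m%n+[m/n]*n p 2) (≡.cong (ℕ._+ p /ᴺ 2 ℕ.* 2) eq)
prime-odd {p} pp p≢2 | suc (suc _) | ℕ.s≤s (ℕ.s≤s ())

module Similitudes (A : CommutativeRing a ℓ) where
  open CRing A
  open Solver
  open SetoidReasoning setoid

  neg-^-suc : ∀ x h → (- x) ^ suc (h ℕ.* 2) ≈ - (x ^ suc (h ℕ.* 2))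
  neg-^-suc x zero    = solve 2 (λ x o → (:- x) :* o := :- (x :* o)) refl x 1#
  neg-^-suc x (suc h) = trans (*-congˡ (*-congˡ (neg-^-suc x h)))
    (solve 2 (λ x y → (:- x) :* ((:- x) :* (:- y)) := :- (x :* (x :* y))) refl x _)

  neg-^-odd : ∀ {p} → Prime p → p ≢ 2 → ∀ x → (- x) ^ p ≈ - (x ^ p)
  neg-^-odd pp p≢2 x with prime-odd pp p≢2
  ... | h , ≡.refl = neg-^-suc x h

  record ScaledOrthogonal (y₀₀ y₀₁ y₁₀ y₁₁ μ : Carrier) : Set ℓ where
    field
      column₀   : y₀₀ * y₀₀ + y₁₀ * y₁₀ ≈ μ
      column₁   : y₀₁ * y₀₁ + y₁₁ * y₁₁ ≈ μ
      orthogonal : y₀₀ * y₀₁ + y₁₀ * y₁₁ ≈ 0#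

  module _ {y₀₀ y₀₁ y₁₀ y₁₁ μ : Carrier} (Y : ScaledOrthogonal y₀₀ y₀₁ y₁₀ y₁₁ μ) where
    open ScaledOrthogonal Y
    private
      det = y₀₀ * y₁₁ - y₀₁ * y₁₀

    -- det Y = ± μ, and the sign is + as soon as det Y is close to μ.
    det≈μ : ∀ (P t v w : Carrier) → (∀ {x} s → x ≈ P * (s * x) → x ≈ 0#) →
            t * (1# + 1#) ≈ 1# → v * μ ≈ 1# → det - μ ≈ P * w → det ≈ μ
    det≈μ P t v w contracting t2≈1 vμ≈1 e≈Pw = x∙y⁻¹≈ε⇒x≈y _ _ (contracting (- (t * v * w)) (begin
      e                                ≈⟨ *-identityˡ e ⟨
      1# * e                           ≈⟨ *-congʳ (*-identityˡ 1#) ⟨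
      (1# * 1#) * e                    ≈⟨ *-congʳ (*-cong t2≈1 vμ≈1) ⟨
      (t * (1# + 1#)) * (v * μ) * e
        ≈⟨ solve 5 (λ o t v m e → (t :* (o :+ o)) :* (v :* m) :* e := t :* v :* o :* (m :* e :+ m :* e)) refl 1# t v μ e ⟩
      t * v * 1# * (μ * e + μ * e)     ≈⟨ *-cong (*-identityʳ _) 2μe ⟩
      t * v * - (e * e)                ≈⟨ *-congˡ (-‿cong (*-congʳ e≈Pw)) ⟩
      t * v * - (P * w * e)            ≈⟨ solve 5 (λ q t v w e → t :* v :* :- (q :* w :* e) := q :* (:- (t :* v :* w) :* e)) refl P t v w e ⟩
      P * (- (t * v * w) * e)          ∎))
      where
      e = det - μ
      -- This is det² = μ², obtained from the identity of Lagrange for the two columns and rewritten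
      -- in the error `e`. Replacing one factor of e² by `P * w` makes `e` a multiple of `P * e`.
      2μe : μ * e + μ * e ≈ - (e * e)
      2μe = begin
        μ * e + μ * e
          ≈⟨ solve 2 (λ d m → m :* (d :- m) :+ m :* (d :- m) := :- ((d :- m) :* (d :- m)) :+ (d :* d :- m :* m)) refl det μ ⟩
        - (e * e) + (det * det - μ * μ)
          ≈⟨ +-congˡ (+-congʳ (solve 4 (λ a b c d → (a :* d :- b :* c) :* (a :* d :- b :* c) :=
               (a :* a :+ c :* c) :* (b :* b :+ d :* d) :- (a :* b :+ c :* d) :* (a :* b :+ c :* d)) refl y₀₀ y₀₁ y₁₀ y₁₁)) ⟩
        - (e * e) + ((y₀₀ * y₀₀ + y₁₀ * y₁₀) * (y₀₁ * y₀₁ + y₁₁ * y₁₁) - (y₀₀ * y₀₁ + y₁₀ * y₁₁) * (y₀₀ * y₀₁ + y₁₀ * y₁₁) - μ * μ)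
          ≈⟨ +-congˡ (+-congʳ (+-cong (*-cong column₀ column₁) (-‿cong (*-cong orthogonal orthogonal)))) ⟩
        - (e * e) + (μ * μ - 0# * 0# - μ * μ)
          ≈⟨ solve 2 (λ e m → :- (e :* e) :+ (m :* m :- con (+ 0) :* con (+ 0) :- m :* m) := :- (e :* e)) refl e μ ⟩
        - (e * e)   ∎

    module _ (v : Carrier) (vμ≈1 : v * μ ≈ 1#) (det≈ : det ≈ μ) where
      private
        cancel : ∀ {x y} → x * μ ≈ y * μ → x ≈ y
        cancel {x} {y} eq = begin
          x             ≈⟨ *-identityʳ x ⟨
          x * 1#        ≈⟨ *-congˡ vμ≈1 ⟨
          x * (v * μ)   ≈⟨ solve 3 (λ x v m → x :* (v :* m) := v :* (x :* m)) refl x v μ ⟩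
          v * (x * μ)   ≈⟨ *-congˡ eq ⟩
          v * (y * μ)   ≈⟨ solve 3 (λ x v m → x :* (v :* m) := v :* (x :* m)) refl y v μ ⟨
          y * (v * μ)   ≈⟨ *-congˡ vμ≈1 ⟩
          y * 1#        ≈⟨ *-identityʳ y ⟩
          y             ∎

      -- The inverse of Y is its transpose over μ and also its adjugate over det Y. Since the
      -- denominators agree, so do the entries.
      diagonal≈ : y₁₁ ≈ y₀₀
      diagonal≈ = cancel (begin
        y₁₁ * μ                             ≈⟨ *-congˡ column₀ ⟨
        y₁₁ * (y₀₀ * y₀₀ + y₁₀ * y₁₀)
          ≈⟨ solve 4 (λ a b c d → d :* (a :* a :+ c :* c) := a :* (a :* d :- b :* c) :+ c :* (a :* b :+ c :* d)) refl y₀₀ y₀₁ y₁₀ y₁₁ ⟩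
        y₀₀ * det + y₁₀ * (y₀₀ * y₀₁ + y₁₀ * y₁₁)  ≈⟨ +-cong (*-congˡ det≈) (trans (*-congˡ orthogonal) (zeroʳ _)) ⟩
        y₀₀ * μ + 0#                        ≈⟨ +-identityʳ _ ⟩
        y₀₀ * μ                             ∎)

      antidiagonal≈ : y₁₀ ≈ - y₀₁
      antidiagonal≈ = cancel (begin
        y₁₀ * μ                             ≈⟨ *-congˡ column₁ ⟨
        y₁₀ * (y₀₁ * y₀₁ + y₁₁ * y₁₁)
          ≈⟨ solve 4 (λ a b c d → c :* (b :* b :+ d :* d) := (:- b) :* (a :* d :- b :* c) :+ d :* (a :* b :+ c :* d)) refl y₀₀ y₀₁ y₁₀ y₁₁ ⟩
        - y₀₁ * det + y₁₁ * (y₀₀ * y₀₁ + y₁₀ * y₁₁)  ≈⟨ +-cong (*-congˡ det≈) (trans (*-congˡ orthogonal) (zeroʳ _)) ⟩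
        - y₀₁ * μ + 0#                        ≈⟨ +-identityʳ _ ⟩
        - y₀₁ * μ                             ∎)

  -- Modulo `P` the matrix is (a b ; -b a), whose determinant is the norm of its first column. That
  -- norm is μ exactly, so only multiples of `P` are left.
  determinant-gap : ∀ {P a b z₀₀ z₀₁ z₁₀ z₁₁ y₀₀ y₀₁ y₁₀ y₁₁ μ} →
    y₀₀ ≈ a + P * z₀₀ → y₀₁ ≈ b + P * z₀₁ → y₁₀ ≈ - b + P * z₁₀ → y₁₁ ≈ a + P * z₁₁ →
    y₀₀ * y₀₀ + y₁₀ * y₁₀ ≈ μ → ∃[ w ] (y₀₀ * y₁₁ - y₀₁ * y₁₀) - μ ≈ P * w
  determinant-gap {P} {a} {b} {z₀₀} {z₀₁} {z₁₀} {z₁₁} {y₀₀} {y₀₁} {y₁₀} {y₁₁} {μ} e₀₀ e₀₁ e₁₀ e₁₁ column =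
    y₀₀ * (z₁₁ - z₀₀) - y₁₀ * (z₀₁ + z₁₀) , (begin
      (y₀₀ * y₁₁ - y₀₁ * y₁₀) - μ
        ≈⟨ +-cong (+-cong (*-congˡ e₁₁) (-‿cong (*-congʳ e₀₁))) (-‿cong (trans (sym column) (+-cong (*-congˡ e₀₀) (*-congˡ e₁₀)))) ⟩
      (y₀₀ * (a + P * z₁₁) - (b + P * z₀₁) * y₁₀) - (y₀₀ * (a + P * z₀₀) + y₁₀ * (- b + P * z₁₀))
        ≈⟨ solve 9 (λ q a b z₀₀ z₀₁ z₁₀ z₁₁ y₀₀ y₁₀ →
             (y₀₀ :* (a :+ q :* z₁₁) :- (b :+ q :* z₀₁) :* y₁₀) :- (y₀₀ :* (a :+ q :* z₀₀) :+ y₁₀ :* (:- b :+ q :* z₁₀))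
             := q :* (y₀₀ :* (z₁₁ :- z₀₀) :- y₁₀ :* (z₀₁ :+ z₁₀))) refl P a b z₀₀ z₀₁ z₁₀ z₁₁ y₀₀ y₁₀ ⟩
      P * (y₀₀ * (z₁₁ - z₀₀) - y₁₀ * (z₀₁ + z₁₀))  ∎)

  scalar-form : ∀ {q₀₀ q₀₁ q₁₀ q₁₁} x₀ x₁ y₀ y₁ {D} → q₀₀ ≈ D → q₀₁ ≈ 0# → q₁₀ ≈ 0# → q₁₁ ≈ D →
    (x₀ * q₀₀ + x₁ * q₁₀) * y₀ + (x₀ * q₀₁ + x₁ * q₁₁) * y₁ ≈ D * (x₀ * y₀ + x₁ * y₁)
  scalar-form x₀ x₁ y₀ y₁ {D} e₀₀ e₀₁ e₁₀ e₁₁ = trans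
    (+-cong (*-congʳ (+-cong (*-congˡ e₀₀) (*-congˡ e₁₀))) (*-congʳ (+-cong (*-congˡ e₀₁) (*-congˡ e₁₁))))
    (solve 5 (λ D a b c d → (a :* D :+ b :* con (+ 0)) :* c :+ (a :* con (+ 0) :+ b :* D) :* d := D :* (a :* c :+ b :* d))
      refl D x₀ x₁ y₀ y₁)

  solve-unit : ∀ {D D⁻¹} → D * D⁻¹ ≈ 1# → ∀ {x y} → D * x ≈ y → x ≈ D⁻¹ * y
  solve-unit {D} {D⁻¹} u {x} {y} eq = begin
    x               ≈⟨ *-identityˡ x ⟨
    1# * x          ≈⟨ *-congʳ u ⟨
    D * D⁻¹ * x     ≈⟨ solve 3 (λ d e x → d :* e :* x := e :* (d :* x)) refl D D⁻¹ x ⟩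
    D⁻¹ * (D * x)   ≈⟨ *-congˡ eq ⟩
    D⁻¹ * y         ∎

  norm₀₀ : ∀ a b → a * a + (- b) * (- b) ≈ a * a + b * b
  norm₀₀ = solve 2 (λ a b → a :* a :+ (:- b) :* (:- b) := a :* a :+ b :* b) refl

  norm-det : ∀ a b → a * a - b * (- b) ≈ a * a + b * b
  norm-det = solve 2 (λ a b → a :* a :- b :* (:- b) := a :* a :+ b :* b) refl

  columns-orthogonal : ∀ a b → a * b + (- b) * a ≈ 0#
  columns-orthogonal = solve 2 (λ a b → a :* b :+ (:- b) :* a := con (+ 0)) refl

  conjugate-product : ∀ a b → a * (- b) + b * a ≈ 0#
  conjugate-product = solve 2 (λ a b → a :* (:- b) :+ b :* a := con (+ 0)) refl

  scalar-multiplication : ∀ {a b c d u v} → a ≈ u × b ≈ 0# → c ≈ v × d ≈ 0# →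
    (a * c - b * d ≈ u * v) × (a * d + b * c ≈ 0#)
  scalar-multiplication {u = u} {v} (a≈ , b≈) (c≈ , d≈) =
    trans (+-cong (*-cong a≈ c≈) (-‿cong (*-cong b≈ d≈)))
      (solve 2 (λ u v → u :* v :- con (+ 0) :* con (+ 0) := u :* v) refl u v) ,
    trans (+-cong (*-cong a≈ d≈) (*-cong b≈ c≈))
      (solve 2 (λ u v → u :* con (+ 0) :+ con (+ 0) :* v := con (+ 0)) refl u v)

  scale-by : ∀ {a b u c d} → a ≈ u × b ≈ 0# → (a * c - b * d ≈ u * c) × (a * d + b * c ≈ u * d)
  scale-by {u = u} {c} {d} (a≈ , b≈) =
    trans (+-cong (*-congʳ a≈) (-‿cong (*-congʳ b≈)))
      (solve 3 (λ u c d → u :* c :- con (+ 0) :* d := u :* c) refl u c d) ,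
    trans (+-cong (*-congʳ a≈) (*-congʳ b≈))
      (solve 3 (λ u c d → u :* d :+ con (+ 0) :* c := u :* d) refl u c d)

  -- The squares cancel in the difference of the two norms, which is 2 (u - b).
  equal-norms : ∀ {t u b} → t * (1# + 1#) ≈ 1# →
    (1# + u) * (1# + u) + b * b ≈ (1# + b) * (1# + b) + - u * - u → u ≈ b
  equal-norms {t} {u} {b} t2≈1 eq = x∙y⁻¹≈ε⇒x≈y u b (begin
    u - b                                ≈⟨ *-identityʳ _ ⟨
    (u - b) * 1#                         ≈⟨ *-congˡ t2≈1 ⟨
    (u - b) * (t * (1# + 1#))
      ≈⟨ solve 4 (λ o t u b → (u :- b) :* (t :* (o :+ o))
           := t :* (((o :+ u) :* (o :+ u) :+ b :* b) :- ((o :+ b) :* (o :+ b) :+ (:- u) :* (:- u)))) refl 1# t u b ⟩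
    t * (((1# + u) * (1# + u) + b * b) - ((1# + b) * (1# + b) + - u * - u))   ≈⟨ *-congˡ (x≈y⇒x∙y⁻¹≈ε eq) ⟩
    t * 0#                               ≈⟨ zeroʳ t ⟩
    0#                                   ∎)

module ScalarForm {A : CommutativeRing a ℓ} {B : CommutativeRing b ℓ′} (f : A ⟶ B) where
  private
    module A = CRing A
    module B = CRing B
    module f = RingHomomorphism f

  hom-form : ∀ x₀ x₁ y₀ y₁ q₀₀ q₀₁ q₁₀ q₁₁ {x₀′ x₁′ y₀′ y₁′ D} →
    f.⟦ x₀ ⟧ B.≈ x₀′ → f.⟦ x₁ ⟧ B.≈ x₁′ → f.⟦ y₀ ⟧ B.≈ y₀′ → f.⟦ y₁ ⟧ B.≈ y₁′ →
    f.⟦ q₀₀ ⟧ B.≈ D → f.⟦ q₀₁ ⟧ B.≈ B.0# → f.⟦ q₁₀ ⟧ B.≈ B.0# → f.⟦ q₁₁ ⟧ B.≈ D →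
    f.⟦ (x₀ A.* q₀₀ A.+ x₁ A.* q₁₀) A.* y₀ A.+ (x₀ A.* q₀₁ A.+ x₁ A.* q₁₁) A.* y₁ ⟧ B.≈ D B.* (x₀′ B.* y₀′ B.+ x₁′ B.* y₁′)
  hom-form x₀ x₁ y₀ y₁ q₀₀ q₀₁ q₁₀ q₁₁ x₀≈ x₁≈ y₀≈ y₁≈ e₀₀ e₀₁ e₁₀ e₁₁ = B.trans
    (B.trans (f.+-homo _ _) (B.+-cong
      (B.trans (f.*-homo _ _) (B.*-cong (B.trans (f.+-homo _ _) (B.+-cong (f.*-homo _ _) (f.*-homo _ _))) B.refl))
      (B.trans (f.*-homo _ _) (B.*-cong (B.trans (f.+-homo _ _) (B.+-cong (f.*-homo _ _) (f.*-homo _ _))) B.refl))))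
    (B.trans (Similitudes.scalar-form B f.⟦ x₀ ⟧ f.⟦ x₁ ⟧ f.⟦ y₀ ⟧ f.⟦ y₁ ⟧ e₀₀ e₀₁ e₁₀ e₁₁)
      (B.*-congˡ (B.+-cong (B.*-cong x₀≈ y₀≈) (B.*-cong x₁≈ y₁≈))))

module _ (𝒪 : CommutativeRing c ℓ) where
  open Presented 𝒪
  module _ (𝒫 : Presentation) {B : CommutativeRing b ℓ′} (F G : algebra 𝒫 ⟶ B) where
    private
      module B = CommutativeRing B
      module F = RingHomomorphism F
      module G = RingHomomorphism G

    hom-ext : (∀ k → F.⟦ con k ⟧ B.≈ G.⟦ con k ⟧) → (∀ g → F.⟦ var g ⟧ B.≈ G.⟦ var g ⟧) → ∀ t → F.⟦ t ⟧ B.≈ G.⟦ t ⟧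
    hom-ext on-con on-var = go
      where
      go : ∀ t → F.⟦ t ⟧ B.≈ G.⟦ t ⟧
      go (var g) = on-var g
      go (con k) = on-con k
      go (s ⊕ t) = B.trans (F.+-homo s t) (B.trans (B.+-cong (go s) (go t)) (B.sym (G.+-homo s t)))
      go (s ⊗ t) = B.trans (F.*-homo s t) (B.trans (B.*-cong (go s) (go t)) (B.sym (G.*-homo s t)))
      go (⊝ s)   = B.trans (F.-‿homo s) (B.trans (B.-‿cong (go s)) (B.sym (G.-‿homo s)))

-- Frobenius lifts of p-derivations.

module Lift (p : ℕ) where
  open PAdicProperties p

  -- The Frobenius lift of a p-derivation, kept opaque: unfolding it on a
  -- completion makes conversion checking compare coherence proofs.
  module _ {A : CommutativeRing a ℓ} (D : PDerivation p A) where
    private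
      module A = CRing A
      module D = PDerivation D
    abstract
      lift : A ⟶ A
      lift = D.frobeniusLift

      lift≈φ : ∀ g → RingHomomorphism.⟦_⟧ lift g A.≈ D.φ g
      lift≈φ g = A.refl

    lift-expansion : ∀ g → RingHomomorphism.⟦_⟧ lift g A.≈ g A.^ p A.+ (p A.×ℕ A.1#) A.* D.δ g
    lift-expansion g = A.trans (lift≈φ g) (A.+-congˡ (p×≈p1#* A _))

    module _ {B : CommutativeRing b ℓ′} (h : A ⟶ B) where
      private
        module B = CRing B
        module h = Hom {A = A} {B = B} h

      hom-lift-expansion : ∀ g → h.⟦ RingHomomorphism.⟦_⟧ lift g ⟧ B.≈ h.⟦ g ⟧ B.^ p B.+ (p B.×ℕ B.1#) B.* h.⟦ D.δ g ⟧
      hom-lift-expansion g = B.trans (h.⟦⟧-cong (lift-expansion g)) (B.trans (h.+-homo _ _)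
        (B.+-cong (h.^-homo g p) (B.trans (h.*-homo _ _) (B.*-congʳ (p-homo {A = A} {B = B} h)))))

    -- Metricity evaluated at a coordinate: φ₀ raises it to the p-th power, so the lift does the
    -- same to its image, an entry of xᵗ q x.
    lift-on-form : (ℋ φ₀ : A ⟶ A) →
      (∀ f → PDerivation.φ D (RingHomomorphism.⟦_⟧ ℋ f) A.≈ RingHomomorphism.⟦_⟧ ℋ (RingHomomorphism.⟦_⟧ φ₀ f)) →
      ∀ {x z} → RingHomomorphism.⟦_⟧ ℋ x A.≈ z → RingHomomorphism.⟦_⟧ φ₀ x A.≈ x A.^ p →
      RingHomomorphism.⟦_⟧ lift z A.≈ z A.^ p
    lift-on-form ℋ φ₀ metric {x} {z} ℋx≈ φ₀x≈ = begin
      lift.⟦ z ⟧          ≈⟨ lift.⟦⟧-cong ℋx≈ ⟨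
      lift.⟦ ℋ.⟦ x ⟧ ⟧    ≈⟨ lift≈φ _ ⟩
      D.φ ℋ.⟦ x ⟧         ≈⟨ metric x ⟩
      ℋ.⟦ φ₀.⟦ x ⟧ ⟧      ≈⟨ ℋ.⟦⟧-cong φ₀x≈ ⟩
      ℋ.⟦ x A.^ p ⟧       ≈⟨ ℋ.^-homo x p ⟩
      ℋ.⟦ x ⟧ A.^ p       ≈⟨ A.^-congˡ p ℋx≈ ⟩
      z A.^ p             ∎
      where
      open SetoidReasoning A.setoid
      module lift = Hom {A = A} {B = A} lift
      module ℋ = Hom {A = A} {B = A} ℋ
      module φ₀ = RingHomomorphism φ₀

  module _ {A : CommutativeRing a ℓ} {B : CommutativeRing b ℓ′} (f : A ⟶ B)
           (D : PDerivation p A) (E : PDerivation p B) where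
    private
      module B = CRing B
      module f = Hom {A = A} {B = B} f

    lift-extends : (∀ k → PDerivation.δ E f.⟦ k ⟧ B.≈ f.⟦ PDerivation.δ D k ⟧) →
                   ∀ k → RingHomomorphism.⟦_⟧ (lift E) f.⟦ k ⟧ B.≈ f.⟦ PDerivation.φ D k ⟧
    lift-extends ext k = B.trans (lift≈φ E _) (B.sym (B.trans (f.+-homo _ _)
      (B.+-cong (f.^-homo k p) (B.trans (f.×ℕ-homo p _) (B.×-congʳ p (B.sym (ext k)))))))

-- Restriction of a metric Frobenius lift to rotations.

-- The algebra of a metric connection, over an arbitrary ring R in the role of 𝒪[Ĝ].
module MetricRestriction {c ℓ a ℓ′ : Level} (p : ℕ) (p-prime : Prime p) (p≢2 : p ≢ 2) (𝒪 : CommutativeRing c ℓ)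
  (φ𝒪 : 𝒪 ⟶ 𝒪) (d : Matrix.Unit 𝒪) (q : Fin 2 → Fin 2 → CommutativeRing.Carrier 𝒪)
  {R : CommutativeRing a ℓ′} (constant : 𝒪 ⟶ R) (X δX : Fin 2 → Fin 2 → CommutativeRing.Carrier R)
  (1/det : CommutativeRing.Carrier R) (φ : R ⟶ R) where

  open PAdicProperties p
  private
    module 𝒪 = CRing 𝒪
    module R = CRing R
    module M = Matrix R
    module d = Matrix.Unit d
    module φ𝒪 = RingHomomorphism φ𝒪
    module constant = RingHomomorphism constant
    module φ = RingHomomorphism φ

    -- The entries of xᵗ q x, written out.
    Z : Fin 2 → Fin 2 → R.Carrier
    Z j k = (X 0F j R.* constant.⟦ q 0F 0F ⟧ R.+ X 1F j R.* constant.⟦ q 1F 0F ⟧) R.* X 0F k R.+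
            (X 0F j R.* constant.⟦ q 0F 1F ⟧ R.+ X 1F j R.* constant.⟦ q 1F 1F ⟧) R.* X 1F k

  record Hypotheses : Set (c Level.⊔ ℓ Level.⊔ ℓ′) where
    field
      half         : 𝒪.Carrier
      half*2≈1     : half 𝒪.* (𝒪.1# 𝒪.+ 𝒪.1#) 𝒪.≈ 𝒪.1#
      q₀₀≈         : q 0F 0F 𝒪.≈ d.value
      q₀₁≈         : q 0F 1F 𝒪.≈ 𝒪.0#
      q₁₀≈         : q 1F 0F 𝒪.≈ 𝒪.0#
      q₁₁≈         : q 1F 1F 𝒪.≈ d.value
      detX*1/det   : M.det X R.* 1/det R.≈ R.1#
      φ-expansion  : ∀ j k → φ.⟦ X j k ⟧ R.≈ X j k R.^ p R.+ (p R.×ℕ R.1#) R.* δX j k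
      φ-constant   : ∀ k → φ.⟦ constant.⟦ k ⟧ ⟧ R.≈ constant.⟦ φ𝒪.⟦ k ⟧ ⟧
      φ-form       : ∀ j k → φ.⟦ Z j k ⟧ R.≈ Z j k R.^ p

  module Restriction {b e : Level} (hypotheses : Hypotheses) {C : CommutativeRing b e} (h : R ⟶ C)
                     (contracting : Contracting C) where
    private
      open Hypotheses hypotheses
      module C = CRing C
      module h = Hom {A = R} {B = C} h
      open Similitudes C
      Pᶜ : C.Carrier
      Pᶜ = p C.×ℕ C.1#

    φ* : R ⟶ C
    φ* = _∘ʰ_ {A = R} {B = R} {E = C} h φ

    κ : 𝒪 ⟶ C
    κ = _∘ʰ_ {A = 𝒪} {B = R} {E = C} h constant

    module φ* = Hom {A = R} {B = C} φ*
    module κ = Hom {A = 𝒪} {B = C} κ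

    y z : Fin 2 → Fin 2 → C.Carrier
    y j k = φ*.⟦ X j k ⟧
    z j k = h.⟦ δX j k ⟧

    D D⁻¹ N n μ : C.Carrier
    D = κ.⟦ φ𝒪.⟦ d.value ⟧ ⟧
    D⁻¹ = κ.⟦ φ𝒪.⟦ d.inverse ⟧ ⟧
    N = h.⟦ X 0F 0F ⟧ C.* h.⟦ X 0F 0F ⟧ C.+ h.⟦ X 0F 1F ⟧ C.* h.⟦ X 0F 1F ⟧
    n = h.⟦ 1/det ⟧
    μ = D⁻¹ C.* (κ.⟦ d.value ⟧ C.* N) C.^ p

    DD⁻¹≈1 : D C.* D⁻¹ C.≈ C.1#
    DD⁻¹≈1 = C.trans (C.sym (κ.*-homo _ _)) (C.trans
      (κ.⟦⟧-cong (𝒪.trans (𝒪.sym (φ𝒪.*-homo _ _)) (𝒪.trans (φ𝒪.⟦⟧-cong d.value*inverse≈1) φ𝒪.1#-homo))) κ.1#-homo)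

    φ*-constant : ∀ k → φ*.⟦ constant.⟦ k ⟧ ⟧ C.≈ κ.⟦ φ𝒪.⟦ k ⟧ ⟧
    φ*-constant k = h.⟦⟧-cong (φ-constant k)

    private
      φ*Z : ∀ j k → φ*.⟦ Z j k ⟧ C.≈ D C.* (y 0F j C.* y 0F k C.+ y 1F j C.* y 1F k)
      φ*Z j k = ScalarForm.hom-form {A = R} {B = C} φ* (X 0F j) (X 1F j) (X 0F k) (X 1F k) _ _ _ _
        C.refl C.refl C.refl C.refl (φ*-value q₀₀≈) (φ*-zero q₀₁≈) (φ*-zero q₁₀≈) (φ*-value q₁₁≈)
        where
        φ*-value : ∀ {x} → x 𝒪.≈ d.value → φ*.⟦ constant.⟦ x ⟧ ⟧ C.≈ D
        φ*-value x≈ = C.trans (φ*-constant _) (κ.⟦⟧-cong (φ𝒪.⟦⟧-cong x≈))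
        φ*-zero : ∀ {x} → x 𝒪.≈ 𝒪.0# → φ*.⟦ constant.⟦ x ⟧ ⟧ C.≈ C.0#
        φ*-zero x≈ = C.trans (φ*-constant _) (C.trans (κ.⟦⟧-cong (𝒪.trans (φ𝒪.⟦⟧-cong x≈) φ𝒪.0#-homo)) κ.0#-homo)

      hZ : ∀ j k → h.⟦ Z j k ⟧ C.≈ κ.⟦ d.value ⟧ C.* (h.⟦ X 0F j ⟧ C.* h.⟦ X 0F k ⟧ C.+ h.⟦ X 1F j ⟧ C.* h.⟦ X 1F k ⟧)
      hZ j k = ScalarForm.hom-form {A = R} {B = C} h (X 0F j) (X 1F j) (X 0F k) (X 1F k) _ _ _ _
        C.refl C.refl C.refl C.refl (κ.⟦⟧-cong q₀₀≈) (κ-zero q₀₁≈) (κ-zero q₁₀≈) (κ.⟦⟧-cong q₁₁≈)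
        where
        κ-zero : ∀ {x} → x 𝒪.≈ 𝒪.0# → κ.⟦ x ⟧ C.≈ C.0#
        κ-zero x≈ = C.trans (κ.⟦⟧-cong x≈) κ.0#-homo

      equation : ∀ j k {t} → h.⟦ X 0F j ⟧ C.* h.⟦ X 0F k ⟧ C.+ h.⟦ X 1F j ⟧ C.* h.⟦ X 1F k ⟧ C.≈ t →
        D C.* (y 0F j C.* y 0F k C.+ y 1F j C.* y 1F k) C.≈ (κ.⟦ d.value ⟧ C.* t) C.^ p
      equation j k t≈ = C.trans (C.sym (φ*Z j k)) (C.trans (C.trans (h.⟦⟧-cong (φ-form j k)) (h.^-homo _ p))
        (C.^-congˡ p (C.trans (hZ j k) (C.*-congˡ t≈))))

    y-expansion : ∀ j k → y j k C.≈ h.⟦ X j k ⟧ C.^ p C.+ Pᶜ C.* z j k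
    y-expansion j k = C.trans (h.⟦⟧-cong (φ-expansion j k)) (C.trans (h.+-homo _ _)
      (C.+-cong (h.^-homo _ p) (C.trans (h.*-homo _ _) (C.*-congʳ (p-homo {A = R} {B = C} h)))))

    module _ (x₁₁≈ : h.⟦ X 1F 1F ⟧ C.≈ h.⟦ X 0F 0F ⟧) (x₁₀≈ : h.⟦ X 1F 0F ⟧ C.≈ C.- h.⟦ X 0F 1F ⟧) where
      private
        x₀₀ x₀₁ : C.Carrier
        x₀₀ = h.⟦ X 0F 0F ⟧
        x₀₁ = h.⟦ X 0F 1F ⟧

        Y : ScaledOrthogonal (y 0F 0F) (y 0F 1F) (y 1F 0F) (y 1F 1F) μ
        Y = record
          { column₀ = solve-unit DD⁻¹≈1 (equation 0F 0F (C.trans (C.+-congˡ (C.*-cong x₁₀≈ x₁₀≈)) (norm₀₀ x₀₀ x₀₁)))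
          ; column₁ = solve-unit DD⁻¹≈1 (equation 1F 1F (C.trans (C.+-congˡ (C.*-cong x₁₁≈ x₁₁≈)) (C.+-comm _ _)))
          ; orthogonal = C.trans (solve-unit DD⁻¹≈1 (equation 0F 1F {C.0#}
              (C.trans (C.+-congˡ (C.*-cong x₁₀≈ x₁₁≈)) (columns-orthogonal x₀₀ x₀₁))))
              (C.trans (C.*-congˡ (C.trans (C.^-congˡ p (C.zeroʳ _)) (0^ C (0<prime p-prime)))) (C.zeroʳ _)) }

        hom-det : (f : R ⟶ C) → let open RingHomomorphism f in
          ⟦ M.det X ⟧ C.≈ ⟦ X 0F 0F ⟧ C.* ⟦ X 1F 1F ⟧ C.- ⟦ X 0F 1F ⟧ C.* ⟦ X 1F 0F ⟧
        hom-det f = C.trans (f.-homo _ _) (C.+-cong (f.*-homo _ _) (C.-‿cong (f.*-homo _ _)))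
          where module f = Hom {A = R} {B = C} f

        hom-inverse : (f : R ⟶ C) → let open RingHomomorphism f in
          ⟦ M.det X ⟧ C.* ⟦ 1/det ⟧ C.≈ C.1#
        hom-inverse f = C.trans (C.sym (f.*-homo _ _)) (C.trans (f.⟦⟧-cong detX*1/det) f.1#-homo)
          where module f = RingHomomorphism f

        Nn≈1 : N C.* n C.≈ C.1#
        Nn≈1 = C.trans (C.*-congʳ (C.sym (C.trans (hom-det h) (C.trans
          (C.+-cong (C.*-congˡ x₁₁≈) (C.-‿cong (C.*-congˡ x₁₀≈))) (norm-det x₀₀ x₀₁))))) (hom-inverse h)

        v : C.Carrier
        v = D C.* (κ.⟦ d.inverse ⟧ C.* n) C.^ p

        vμ≈1 : v C.* μ C.≈ C.1#
        vμ≈1 = C.trans (Identities.clear-product C D _ D⁻¹ _) (C.trans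
          (C.*-cong DD⁻¹≈1 (C.trans (C.sym (C.^-distrib-* _ _ p)) (C.trans (C.^-congˡ p
            (C.trans (Identities.clear-product C _ _ _ _) (C.trans (C.*-cong
              (C.trans (C.*-comm _ _) (C.trans (C.sym (κ.*-homo _ _)) (C.trans (κ.⟦⟧-cong d.value*inverse≈1) κ.1#-homo)))
              (C.trans (C.*-comm _ _) Nn≈1)) (C.*-identityˡ _)))) (1^ C p)))) (C.*-identityˡ _))

        gap : ∃[ w ] (y 0F 0F C.* y 1F 1F C.- y 0F 1F C.* y 1F 0F) C.- μ C.≈ Pᶜ C.* w
        gap = determinant-gap (y-expansion 0F 0F) (y-expansion 0F 1F)
          -- Oddness of `p` is used here: (-x)ᵖ = -xᵖ, so the matrix of p-th powers again has the
          -- shape (a b ; -b a).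
          (C.trans (y-expansion 1F 0F) (C.+-congʳ (C.trans (C.^-congˡ p x₁₀≈) (neg-^-odd p-prime p≢2 x₀₁))))
          (C.trans (y-expansion 1F 1F) (C.+-congʳ (C.^-congˡ p x₁₁≈)))
          (ScaledOrthogonal.column₀ Y)

        det-y≈μ : y 0F 0F C.* y 1F 1F C.- y 0F 1F C.* y 1F 0F C.≈ μ
        det-y≈μ = det≈μ Y Pᶜ κ.⟦ half ⟧ v (proj₁ gap) contracting
          (C.trans (C.*-congˡ (C.sym (C.trans (κ.+-homo _ _) (C.+-cong κ.1#-homo κ.1#-homo))))
            (C.trans (C.sym (κ.*-homo _ _)) (C.trans (κ.⟦⟧-cong half*2≈1) κ.1#-homo)))
          vμ≈1 (proj₂ gap)

      y₁₁≈y₀₀ : y 1F 1F C.≈ y 0F 0F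
      y₁₁≈y₀₀ = diagonal≈ Y v vμ≈1 det-y≈μ

      y₁₀≈-y₀₁ : y 1F 0F C.≈ C.- y 0F 1F
      y₁₀≈-y₀₁ = antidiagonal≈ Y v vμ≈1 det-y≈μ

      norm-y : D C.* (y 0F 0F C.* y 0F 0F C.+ y 0F 1F C.* y 0F 1F) C.≈ (κ.⟦ d.value ⟧ C.* N) C.^ p
      norm-y = C.trans (C.*-congˡ (C.sym (C.trans (C.+-congˡ (C.*-cong y₁₀≈-y₀₁ y₁₀≈-y₀₁)) (norm₀₀ _ _))))
        (equation 0F 0F (C.trans (C.+-congˡ (C.*-cong x₁₀≈ x₁₀≈)) (norm₀₀ x₀₀ x₀₁)))

      φ*-det : φ*.⟦ M.det X ⟧ C.≈ y 0F 0F C.* y 0F 0F C.+ y 0F 1F C.* y 0F 1F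
      φ*-det = C.trans (hom-det φ*) (C.trans
        (C.+-cong (C.*-congˡ y₁₁≈y₀₀) (C.-‿cong (C.*-congˡ y₁₀≈-y₀₁))) (norm-det _ _))

      norm-y-inverse : (y 0F 0F C.* y 0F 0F C.+ y 0F 1F C.* y 0F 1F) C.* φ*.⟦ 1/det ⟧ C.≈ C.1#
      norm-y-inverse = C.trans (C.*-congʳ (C.sym φ*-det)) (hom-inverse φ*)

-- Distinct lines through the origin and distinct points on each.

module Slopes (p : ℕ) (p-prime : Prime p) (p≢2 : p ≢ 2) (𝒪 : CommutativeRing c ℓ) (dvr : IsCompleteDVR p 𝒪) where
  open CRing 𝒪
  open CompleteDVR p p-prime 𝒪 dvr
  open GaussianDVR p p-prime 𝒪 dvr
  open Gaussian 𝒪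
  open Horner 𝒪 using (Regular)
  open SetoidReasoning setoid

  private
    p-1 : ℕ
    p-1 = ℕ.pred p

    p≡ : p ≡ suc p-1
    p≡ = ≡.sym (ℕ.suc-pred p {{ℕ.>-nonZero (0<prime p-prime)}})

    0<p-1 : 0 ℕ.< p-1
    0<p-1 = ℕ.≤-pred (≡.subst (2 ℕ.≤_) p≡ (1<prime p-prime))

  -- Both sides are odd in `m`, so `m` may be replaced by a natural number, whose powers can be
  -- compared by size.
  ∣m∣-equation : ∀ m {L} → fromℤ m * L ≈ fromℤ m ^ p → (ℤ.∣ m ∣ ×ℕ 1#) * L ≈ (ℤ.∣ m ∣ ×ℕ 1#) ^ p
  ∣m∣-equation (+ n)      eq = eq
  ∣m∣-equation (-[1+ n ]) {L} eq = begin
    x * L             ≈⟨ ⁻¹-involutive _ ⟨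
    - - (x * L)       ≈⟨ -‿cong (-‿distribˡ-* x L) ⟩
    - (- x * L)       ≈⟨ -‿cong eq ⟩
    - ((- x) ^ p)     ≈⟨ -‿cong (Similitudes.neg-^-odd 𝒪 p-prime p≢2 x) ⟩
    - - (x ^ p)       ≈⟨ ⁻¹-involutive _ ⟩
    x ^ p             ∎
    where x = suc n ×ℕ 1#

  1<∣m∣ : ∀ m → m ≢ 1ℤ → m ≢ -1ℤ → ¬ (+ p ℤ.∣ m) → 1 ℕ.< ℤ.∣ m ∣
  1<∣m∣ (+ 0)             _    _     p∤m = contradiction (p ℕ.∣0) p∤m
  1<∣m∣ (+ 1)             m≢1  _     _   = contradiction ≡.refl m≢1
  1<∣m∣ (+ suc (suc n))   _    _     _   = ℕ.s≤s ℕ.z<s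
  1<∣m∣ (-[1+ 0 ])        _    m≢-1  _   = contradiction ≡.refl m≢-1
  1<∣m∣ (-[1+ suc n ])    _    _     _   = ℕ.s≤s ℕ.z<s

  module _ {r : ℕ} (1<r : 1 ℕ.< r) {L : Carrier} (eq : (r ×ℕ 1#) * L ≈ (r ×ℕ 1#) ^ p) where
    private
      R : ℕ
      R = r ℕ.^ p-1

      1<R : 1 ℕ.< R
      1<R = ℕ.^-monoʳ-< r 1<r 0<p-1

      L≈R : L ≈ R ×ℕ 1#
      L≈R = cancelˡ (characteristic-zero r (ℕ.<-trans ℕ.z<s 1<r)) (begin
        (r ×ℕ 1#) * L              ≈⟨ eq ⟩
        (r ×ℕ 1#) ^ p              ≡⟨ ≡.cong ((r ×ℕ 1#) ^_) p≡ ⟩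
        (r ×ℕ 1#) * (r ×ℕ 1#) ^ p-1 ≈⟨ *-congˡ (×1-homo-^ 𝒪 r p-1) ⟨
        (r ×ℕ 1#) * (R ×ℕ 1#)      ∎)

    -- `L` is the image of the natural number R = rᵖ⁻¹ > 1. The powers of R are distinct, and they
    -- stay distinct in characteristic zero.
    powers-distinct : ∀ {i j} → L ^ i ≈ L ^ j → i ≡ j
    powers-distinct {i} {j} Lⁱ≈Lʲ = ^-injectiveʳ 1<R (×1-injective _ _ (begin
      (R ℕ.^ i) ×ℕ 1#  ≈⟨ ×1-homo-^ 𝒪 R i ⟩
      (R ×ℕ 1#) ^ i    ≈⟨ ^-congˡ i L≈R ⟨
      L ^ i            ≈⟨ Lⁱ≈Lʲ ⟩
      L ^ j            ≈⟨ ^-congˡ j L≈R ⟩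
      (R ×ℕ 1#) ^ j    ≈⟨ ×1-homo-^ 𝒪 R j ⟨
      (R ℕ.^ j) ×ℕ 1#  ∎))

    L≉1 : ¬ L ≈ 1#
    L≉1 L≈1 = contradiction (powers-distinct {1} {0} (trans (*-identityʳ L) L≈1)) λ ()

  module _ {a b : Carrier} (P∤a : ¬ P ∣ a) (P∣b : P ∣ b) (b≉0 : ¬ b ≈ 0#) where
    private
      g : Carrier × Carrier
      g = a , b

      inverse : ∀ k → re k g ∣ 1#
      inverse k = p∤⇒unit (re-p∤ k P∤a P∣b)

      re⁻¹ : ℕ → Carrier
      re⁻¹ k with inverse k
      ... | v , _ = v

    -- The real parts of the powers are units because `p` divides `b`, so the slopes lie in 𝒪. Two
    -- equal slopes would contradict `powers-independent`.
    slope : ℕ → Carrier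
    slope k = re⁻¹ k * im k g

    re*slope : ∀ k → re k g * slope k ≈ im k g
    re*slope k with inverse k
    ... | v , vr≈1 = trans (sym (*-assoc _ _ _)) (trans (*-congʳ (trans (*-comm _ _) vr≈1)) (*-identityˡ _))

    slopes-distinct : ∀ {k l} → k ≢ l → Regular (slope k - slope l)
    slopes-distinct {k} {l} k≢l = nonzero-difference λ eq → distinct eq (ℕ.<-cmp k l)
      where
      cross : ∀ k l → slope k ≈ slope l → re k g * im l g ≈ re l g * im k g
      cross k l eq = begin
        re k g * im l g               ≈⟨ *-congˡ (re*slope l) ⟨
        re k g * (re l g * slope l)   ≈⟨ *-assoc _ _ _ ⟨
        re k g * re l g * slope l     ≈⟨ *-cong (*-comm _ _) (sym eq) ⟩
        re l g * re k g * slope k     ≈⟨ *-assoc _ _ _ ⟩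
        re l g * (re k g * slope k)   ≈⟨ *-congˡ (re*slope k) ⟩
        re l g * im k g               ∎
      distinct : slope k ≈ slope l → ¬ _
      distinct eq (tri< k<l _ _) = powers-independent P∤a P∣b b≉0 k<l (cross k l eq)
      distinct eq (tri≈ _ k≡l _) = k≢l k≡l
      distinct eq (tri> _ _ l<k) = powers-independent P∤a P∣b b≉0 l<k (cross l k (sym eq))

    scaled-distinct : ∀ {L} → (∀ {i j} → L ^ i ≈ L ^ j → i ≡ j) → ∀ k {i j} → i ≢ j →
                      Regular (L ^ i * re k g - L ^ j * re k g)
    scaled-distinct powers k i≢j = nonzero-difference λ eq → i≢j (powers (cancelˡ
      (p∤⇒nonzero (re-p∤ k P∤a P∣b)) (trans (*-comm _ _) (trans eq (*-comm _ _)))))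

-- Connections on G and their Frobenius lifts.

module LeviCivita (p : ℕ) (p-prime : Prime p) (p≢2 : p ≢ 2) (𝒪 : CommutativeRing c ℓ)
                  (dvr : IsCompleteDVR p 𝒪) (δ𝒪 : PDerivation p 𝒪) where
  open PAdic p
  open PAdicProperties p
  open Lift p
  open Connections p p-prime 𝒪 δ𝒪 renaming (x to entry)
  open CompleteDVR p p-prime 𝒪 dvr
    using (P; p∤⇒unit; p∤n⇒P∤n; 1+p∤; torsionFree; nonzero⇒regular; characteristic-zero)
  open Density p p-prime 𝒪 dvr

  private
    module 𝒪 = CRing 𝒪
    module δ = PDerivation δ𝒪
    module Ĝ = CRing 𝒪[Ĝ]
    module constant = RingHomomorphism constant
    module ιG = RingHomomorphism (ι 𝒪[G])

  2-inverse : ∃[ t ] t 𝒪.* (𝒪.1# 𝒪.+ 𝒪.1#) 𝒪.≈ 𝒪.1#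
  2-inverse with p∤⇒unit (p∤n⇒P∤n (prime∤2 p-prime p≢2))
  ... | t , eq = t , 𝒪.trans (𝒪.*-congˡ (𝒪.+-congˡ (𝒪.sym (𝒪.+-identityʳ 𝒪.1#)))) eq

  lift∇ : Connection → 𝒪[Ĝ] ⟶ 𝒪[Ĝ]
  lift∇ ∇ = lift (Connection.pDerivation ∇)

  module _ {B : CommutativeRing b ℓ′} (f : 𝒪[G] ⟶ B) (∇ : Connection) where
    private
      B̂ : CommutativeRing _ _
      B̂ = completion B
      module B = CRing B
      module B̂ = CRing B̂
      f̂ : 𝒪[Ĝ] ⟶ B̂
      f̂ = completionMap {A = 𝒪[G]} {B = B} f
      module f̂ = RingHomomorphism f̂
      module f = RingHomomorphism f
      module φ = RingHomomorphism (lift∇ ∇)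

      expansion = hom-lift-expansion (Connection.pDerivation ∇) {B = B̂} f̂

      power-zero : ∀ {x} → x B̂.≈ B̂.0# → x B̂.^ p B̂.≈ B̂.0#
      power-zero x≈0 = B̂.trans (B̂.^-congˡ p x≈0) (0^ B̂ (0<prime p-prime))

    horizontal⇒φ : IsHorizontal B f ∇ → ∀ g → f̂.⟦ g ⟧ B̂.≈ B̂.0# → f̂.⟦ φ.⟦ g ⟧ ⟧ B̂.≈ B̂.0#
    horizontal⇒φ hor g fg≈0 = B̂.trans (expansion g) (B̂.trans
      (B̂.+-cong (power-zero fg≈0) (B̂.trans (B̂.*-congˡ (hor g fg≈0)) (B̂.zeroʳ _))) (B̂.+-identityˡ B̂.0#))

    -- The ideal of Ŷ is stable under φ once f̂ ∘ φ factors through 𝒪(Y); it is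
    -- then stable under δ since 𝒪(Ŷ) is p-torsion free.
    horizontality-criterion : TorsionFree B → (ψ : B ⟶ B̂) →
      (∀ t → f̂.⟦ φ.⟦ ιG.⟦ t ⟧ ⟧ ⟧ B̂.≈ RingHomomorphism.⟦_⟧ ψ f.⟦ t ⟧) → IsHorizontal B f ∇
    horizontality-criterion tf ψ factors g fg≈0 = completion-torsionFree B tf _ (B̂.trans
      (p×≈p1#* B̂ _) (B̂.trans (B̂.sym (B̂.+-identityˡ _)) (B̂.trans
      (B̂.+-congʳ (B̂.sym (power-zero fg≈0))) (B̂.trans (B̂.sym (expansion g)) φg≈0))))
      where
      ψf : 𝒪[G] ⟶ B̂
      ψf = _∘ʰ_ {A = 𝒪[G]} {B = B} {E = B̂} ψ f
      f̂φ : 𝒪[Ĝ] ⟶ B̂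
      f̂φ = _∘ʰ_ {A = 𝒪[Ĝ]} {B = 𝒪[Ĝ]} {E = B̂} f̂ (lift∇ ∇)
      module ψ̂ = RingHomomorphism (extend {A = B} {B = B} ψ)
      φg≈0 : f̂.⟦ φ.⟦ g ⟧ ⟧ B̂.≈ B̂.0#
      -- The factorisation is known on 𝒪[G] only. By continuity f̂ ∘ φ is the extension of ψ ∘ f,
      -- which passes through f̂ and so kills its kernel.
      φg≈0 = B̂.trans (is-extend {A = 𝒪[G]} {B = B} ψf f̂φ factors g)
        (B̂.trans (componentwise λ n → at-≈ (B̂.refl {ψ̂.⟦ f̂.⟦ g ⟧ ⟧}) n)
        (B̂.trans (ψ̂.⟦⟧-cong fg≈0) ψ̂.0#-homo))

  X-det : Matrix.det 𝒪[Ĝ] X Ĝ.* ιG.⟦ var 1/det ⟧ Ĝ.≈ Ĝ.1#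
  X-det = componentwise λ m → at-≈ (ιG.⟦⟧-cong (relation _)) m

  private
    form : SymGL₂ → Fin 2 → Fin 2 → Ĝ.Carrier
    form q j k = (X 0F j Ĝ.* Q 0F 0F Ĝ.+ X 1F j Ĝ.* Q 1F 0F) Ĝ.* X 0F k Ĝ.+
                 (X 0F j Ĝ.* Q 0F 1F Ĝ.+ X 1F j Ĝ.* Q 1F 1F) Ĝ.* X 1F k
      where
      Q : Fin 2 → Fin 2 → Ĝ.Carrier
      Q j k = constant.⟦ SymGL₂.matrix q j k ⟧

    record Metric (∇ : Connection) (q : SymGL₂) : Set (c Level.⊔ ℓ) where
      constructor metricData
      field
        H F : 𝒪[Ĝ] ⟶ 𝒪[Ĝ]
        H-form : ∀ j k → RingHomomorphism.⟦_⟧ H (X j k) Ĝ.≈ form q j k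
        F-power : ∀ j k → RingHomomorphism.⟦_⟧ F (X j k) Ĝ.≈ X j k Ĝ.^ p
        commute : ∀ f → PDerivation.φ (Connection.pDerivation ∇) (RingHomomorphism.⟦_⟧ H f) Ĝ.≈
                        RingHomomorphism.⟦_⟧ H (RingHomomorphism.⟦_⟧ F f)

    ℋX : ∀ q j k → RingHomomorphism.⟦_⟧ (ℋ q) (X j k) Ĝ.≈ form q j k
    ℋX q j k = componentwise λ m → at-≈ (Ĝ.refl {form q j k}) m

    φ₀X : ∀ j k → RingHomomorphism.⟦_⟧ φ₀ (X j k) Ĝ.≈ X j k Ĝ.^ p
    φ₀X j k = Ĝ.trans
      (componentwise λ m → at-≈ (Ĝ.refl {ιG.⟦ var (entry j k) G.^ p ⟧}) m)
      (Hom.^-homo {A = 𝒪[G]} {B = 𝒪[Ĝ]} (ι 𝒪[G]) (var (entry j k)) p)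
      where module G = CRing 𝒪[G]

    abstract
      metric° : ∀ ∇ q → IsMetric ∇ q → Metric ∇ q
      metric° ∇ q metric = metricData (ℋ q) φ₀ (λ j k → ℋX q j k) (λ j k → φ₀X j k) (λ f → metric f)

  module _ (∇ : Connection) where
    private
      module ∇ = Connection ∇
      module φ = RingHomomorphism (lift∇ ∇)

    lift-X : ∀ j k → φ.⟦ X j k ⟧ Ĝ.≈ X j k Ĝ.^ p Ĝ.+ (p Ĝ.×ℕ Ĝ.1#) Ĝ.* ∇.δ (X j k)
    lift-X j k = lift-expansion ∇.pDerivation (X j k)

    lift-constant : ∀ k → φ.⟦ constant.⟦ k ⟧ ⟧ Ĝ.≈ constant.⟦ δ.φ k ⟧
    lift-constant = lift-extends {A = 𝒪} {B = 𝒪[Ĝ]} constant δ𝒪 ∇.pDerivation ∇.extends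

    module _ (q : SymGL₂) (metric : IsMetric ∇ q) where
      lift-form : ∀ j k → φ.⟦ form q j k ⟧ Ĝ.≈ form q j k Ĝ.^ p
      lift-form j k = lift-on-form ∇.pDerivation H F commute {X j k} {form q j k} (H-form j k) (F-power j k)
        where open Metric (metric° ∇ q metric)

  -- Horizontality of G′ and G″.

  record IsScalar (q : SymGL₂) (d : Unit) : Set ℓ where
    private
      module q = SymGL₂ q
      module d = Unit d
    field
      q₀₀≈ : q.matrix 0F 0F 𝒪.≈ d.value
      q₀₁≈ : q.matrix 0F 1F 𝒪.≈ 𝒪.0#
      q₁₀≈ : q.matrix 1F 0F 𝒪.≈ 𝒪.0#
      q₁₁≈ : q.matrix 1F 1F 𝒪.≈ d.value

  δX : Connection → Fin 2 → Fin 2 → Ĝ.Carrier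
  δX ∇ j k = Connection.δ ∇ (X j k)

  restriction-hypotheses : ∀ ∇ q → IsMetric ∇ q → ∀ d → IsScalar q d →
    MetricRestriction.Hypotheses p p-prime p≢2 𝒪 δ.frobeniusLift d (SymGL₂.matrix q) {R = 𝒪[Ĝ]} constant X (δX ∇)
      ιG.⟦ var 1/det ⟧ (lift∇ ∇)
  restriction-hypotheses ∇ q metric d scalar = record
    { half = proj₁ 2-inverse
    ; half*2≈1 = proj₂ 2-inverse
    ; q₀₀≈ = q₀₀≈ ; q₀₁≈ = q₀₁≈ ; q₁₀≈ = q₁₀≈ ; q₁₁≈ = q₁₁≈
    ; detX*1/det = X-det
    ; φ-expansion = lift-X ∇
    ; φ-constant = lift-constant ∇
    ; φ-form = lift-form ∇ q metric }
    where open IsScalar scalar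

  -- The universal properties of G′ and G″ among closed subschemes f of G, for
  -- semilinear points F; as records, they are not unfolded when C is concrete.
  module _ {a ℓᵃ b ℓ′ : Level} {B : CommutativeRing a ℓᵃ} (f : 𝒪[G] ⟶ B) (C : CommutativeRing b ℓ′) where
    private
      module C = CRing C

    Factors : 𝒪[G] ⟶ C → Set _
    Factors F = Σ (B ⟶ C) λ ψ → ∀ t → RingHomomorphism.⟦_⟧ F t C.≈ RingHomomorphism.⟦_⟧ ψ (RingHomomorphism.⟦_⟧ f t)

    record G′-Universal : Set (c Level.⊔ ℓ Level.⊔ a Level.⊔ ℓᵃ Level.⊔ b Level.⊔ ℓ′) where
      field
        factor : ∀ F → let module F = RingHomomorphism F ; y = λ j k → F.⟦ var (entry j k) ⟧ in
          y 1F 1F C.≈ y 0F 0F → y 1F 0F C.≈ C.- y 0F 1F →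
          (y 0F 0F C.* y 0F 0F C.+ y 0F 1F C.* y 0F 1F) C.* F.⟦ var 1/det ⟧ C.≈ C.1# → Factors F

    record G″-Universal : Set (c Level.⊔ ℓ Level.⊔ a Level.⊔ ℓᵃ Level.⊔ b Level.⊔ ℓ′) where
      field
        factor : ∀ F → let module F = RingHomomorphism F ; y = λ j k → F.⟦ var (entry j k) ⟧ in
          y 1F 1F C.≈ y 0F 0F → y 1F 0F C.≈ C.- y 0F 1F →
          y 0F 0F C.* y 0F 0F C.+ y 0F 1F C.* y 0F 1F C.≈ C.1# → F.⟦ var 1/det ⟧ C.≈ C.1# → Factors F

  module _ (C : CommutativeRing b ℓ′) where
    private
      module C = CRing C

    G′-universal : G′-Universal {B = 𝒪[G′]} G′⊂G C
    G′-universal = record { factor = λ F y₁₁≈y₀₀ y₁₀≈-y₀₁ norm →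
      let module F = RingHomomorphism F
          σ = _∘ʰ_ {A = 𝒪} {B = 𝒪[G]} {E = C} F (structureMap 𝒪[G]-presentation)
          ψ = evalG′ C σ record
            { a₁ = F.⟦ var (entry 0F 0F) ⟧ ; a₂ = F.⟦ var (entry 0F 1F) ⟧ ; n⁻¹ = F.⟦ var 1/det ⟧ ; norm*n⁻¹≈1 = norm }
      in ψ , hom-ext 𝒪 𝒪[G]-presentation {B = C} F (_∘ʰ_ {A = 𝒪[G]} {B = 𝒪[G′]} {E = C} ψ G′⊂G) (λ _ → C.refl)
        λ { (entry 0F 0F) → C.refl ; (entry 0F 1F) → C.refl ; (entry 1F 0F) → y₁₀≈-y₀₁ ; (entry 1F 1F) → y₁₁≈y₀₀ ; 1/det → C.refl } }

    G″-universal : G″-Universal {B = 𝒪[G″]} G″⊂G C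
    G″-universal = record { factor = λ F y₁₁≈y₀₀ y₁₀≈-y₀₁ norm 1/det≈1 →
      let module F = RingHomomorphism F
          σ = _∘ʰ_ {A = 𝒪} {B = 𝒪[G]} {E = C} F (structureMap 𝒪[G]-presentation)
          ψ = eval 𝒪[G″]-presentation C σ (λ { α → F.⟦ var (entry 0F 0F) ⟧ ; β → F.⟦ var (entry 0F 1F) ⟧ })
            (λ _ → C.trans norm (C.sym (RingHomomorphism.1#-homo σ)))
      in ψ , hom-ext 𝒪 𝒪[G]-presentation {B = C} F (_∘ʰ_ {A = 𝒪[G]} {B = 𝒪[G″]} {E = C} ψ G″⊂G) (λ _ → C.refl)
        λ { (entry 0F 0F) → C.refl ; (entry 0F 1F) → C.refl ; (entry 1F 0F) → y₁₀≈-y₀₁ ; (entry 1F 1F) → y₁₁≈y₀₀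
          ; 1/det → C.trans 1/det≈1 (C.sym (RingHomomorphism.1#-homo σ)) } }

  record IsRotation {b e : Level} {C : CommutativeRing b e} (h : 𝒪[Ĝ] ⟶ C) : Set e where
    open CommutativeRing C using (_≈_; -_)
    open RingHomomorphism h using (⟦_⟧)
    field
      x₁₁≈ : ⟦ X 1F 1F ⟧ ≈ ⟦ X 0F 0F ⟧
      x₁₀≈ : ⟦ X 1F 0F ⟧ ≈ - ⟦ X 0F 1F ⟧

  module Restricted (∇ : Connection) (q : SymGL₂) (metric : IsMetric ∇ q) (d : Unit) (scalar : IsScalar q d)
    {b e : Level} {C : CommutativeRing b e} (h : 𝒪[Ĝ] ⟶ C) (contracting : Contracting C)
    (rotation : IsRotation {C = C} h) where

    private
      module C = CRing C
      module d = Unit d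
      open IsRotation rotation

    open MetricRestriction.Restriction p p-prime p≢2 𝒪 δ.frobeniusLift d (SymGL₂.matrix q) {R = 𝒪[Ĝ]} constant X (δX ∇)
      ιG.⟦ var 1/det ⟧ (lift∇ ∇) (restriction-hypotheses ∇ q metric d scalar) {C = C} h contracting public

    F : 𝒪[G] ⟶ C
    F = _∘ʰ_ {A = 𝒪[G]} {B = 𝒪[Ĝ]} {E = C} φ* (ι 𝒪[G])

    F₁₁≈F₀₀ : y 1F 1F C.≈ y 0F 0F
    F₁₁≈F₀₀ = y₁₁≈y₀₀ x₁₁≈ x₁₀≈

    F₁₀≈-F₀₁ : y 1F 0F C.≈ C.- y 0F 1F
    F₁₀≈-F₀₁ = y₁₀≈-y₀₁ x₁₁≈ x₁₀≈

    F-norm : (y 0F 0F C.* y 0F 0F C.+ y 0F 1F C.* y 0F 1F) C.* φ*.⟦ ιG.⟦ var 1/det ⟧ ⟧ C.≈ C.1#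
    F-norm = norm-y-inverse x₁₁≈ x₁₀≈

    -- δ d = 0 means φ d = dᵖ, so that the norm form of Y is that of X to the power p.
    module _ (δd≈0 : δ.δ d.value 𝒪.≈ 𝒪.0#) (N≈1 : N C.≈ C.1#) where
      F-norm≈1 : y 0F 0F C.* y 0F 0F C.+ y 0F 1F C.* y 0F 1F C.≈ C.1#
      F-norm≈1 = C.trans (Similitudes.solve-unit C DD⁻¹≈1 (norm-y x₁₁≈ x₁₀≈)) (C.trans (C.*-congˡ (C.trans
        (C.^-congˡ p (C.trans (C.*-congˡ N≈1) (C.*-identityʳ _)))
        (C.trans (C.sym (κ.^-homo _ p)) (κ.⟦⟧-cong (𝒪.sym φd≈dᵖ)))))
        (C.trans (C.*-comm _ _) DD⁻¹≈1))
        where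
        φd≈dᵖ : δ.φ d.value 𝒪.≈ d.value 𝒪.^ p
        φd≈dᵖ = 𝒪.trans (𝒪.+-congˡ (𝒪.trans (p×≈p1#* 𝒪 _) (𝒪.trans (𝒪.*-congˡ δd≈0) (𝒪.zeroʳ _)))) (𝒪.+-identityʳ _)

      F-1/det≈1 : φ*.⟦ ιG.⟦ var 1/det ⟧ ⟧ C.≈ C.1#
      F-1/det≈1 = C.trans (C.sym (C.trans (C.*-congʳ F-norm≈1) (C.*-identityˡ _))) (norm-y-inverse x₁₁≈ x₁₀≈)

  module _ (∇ : Connection) (q : SymGL₂) (metric : IsMetric ∇ q) (d : Unit) (scalar : IsScalar q d) where
    private
      module d = Unit d

    module Criterion {B : CommutativeRing b ℓ′} (f : 𝒪[G] ⟶ B) where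
      private
        module B = CRing B
        module B̂ = CRing (completion B)
        module f = RingHomomorphism f
        module ιB = RingHomomorphism (ι B)
        f̂ : 𝒪[Ĝ] ⟶ completion B
        f̂ = completionMap {A = 𝒪[G]} {B = B} f

      module _ (tf : TorsionFree B)
               (f₁₁≈ : f.⟦ var (entry 1F 1F) ⟧ B.≈ f.⟦ var (entry 0F 0F) ⟧)
               (f₁₀≈ : f.⟦ var (entry 1F 0F) ⟧ B.≈ B.- f.⟦ var (entry 0F 1F) ⟧) where
        private
          rotation : IsRotation {C = completion B} f̂
          rotation = record
            { x₁₁≈ = componentwise λ n → at-≈ (ιB.⟦⟧-cong f₁₁≈) n
            ; x₁₀≈ = componentwise λ n → at-≈ (ιB.⟦⟧-cong f₁₀≈) n }

          module R = Restricted ∇ q metric d scalar {C = completion B} f̂ (p-contracting B) rotation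

          conclude : Factors {B = B} f (completion B) R.F → IsHorizontal B f ∇
          conclude (ψ , factors) = horizontality-criterion {B = B} f ∇ tf ψ (λ t → factors t)

        universal⇒horizontal : G′-Universal {B = B} f (completion B) → IsHorizontal B f ∇
        universal⇒horizontal universal = conclude (G′-Universal.factor universal R.F R.F₁₁≈F₀₀ R.F₁₀≈-F₀₁ R.F-norm)

        universal₁⇒horizontal : δ.δ d.value 𝒪.≈ 𝒪.0# →
          f.⟦ var (entry 0F 0F) ⟧ B.* f.⟦ var (entry 0F 0F) ⟧ B.+ f.⟦ var (entry 0F 1F) ⟧ B.* f.⟦ var (entry 0F 1F) ⟧ B.≈ B.1# →
          G″-Universal {B = B} f (completion B) → IsHorizontal B f ∇
        universal₁⇒horizontal δd≈0 norm universal = conclude (G″-Universal.factor universal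
            R.F R.F₁₁≈F₀₀ R.F₁₀≈-F₀₁ (R.F-norm≈1 δd≈0 N≈1) (R.F-1/det≈1 δd≈0 N≈1))
          where
          N≈1 : R.N B̂.≈ B̂.1#
          N≈1 = componentwise λ n → at-≈ (ιB.⟦⟧-cong norm) n

    -- The statements on elements of completions are η-expanded, here and below, so that
    -- the type checker compares their components only, and not the coherence proofs.
    G′-horizontal : IsHorizontal 𝒪[G′] G′⊂G ∇
    G′-horizontal g fg≈0 = componentwise λ n → at-≈
      (Criterion.universal⇒horizontal {B = 𝒪[G′]} G′⊂G 𝒪[G′]-torsionFree ∼-refl ∼-refl (G′-universal (completion 𝒪[G′]))
        g (componentwise λ n → at-≈ fg≈0 n)) n

    G″-horizontal : δ.δ d.value 𝒪.≈ 𝒪.0# → IsHorizontal 𝒪[G″] G″⊂G ∇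
    G″-horizontal δd≈0 g fg≈0 = componentwise λ n → at-≈
      (Criterion.universal₁⇒horizontal {B = 𝒪[G″]} G″⊂G
        (𝒪[G″]-torsionFree (nonzero⇒regular (characteristic-zero 2 ℕ.z<s))) ∼-refl ∼-refl δd≈0 (relation _)
        (G″-universal (completion 𝒪[G″]))
        g (componentwise λ n → at-≈ fg≈0 n)) n

  -- The Frobenius lifts at the identity of G.

  detG : Term GenG
  detG = var (entry 0F 0F) ⊗ var (entry 1F 1F) ⊕ ⊝ (var (entry 0F 1F) ⊗ var (entry 1F 0F))

  -- Evaluation at the identity, with values in a copy of 𝒪 such as its completion. The last three
  -- fields say that constants map bijectively onto `C`, so values found in `C` can be carried back
  -- to 𝒪.
  record IsIdentityPoint {ℓ₁ ℓ₂ : Level} {C : CommutativeRing ℓ₁ ℓ₂} (h : 𝒪[Ĝ] ⟶ C) : Set (c Level.⊔ ℓ Level.⊔ ℓ₁ Level.⊔ ℓ₂) where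
    open CommutativeRing C using (Carrier; _≈_; 0#; 1#)
    open RingHomomorphism h using (⟦_⟧)
    field
      rotation     : IsRotation {C = C} h
      contracting  : Contracting C
      x₀₀≈1        : ⟦ X 0F 0F ⟧ ≈ 1#
      x₀₁≈0        : ⟦ X 0F 1F ⟧ ≈ 0#
      κ-injective  : ∀ {x y} → ⟦ constant.⟦ x ⟧ ⟧ ≈ ⟦ constant.⟦ y ⟧ ⟧ → x 𝒪.≈ y
      preimage     : Carrier → 𝒪.Carrier
      κ-preimage   : ∀ y → ⟦ constant.⟦ preimage y ⟧ ⟧ ≈ y

  module AtIdentity {ℓ₁ ℓ₂ : Level} {C : CommutativeRing ℓ₁ ℓ₂} (h : 𝒪[Ĝ] ⟶ C) (identity : IsIdentityPoint {C = C} h)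
    (∇ : Fin 2 → Connection) (q : Fin 2 → SymGL₂) (metric : ∀ i → IsMetric (∇ i) (q i))
    (d : Fin 2 → Unit) (scalar : ∀ i → IsScalar (q i) (d i)) where

    private
      open IsIdentityPoint identity
      open IsRotation rotation
      module C = CRing C
      module h = RingHomomorphism h
      module d i = Unit (d i)
      q′ : Fin 2 → Fin 2 → Fin 2 → 𝒪.Carrier
      q′ i = SymGL₂.matrix (q i)

      κ : 𝒪 ⟶ C
      κ = _∘ʰ_ {A = 𝒪} {B = 𝒪[Ĝ]} {E = C} h constant
      module κ = Hom {A = 𝒪} {B = C} κ
      module R i = Restricted (∇ i) (q i) (metric i) (d i) (scalar i) {C = C} h contracting rotation
      module S = Similitudes C

      N≈1 : h.⟦ X 0F 0F ⟧ C.* h.⟦ X 0F 0F ⟧ C.+ h.⟦ X 0F 1F ⟧ C.* h.⟦ X 0F 1F ⟧ C.≈ C.1#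
      N≈1 = C.trans (C.+-cong (C.trans (C.*-cong x₀₀≈1 x₀₀≈1) (C.*-identityˡ _)) (C.trans (C.*-congʳ x₀₁≈0) (C.zeroˡ _)))
        (C.+-identityʳ _)

      D : Fin 2 → C.Carrier
      D i = κ.⟦ δ.φ (d.value i) ⟧

      y : Fin 2 → Fin 2 → Fin 2 → C.Carrier
      y i j k = h.⟦ RingHomomorphism.⟦_⟧ (lift∇ (∇ i)) (X j k) ⟧

      norm : ∀ i → D i C.* (y i 0F 0F C.* y i 0F 0F C.+ y i 0F 1F C.* y i 0F 1F) C.≈ κ.⟦ d.value i 𝒪.^ p ⟧
      norm i = C.trans (R.norm-y i x₁₁≈ x₁₀≈) (C.trans
        (C.^-congˡ p (C.trans (C.*-congˡ N≈1) (C.*-identityʳ _))) (C.sym (κ.^-homo _ p)))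

    -- At the identity the norm equation reads φ(d) det Y = dᵖ. With det Y = 1 this gives p δd = 0.
    det≈1⇒δd≈0 : ∀ i → h.⟦ RingHomomorphism.⟦_⟧ (lift∇ (∇ i)) (Matrix.det 𝒪[Ĝ] X) ⟧ C.≈ C.1# → δ.δ (d.value i) 𝒪.≈ 𝒪.0#
    det≈1⇒δd≈0 i det≈1 = torsionFree _ (𝒪.trans (𝒪.sym (cancel _ _)) (𝒪.trans (𝒪.+-congˡ (κ-injective φd≈dᵖ)) (𝒪.-‿inverseˡ _)))
      where
      cancel : ∀ x y → 𝒪.- x 𝒪.+ (x 𝒪.+ y) 𝒪.≈ y
      cancel x y = 𝒪.trans (𝒪.sym (𝒪.+-assoc _ _ _)) (𝒪.trans (𝒪.+-congʳ (𝒪.-‿inverseˡ x)) (𝒪.+-identityˡ y))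
      φd≈dᵖ : D i C.≈ κ.⟦ d.value i 𝒪.^ p ⟧
      φd≈dᵖ = C.trans (C.sym (C.*-identityʳ _)) (C.trans (C.*-congˡ (C.sym (C.trans (C.sym (R.φ*-det i x₁₁≈ x₁₀≈)) det≈1))) (norm i))

    det-1⇒δd≈0 : ∀ i → h.⟦ RingHomomorphism.⟦_⟧ (lift∇ (∇ i)) ιG.⟦ detG ⊕ ⊝ con 𝒪.1# ⟧ ⟧ C.≈ C.0# → δ.δ (d.value i) 𝒪.≈ 𝒪.0#
    det-1⇒δd≈0 i eq = det≈1⇒δd≈0 i (C.trans (h.⟦⟧-cong (φ.⟦⟧-cong (componentwise λ n → at-≈ (Ĝ.refl {ιG.⟦ detG ⟧}) n)))
      (C.x∙y⁻¹≈ε⇒x≈y _ _ (C.trans (C.+-congˡ (C.sym (C.trans (F.-‿homo (con 𝒪.1#)) (C.-‿cong F.1#-homo))))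
        (C.trans (C.sym (F.+-homo _ _)) eq))))
      where
      module φ = RingHomomorphism (lift∇ (∇ i))
      module F = RingHomomorphism (R.F i)

    module _ (symmetric : ∀ k → christoffel (∇ 0F) (q 0F) 1F k Ĝ.≈ christoffel (∇ 1F) (q 1F) 0F k)
             (d₀≈d₁ : d.value 0F 𝒪.≈ d.value 1F) where
      private
        z : Fin 2 → Fin 2 → Fin 2 → C.Carrier
        z i j k = h.⟦ δX (∇ i) j k ⟧

        xᵖ : Fin 2 → Fin 2 → C.Carrier
        xᵖ j k = h.⟦ X j k Ĝ.^ p ⟧

        christoffel-image : ∀ i j k → h.⟦ christoffel (∇ i) (q i) j k ⟧ C.≈ D i C.* (z i 0F j C.* xᵖ 0F k C.+ z i 1F j C.* xᵖ 1F k)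
        christoffel-image i j k = ScalarForm.hom-form {A = 𝒪[Ĝ]} {B = C} h (δX (∇ i) 0F j) (δX (∇ i) 1F j) (X 0F k Ĝ.^ p) (X 1F k Ĝ.^ p)
          (φq 0F 0F) (φq 0F 1F) (φq 1F 0F) (φq 1F 1F) C.refl C.refl C.refl C.refl
          (φ-value q₀₀≈) (φ-zero q₀₁≈) (φ-zero q₁₀≈) (φ-value q₁₁≈)
          where
          open IsScalar (scalar i)
          module φ = RingHomomorphism δ.frobeniusLift
          φq : Fin 2 → Fin 2 → Ĝ.Carrier
          φq j k = constant.⟦ δ.φ (q′ i j k) ⟧
          φ-value : ∀ {x} → x 𝒪.≈ d.value i → κ.⟦ δ.φ x ⟧ C.≈ D i
          φ-value x≈ = κ.⟦⟧-cong (φ.⟦⟧-cong x≈)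
          φ-zero : ∀ {x} → x 𝒪.≈ 𝒪.0# → κ.⟦ δ.φ x ⟧ C.≈ C.0#
          φ-zero x≈ = C.trans (κ.⟦⟧-cong (𝒪.trans (φ.⟦⟧-cong x≈) φ.0#-homo)) κ.0#-homo

        hX^ : ∀ j k → xᵖ j k C.≈ h.⟦ X j k ⟧ C.^ p
        hX^ j k = Hom.^-homo {A = 𝒪[Ĝ]} {B = C} h (X j k) p

        0ᵖ : ∀ {x} → x C.≈ C.0# → x C.^ p C.≈ C.0#
        0ᵖ x≈0 = C.trans (C.^-congˡ p x≈0) (0^ C (0<prime p-prime))

        1ᵖ : ∀ {x} → x C.≈ C.1# → x C.^ p C.≈ C.1#
        1ᵖ x≈1 = C.trans (C.^-congˡ p x≈1) (1^ C p)

        x₁₀≈0 : h.⟦ X 1F 0F ⟧ C.≈ C.0#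
        x₁₀≈0 = C.trans x₁₀≈ (C.trans (C.-‿cong x₀₁≈0) C.ε⁻¹≈ε)

        x₁₁≈1 : h.⟦ X 1F 1F ⟧ C.≈ C.1#
        x₁₁≈1 = C.trans x₁₁≈ x₀₀≈1

        -- At the identity x⁽ᵖ⁾ is the identity matrix, so the symbol Γᵢⱼₖ is φ(dᵢ) times the (k ,
        -- j) entry of δᵢ x.
        christoffel₀ : ∀ i j → h.⟦ christoffel (∇ i) (q i) j 0F ⟧ C.≈ D i C.* z i 0F j
        christoffel₀ i j = C.trans (christoffel-image i j 0F) (C.*-congˡ (C.trans
          (C.+-cong (C.trans (C.*-congˡ (C.trans (hX^ 0F 0F) (1ᵖ x₀₀≈1))) (C.*-identityʳ _))
                    (C.trans (C.*-congˡ (C.trans (hX^ 1F 0F) (0ᵖ x₁₀≈0))) (C.zeroʳ _))) (C.+-identityʳ _)))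

        christoffel₁ : ∀ i j → h.⟦ christoffel (∇ i) (q i) j 1F ⟧ C.≈ D i C.* z i 1F j
        christoffel₁ i j = C.trans (christoffel-image i j 1F) (C.*-congˡ (C.trans
          (C.+-cong (C.trans (C.*-congˡ (C.trans (hX^ 0F 1F) (0ᵖ x₀₁≈0))) (C.zeroʳ _))
                    (C.trans (C.*-congˡ (C.trans (hX^ 1F 1F) (1ᵖ x₁₁≈1))) (C.*-identityʳ _))) (C.+-identityˡ _)))

        D₀≈D₁ : D 0F C.≈ D 1F
        D₀≈D₁ = κ.⟦⟧-cong (RingHomomorphism.⟦⟧-cong δ.frobeniusLift d₀≈d₁)

        cancel-D : ∀ {x y} → D 0F C.* x C.≈ D 1F C.* y → x C.≈ y
        cancel-D {x} {y} eq = C.trans (S.solve-unit (R.DD⁻¹≈1 0F) (C.trans eq (C.*-congʳ (C.sym D₀≈D₁))))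
          (C.sym (S.solve-unit (R.DD⁻¹≈1 0F) C.refl))

        z₀₀₁≈z₁₀₀ : z 0F 0F 1F C.≈ z 1F 0F 0F
        z₀₀₁≈z₁₀₀ = cancel-D (C.trans (C.sym (christoffel₀ 0F 1F)) (C.trans (h.⟦⟧-cong (symmetric 0F)) (christoffel₀ 1F 0F)))

        z₀₁₁≈z₁₁₀ : z 0F 1F 1F C.≈ z 1F 1F 0F
        z₀₁₁≈z₁₁₀ = cancel-D (C.trans (C.sym (christoffel₁ 0F 1F)) (C.trans (h.⟦⟧-cong (symmetric 1F)) (christoffel₁ 1F 0F)))

        -- By the symmetry and the rotation shape, two unknowns describe both matrices: their first
        -- rows are (1 + v , w) and (1 + w , -v).
        Pᶜ w v : C.Carrier
        Pᶜ = p C.×ℕ C.1#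
        w = Pᶜ C.* z 0F 0F 1F
        v = Pᶜ C.* z 0F 1F 1F

        y₀₀₁ : y 0F 0F 1F C.≈ w
        y₀₀₁ = C.trans (R.y-expansion 0F 0F 1F) (C.trans (C.+-congʳ (0ᵖ x₀₁≈0)) (C.+-identityˡ _))

        y₀₀₀ : y 0F 0F 0F C.≈ C.1# C.+ v
        y₀₀₀ = C.trans (C.sym (R.F₁₁≈F₀₀ 0F)) (C.trans (R.y-expansion 0F 1F 1F) (C.+-congʳ (1ᵖ x₁₁≈1)))

        y₁₀₀ : y 1F 0F 0F C.≈ C.1# C.+ w
        y₁₀₀ = C.trans (R.y-expansion 1F 0F 0F) (C.+-cong (1ᵖ x₀₀≈1) (C.*-congˡ (C.sym z₀₀₁≈z₁₀₀)))

        y₁₀₁ : y 1F 0F 1F C.≈ C.- v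
        y₁₀₁ = C.trans (C.sym (C.⁻¹-involutive _)) (C.-‿cong (C.trans (C.sym (R.F₁₀≈-F₀₁ 1F))
          (C.trans (R.y-expansion 1F 1F 0F) (C.trans (C.+-cong (0ᵖ x₁₀≈0) (C.*-congˡ (C.sym z₀₁₁≈z₁₁₀))) (C.+-identityˡ _)))))

        -- As d₁ = d₂, the two rotations have the same norm, and comparing the norms identifies the
        -- two unknowns.
        v≈w : v C.≈ w
        v≈w = S.equal-norms (C.trans (C.*-congˡ (C.sym (C.trans (κ.+-homo _ _) (C.+-cong κ.1#-homo κ.1#-homo))))
            (C.trans (C.sym (κ.*-homo _ _)) (C.trans (κ.⟦⟧-cong (proj₂ 2-inverse)) κ.1#-homo)))
          (cancel-D (C.trans (C.*-congˡ (C.sym (C.+-cong (C.*-cong y₀₀₀ y₀₀₀) (C.*-cong y₀₀₁ y₀₀₁))))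
            (C.trans (norm 0F) (C.trans (κ.⟦⟧-cong (𝒪.^-congˡ p d₀≈d₁)) (C.trans (C.sym (norm 1F))
              (C.*-congˡ (C.+-cong (C.*-cong y₁₀₀ y₁₀₀) (C.*-cong y₁₀₁ y₁₀₁))))))))

        κ-P : κ.⟦ P ⟧ C.≈ Pᶜ
        κ-P = p-homo {A = 𝒪} {B = C} κ

      -- The number b of the overview, brought back to 𝒪. The preimage is taken before multiplying
      -- by `P`, which makes its divisibility by `p` immediate.
      β₀ : 𝒪.Carrier
      β₀ = preimage (z 0F 0F 1F) 𝒪.* P

      κβ₀≈w : κ.⟦ β₀ ⟧ C.≈ w
      κβ₀≈w = C.trans (κ.*-homo _ _) (C.trans (C.*-cong (κ-preimage _) κ-P) (C.*-comm _ _))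

      private
        κ[1+β₀]≈ : κ.⟦ 𝒪.1# 𝒪.+ β₀ ⟧ C.≈ C.1# C.+ w
        κ[1+β₀]≈ = C.trans (κ.+-homo _ _) (C.+-cong κ.1#-homo κβ₀≈w)

      norm-β₀ : δ.φ (d.value 0F) 𝒪.* ((𝒪.1# 𝒪.+ β₀) 𝒪.* (𝒪.1# 𝒪.+ β₀) 𝒪.+ β₀ 𝒪.* β₀) 𝒪.≈ d.value 0F 𝒪.^ p
      norm-β₀ = κ-injective (C.trans (κ.*-homo _ _) (C.trans (C.*-congˡ (C.trans (κ.+-homo _ _)
        (C.+-cong (C.trans (κ.*-homo _ _) (C.*-cong (C.trans κ[1+β₀]≈ (C.sym a₀≈)) (C.trans κ[1+β₀]≈ (C.sym a₀≈))))
          (C.trans (κ.*-homo _ _) (C.*-cong (C.trans κβ₀≈w (C.sym y₀₀₁)) (C.trans κβ₀≈w (C.sym y₀₀₁)))))))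
        (norm 0F)))
        where
        a₀≈ : y 0F 0F 0F C.≈ C.1# C.+ w
        a₀≈ = C.trans y₀₀₀ (C.+-congˡ v≈w)

      a₁ a₂ : Fin 2 → 𝒪.Carrier
      a₁ i = 𝒪.1# 𝒪.+ β₀
      a₂ 0F = β₀
      a₂ 1F = 𝒪.- β₀

      κa₁ : ∀ i → κ.⟦ a₁ i ⟧ C.≈ y i 0F 0F
      κa₁ 0F = C.trans κ[1+β₀]≈ (C.sym (C.trans y₀₀₀ (C.+-congˡ v≈w)))
      κa₁ 1F = C.trans κ[1+β₀]≈ (C.sym y₁₀₀)

      κa₂ : ∀ i → κ.⟦ a₂ i ⟧ C.≈ y i 0F 1F
      κa₂ 0F = C.trans κβ₀≈w (C.sym y₀₀₁)
      κa₂ 1F = C.trans (κ.-‿homo _) (C.trans (C.-‿cong (C.trans κβ₀≈w (C.sym v≈w))) (C.sym y₁₀₁))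

      point : Fin 2 → PointG′ 𝒪
      point i = record
        { a₁ = a₁ i ; a₂ = a₂ i ; n⁻¹ = preimage n
        ; norm*n⁻¹≈1 = κ-injective (C.trans (κ.*-homo _ _) (C.trans (C.*-cong
            (C.trans (κ.+-homo _ _) (C.+-cong (C.trans (κ.*-homo _ _) (C.*-cong (κa₁ i) (κa₁ i)))
              (C.trans (κ.*-homo _ _) (C.*-cong (κa₂ i) (κa₂ i))))) (κ-preimage n)) (C.trans (R.F-norm i) (C.sym κ.1#-homo)))) }
        where
        n : C.Carrier
        n = h.⟦ RingHomomorphism.⟦_⟧ (lift∇ (∇ i)) ιG.⟦ var 1/det ⟧ ⟧

      -- h ∘ φᵢ is the value at pointᵢ of the φ-twisted function.
      vanishing-at-point : ∀ i t → h.⟦ RingHomomorphism.⟦_⟧ (lift∇ (∇ i)) ιG.⟦ t ⟧ ⟧ C.≈ C.0# →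
        RingHomomorphism.⟦_⟧ (evalG′ 𝒪 δ.frobeniusLift (point i)) (RingHomomorphism.⟦_⟧ G′⊂G t) 𝒪.≈ 𝒪.0#
      vanishing-at-point i t ht≈0 = κ-injective (C.trans (C.sym (hom-ext 𝒪 𝒪[G]-presentation {B = C} (R.F i) E
          (R.φ*-constant i)
          (λ { (entry 0F 0F) → C.sym (κa₁ i)
             ; (entry 0F 1F) → C.sym (κa₂ i)
             ; (entry 1F 0F) → C.trans (R.F₁₀≈-F₀₁ i) (C.trans (C.-‿cong (C.sym (κa₂ i))) (C.sym (κ.-‿homo _)))
             ; (entry 1F 1F) → C.trans (R.F₁₁≈F₀₀ i) (C.sym (κa₁ i))
             ; 1/det → C.sym (κ-preimage _) }) t))
          (C.trans ht≈0 (C.sym κ.0#-homo)))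
        where
        E : 𝒪[G] ⟶ C
        E = _∘ʰ_ {A = 𝒪[G]} {B = 𝒪} {E = C} κ (_∘ʰ_ {A = 𝒪[G]} {B = 𝒪[G′]} {E = 𝒪} (evalG′ 𝒪 δ.frobeniusLift (point i)) G′⊂G)

  -- Evaluation at the identity on closed subschemes containing it.

  open IsCompleteDVR dvr using (isComplete)

  private
    Ô : CommutativeRing _ _
    Ô = completion 𝒪
    module Ô = CRing Ô
    module ιO = RingHomomorphism (ι 𝒪)

  ε : 𝒪[G] ⟶ 𝒪
  ε = evalG 𝒪 (idʰ 𝒪) (embed {B = 𝒪} one)

  ε̂ : 𝒪[Ĝ] ⟶ Ô
  ε̂ = completionMap {A = 𝒪[G]} {B = 𝒪} ε

  private
    module ε = RingHomomorphism ε
    module ε̂ = RingHomomorphism ε̂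

    ε̂-constant : ∀ x → ε̂.⟦ constant.⟦ x ⟧ ⟧ Ô.≈ ιO.⟦ x ⟧
    ε̂-constant x = componentwise λ n → at-≈ (Ô.refl {ιO.⟦ x ⟧}) n

    ε̂-constant-injective : ∀ {x y} → ε̂.⟦ constant.⟦ x ⟧ ⟧ Ô.≈ ε̂.⟦ constant.⟦ y ⟧ ⟧ → x 𝒪.≈ y
    ε̂-constant-injective {x} {y} eq = proj₁ isComplete (Ô.trans (Ô.sym (ε̂-constant x)) (Ô.trans eq (ε̂-constant y)))

    preimage : Ô.Carrier → 𝒪.Carrier
    preimage y = proj₁ (proj₂ isComplete y)

    ε̂-preimage : ∀ y → ε̂.⟦ constant.⟦ preimage y ⟧ ⟧ Ô.≈ y
    ε̂-preimage y = Ô.trans (ε̂-constant _) (proj₂ (proj₂ isComplete y) 𝒪.refl)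

  ε̂-identity : IsIdentityPoint {C = Ô} ε̂
  ε̂-identity = record
    { rotation = record
      { x₁₁≈ = componentwise λ n → at-≈ (Ô.refl {Ô.1#}) n
      ; x₁₀≈ = componentwise λ n → at-≈ (Ô.refl {Ô.- Ô.0#}) n }
    ; contracting = p-contracting 𝒪
    ; x₀₀≈1 = componentwise λ n → at-≈ (Ô.refl {Ô.1#}) n
    ; x₀₁≈0 = componentwise λ n → at-≈ (Ô.refl {Ô.0#}) n
    ; κ-injective = ε̂-constant-injective
    ; preimage = preimage
    ; κ-preimage = ε̂-preimage }

  module AtOne = AtIdentity {C = Ô} ε̂ ε̂-identity

  module _ {Y : CommutativeRing b ℓ′} (f : 𝒪[G] ⟶ Y) (e : Y ⟶ 𝒪)
           (ε≈ef : ∀ t → ε.⟦ t ⟧ 𝒪.≈ RingHomomorphism.⟦_⟧ e (RingHomomorphism.⟦_⟧ f t)) where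
    private
      module Y = CommutativeRing Y
      module Ŷ = CRing (completion Y)
      module f = RingHomomorphism f
      module f̂ = RingHomomorphism (completionMap {A = 𝒪[G]} {B = Y} f)
      module ê = RingHomomorphism (completionMap {A = Y} {B = 𝒪} e)
      module M n = CRing (𝒪 mod n)

      transfer : ∀ z → f̂.⟦ z ⟧ Ŷ.≈ Ŷ.0# → ε̂.⟦ z ⟧ Ô.≈ Ô.0#
      transfer z fz≈0 = componentwise λ n → M.trans n
        (RingHomomorphism.⟦⟧-cong (reduce 𝒪 n) (ε≈ef (at z n))) (at-≈ ê-zero n)
        where
        ê-zero : ê.⟦ f̂.⟦ z ⟧ ⟧ Ô.≈ Ô.0#
        ê-zero = Ô.trans (ê.⟦⟧-cong fz≈0) ê.0#-homo

    -- Horizontality puts φ(t) in the ideal of Ŷ, and the identity is a point of Y through `e`, so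
    -- φ(t) vanishes there.
    horizontal⇒vanishing-at-1 : ∀ ∇ → IsHorizontal Y f ∇ → ∀ t → f.⟦ t ⟧ Y.≈ Y.0# →
      ε̂.⟦ RingHomomorphism.⟦_⟧ (lift∇ ∇) ιG.⟦ t ⟧ ⟧ Ô.≈ Ô.0#
    horizontal⇒vanishing-at-1 ∇ hor t ft≈0 = transfer _ (horizontal⇒φ {B = Y} f ∇ hor ιG.⟦ t ⟧
      (componentwise λ n → at-≈ (RingHomomorphism.⟦⟧-cong (ι Y) ft≈0) n))

  ε″ : 𝒪[G″] ⟶ 𝒪
  ε″ = eval 𝒪[G″]-presentation 𝒪 (idʰ 𝒪) (λ { α → 𝒪.1# ; β → 𝒪.0# })
    (λ _ → 𝒪.trans (𝒪.+-cong (𝒪.*-identityˡ 𝒪.1#) (𝒪.zeroˡ 𝒪.0#)) (𝒪.+-identityʳ 𝒪.1#))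

  ε≈ε″ : ∀ t → ε.⟦ t ⟧ 𝒪.≈ RingHomomorphism.⟦_⟧ ε″ (RingHomomorphism.⟦_⟧ G″⊂G t)
  ε≈ε″ = hom-ext 𝒪 𝒪[G]-presentation {B = 𝒪} ε (_∘ʰ_ {A = 𝒪[G]} {B = 𝒪[G″]} {E = 𝒪} ε″ G″⊂G) (λ _ → 𝒪.refl)
    λ { (entry 0F 0F) → 𝒪.refl ; (entry 0F 1F) → 𝒪.refl ; (entry 1F 0F) → 𝒪.refl ; (entry 1F 1F) → 𝒪.refl ; 1/det → 𝒪.refl }

  det-1-on-G″ : CommutativeRing._≈_ 𝒪[G″] (RingHomomorphism.⟦_⟧ G″⊂G (detG ⊕ ⊝ con 𝒪.1#)) (con 𝒪.0#)
  det-1-on-G″ = R.x≈y⇒x∙y⁻¹≈ε (R.trans (Similitudes.norm-det 𝒪[G″] (var α) (var β)) (relation _))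
    where module R = CRing 𝒪[G″]

  G″-vanishing-at-1 : ∀ ∇ → IsHorizontal 𝒪[G″] G″⊂G ∇ →
    ε̂.⟦ RingHomomorphism.⟦_⟧ (lift∇ ∇) ιG.⟦ detG ⊕ ⊝ con 𝒪.1# ⟧ ⟧ Ô.≈ Ô.0#
  G″-vanishing-at-1 ∇ hor = horizontal⇒vanishing-at-1 {Y = 𝒪[G″]} G″⊂G ε″ ε≈ε″ ∇
    (λ g fg≈0 → componentwise λ n → at-≈ (hor g (componentwise λ n → at-≈ fg≈0 n)) n) (detG ⊕ ⊝ con 𝒪.1#) det-1-on-G″

  -- Horizontal subgroups of G′.

  open GaussianDVR p p-prime 𝒪 dvr using (re-p∤)
  open Gaussian 𝒪
  open Slopes p p-prime p≢2 𝒪 dvr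

  private
    -- 𝒪 with its equality at the universe level of the algebras B in IsSubgroup.
    𝒪₀ : CommutativeRing c (c Level.⊔ ℓ)
    𝒪₀ = 𝒪 / principal 𝒪 𝒪.0#

    toᵒ : 𝒪 ⟶ 𝒪₀
    toᵒ = quotientMap 𝒪 (principal 𝒪 𝒪.0#)

    fromᵒ : 𝒪₀ ⟶ 𝒪
    fromᵒ = mkHom {A = 𝒪₀} {B = 𝒪} id (λ { (r , r0≈x-y) → 𝒪.x∙y⁻¹≈ε⇒x≈y _ _ (𝒪.trans (𝒪.sym r0≈x-y) (𝒪.zeroʳ r)) })
      (λ _ _ → 𝒪.refl) (λ _ _ → 𝒪.refl) 𝒪.refl

    module 𝒪₀ = CRing 𝒪₀

    value₀ : (σ : 𝒪 ⟶ 𝒪₀) → PointG′ 𝒪₀ → 𝒪[G′] ⟶ 𝒪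
    value₀ σ g = _∘ʰ_ {A = 𝒪[G′]} {B = 𝒪₀} {E = 𝒪} fromᵒ (evalG′ 𝒪₀ σ g)

    pointᵒ : PointG′ 𝒪 → PointG′ 𝒪₀
    pointᵒ g = record { a₁ = a₁ ; a₂ = a₂ ; n⁻¹ = n⁻¹ ; norm*n⁻¹≈1 = RingHomomorphism.⟦⟧-cong toᵒ norm*n⁻¹≈1 }
      where open PointG′ g

    evalᵒ : ∀ (σ : 𝒪 ⟶ 𝒪) (g : PointG′ 𝒪) t → RingHomomorphism.⟦_⟧ (evalG′ 𝒪 σ g) t 𝒪.≈ 𝒪.0# →
      RingHomomorphism.⟦_⟧ (evalG′ 𝒪₀ (_∘ʰ_ {A = 𝒪} {B = 𝒪} {E = 𝒪₀} toᵒ σ) (pointᵒ g)) t 𝒪₀.≈ 𝒪₀.0#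
    evalᵒ σ g t eq = RingHomomorphism.⟦⟧-cong toᵒ (𝒪.trans
      (hom-ext 𝒪 𝒪[G′]-presentation {B = 𝒪} (value₀ (_∘ʰ_ {A = 𝒪} {B = 𝒪} {E = 𝒪₀} toᵒ σ) (pointᵒ g)) (evalG′ 𝒪 σ g)
        (λ _ → 𝒪.refl) (λ { α → 𝒪.refl ; β → 𝒪.refl ; 1/N → 𝒪.refl }) t) eq)

    _∙ᵒ_ : PointG′ 𝒪₀ → PointG′ 𝒪₀ → PointG′ 𝒪₀
    _∙ᵒ_ = _∙_ {B = 𝒪₀}

    power : PointG′ 𝒪₀ → ℕ → PointG′ 𝒪₀
    power g zero    = one {B = 𝒪₀}
    power g (suc n) = g ∙ᵒ power g n

    coordinates : PointG′ 𝒪₀ → 𝒪.Carrier × 𝒪.Carrier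
    coordinates g = PointG′.a₁ g , PointG′.a₂ g

    power-coordinates : ∀ g n → coordinates (power g n) ≡ n ×ᵍ coordinates g
    power-coordinates g zero    = ≡.refl
    power-coordinates g (suc n) = ≡.cong (coordinates g ⋆_) (power-coordinates g n)

    -- A substitution on terms, not a ring homomorphism: the relation of G′ need not hold for the
    -- images in 𝒪[G]. It supplies a function on G restricting to a given one on G′.
    section : Term GenG′ → Term GenG
    section (var α)   = var (entry 0F 0F)
    section (var β)   = var (entry 0F 1F)
    section (var 1/N) = var 1/det
    section (con k)   = con k
    section (s ⊕ t)   = section s ⊕ section t
    section (s ⊗ t)   = section s ⊗ section t
    section (⊝ s)     = ⊝ section s

    section-right-inverse : ∀ t → CommutativeRing._≈_ 𝒪[G′] (RingHomomorphism.⟦_⟧ G′⊂G (section t)) t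
    section-right-inverse (var α)   = ∼-refl
    section-right-inverse (var β)   = ∼-refl
    section-right-inverse (var 1/N) = ∼-refl
    section-right-inverse (con k)   = ∼-refl
    section-right-inverse (s ⊕ t)   = ⊕-cong (section-right-inverse s) (section-right-inverse t)
    section-right-inverse (s ⊗ t)   = ⊗-cong (section-right-inverse s) (section-right-inverse t)
    section-right-inverse (⊝ s)     = ⊝-cong (section-right-inverse s)

  module _ (I : Ideal 𝒪[G′] (c Level.⊔ ℓ)) (subgroup : IsSubgroup I) where
    private
      open Ideal I using (_∈I; resp)
      module A = CRing 𝒪[G′]

      at-one : 𝒪[G′] ⟶ 𝒪
      at-one = value₀ toᵒ (one {B = 𝒪₀})
      module at-one = Hom {A = 𝒪[G′]} {B = 𝒪} at-one

      -- A subgroup contains the identity, so evaluation there kills `I` and descends to 𝒪[H].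
      e : 𝒪[H] I ⟶ 𝒪
      e = mkHom {A = 𝒪[H] I} {B = 𝒪} at-one.⟦_⟧
        (λ {x} {y} x-y∈I → 𝒪.x∙y⁻¹≈ε⇒x≈y _ _ (𝒪.trans (𝒪.sym (at-one.-homo x y))
          (RingHomomorphism.⟦⟧-cong fromᵒ (proj₁ (subgroup 𝒪₀ toᵒ) _ x-y∈I))))
        at-one.+-homo at-one.*-homo at-one.1#-homo

      ε≈e : ∀ t → RingHomomorphism.⟦_⟧ ε t 𝒪.≈ RingHomomorphism.⟦_⟧ e (RingHomomorphism.⟦_⟧ (H⊂G I) t)
      ε≈e = hom-ext 𝒪 𝒪[G]-presentation {B = 𝒪} ε (_∘ʰ_ {A = 𝒪[G]} {B = 𝒪[H] I} {E = 𝒪} e (H⊂G I)) (λ _ → 𝒪.refl)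
        λ { (entry 0F 0F) → 𝒪.refl ; (entry 0F 1F) → 𝒪.refl ; (entry 1F 0F) → 𝒪.refl ; (entry 1F 1F) → 𝒪.refl ; 1/det → 𝒪.refl }

    module _ (∇ : Fin 2 → Connection) (q : Fin 2 → SymGL₂) (metric : ∀ i → IsMetric (∇ i) (q i))
      (d : Fin 2 → Unit) (scalar : ∀ i → IsScalar (q i) (d i))
      (symmetric : ∀ k → christoffel (∇ 0F) (q 0F) 1F k Ĝ.≈ christoffel (∇ 1F) (q 1F) 0F k)
      (horizontal : ∀ i → IsHorizontal (𝒪[H] I) (H⊂G I) (∇ i))
      (m : ℤ) (d≈m : ∀ i → Unit.value (d i) 𝒪.≈ 𝒪.fromℤ m) (m≢1 : m ≢ 1ℤ) (m≢-1 : m ≢ -1ℤ) (p∤m : ¬ (+ p ℤ.∣ m)) where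
      private
        module O = AtOne ∇ q metric d scalar
        module d i = Unit (d i)

        d₀≈d₁ : d.value 0F 𝒪.≈ d.value 1F
        d₀≈d₁ = 𝒪.trans (d≈m 0F) (𝒪.sym (d≈m 1F))

        w : 𝒪.Carrier
        w = O.β₀ symmetric d₀≈d₁

        p∣w : P 𝒪.∣ w
        p∣w = _ , 𝒪.refl

        φ-point : Fin 2 → PointG′ 𝒪
        φ-point = O.point symmetric d₀≈d₁

        ∈I⇒vanishing : ∀ i t → t ∈I → RingHomomorphism.⟦_⟧ (evalG′ 𝒪 δ.frobeniusLift (φ-point i)) t 𝒪.≈ 𝒪.0#
        ∈I⇒vanishing i t t∈I = 𝒪.trans
          (RingHomomorphism.⟦⟧-cong (evalG′ 𝒪 δ.frobeniusLift (φ-point i)) (A.sym (section-right-inverse t)))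
          (O.vanishing-at-point symmetric d₀≈d₁ i (section t)
            (horizontal⇒vanishing-at-1 {Y = 𝒪[H] I} (H⊂G I) e ε≈e (∇ i)
              (λ g fg≈0 → componentwise λ n → at-≈ (horizontal i g (componentwise λ n → at-≈ fg≈0 n)) n) (section t)
              (resp (A.trans (A.sym (section-right-inverse t)) (A.sym (A.trans (A.+-congˡ A.ε⁻¹≈ε) (A.+-identityʳ _)))) t∈I)))

        -- The algebra structure through `φ`, for which the twisted points are points of H.
        σ : 𝒪 ⟶ 𝒪₀
        σ = _∘ʰ_ {A = 𝒪} {B = 𝒪} {E = 𝒪₀} toᵒ δ.frobeniusLift

        g : Fin 2 → PointG′ 𝒪₀
        g i = pointᵒ (φ-point i)

        g∈H : ∀ i → Contains I 𝒪₀ σ (g i)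
        g∈H i t t∈I = evalᵒ δ.frobeniusLift (φ-point i) t (∈I⇒vanishing i t t∈I)

        ∙∈H : ∀ {x y} → Contains I 𝒪₀ σ x → Contains I 𝒪₀ σ y → Contains I 𝒪₀ σ (x ∙ᵒ y)
        ∙∈H = proj₁ (proj₂ (subgroup 𝒪₀ σ)) _ _

        power∈H : ∀ {x} → Contains I 𝒪₀ σ x → ∀ n → Contains I 𝒪₀ σ (power x n)
        power∈H x∈H zero    = proj₁ (subgroup 𝒪₀ σ)
        power∈H x∈H (suc n) = ∙∈H x∈H (power∈H x∈H n)

        L : 𝒪.Carrier
        L = (𝒪.1# 𝒪.+ w) 𝒪.* (𝒪.1# 𝒪.+ w) 𝒪.+ w 𝒪.* w

        scalarPoint : PointG′ 𝒪₀
        scalarPoint = g 0F ∙ᵒ g 1F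

        -- The two points are conjugate, so their product is the common norm.
        scalar-coordinates : coordinates scalarPoint ≈ᵍ (L , 𝒪.0#)
        scalar-coordinates = Similitudes.norm-det 𝒪 (𝒪.1# 𝒪.+ w) w , Similitudes.conjugate-product 𝒪 (𝒪.1# 𝒪.+ w) w

        scalar-power : ∀ n → coordinates (power scalarPoint n) ≈ᵍ (L 𝒪.^ n , 𝒪.0#)
        scalar-power zero    = 𝒪.refl , 𝒪.refl
        scalar-power (suc n) = Similitudes.scalar-multiplication 𝒪 scalar-coordinates (scalar-power n)

        v : ℕ → PointG′ 𝒪₀
        v = power (g 0F)

        Q : ℕ → ℕ → PointG′ 𝒪₀
        Q k i = power scalarPoint i ∙ᵒ v k

        Q∈H : ∀ k i → Contains I 𝒪₀ σ (Q k i)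
        Q∈H k i = ∙∈H (power∈H (∙∈H (g∈H 0F) (g∈H 1F)) i) (power∈H (g∈H 0F) k)

        g₀ : 𝒪.Carrier × 𝒪.Carrier
        g₀ = 𝒪.1# 𝒪.+ w , w

        Q-coordinates : ∀ k i → coordinates (Q k i) ≈ᵍ (L 𝒪.^ i 𝒪.* re k g₀ , L 𝒪.^ i 𝒪.* im k g₀)
        Q-coordinates k i = ≡.subst (λ x → (coordinates (power scalarPoint i) ⋆ x) ≈ᵍ (L 𝒪.^ i 𝒪.* re k g₀ , L 𝒪.^ i 𝒪.* im k g₀))
          (≡.sym (power-coordinates (g 0F) k)) (Similitudes.scale-by 𝒪 (scalar-power i))

        -- Integers are fixed by `φ`, so φ(d) = m in the norm equation at the identity.
        equation : 𝒪.fromℤ m 𝒪.* L 𝒪.≈ 𝒪.fromℤ m 𝒪.^ p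
        equation = 𝒪.trans (𝒪.*-congʳ (𝒪.sym φd≈m)) (𝒪.trans (O.norm-β₀ symmetric d₀≈d₁) (𝒪.^-congˡ p (d≈m 0F)))
          where
          module φ = Hom {A = 𝒪} {B = 𝒪} δ.frobeniusLift
          φ-fromℤ : ∀ m → δ.φ (𝒪.fromℤ m) 𝒪.≈ 𝒪.fromℤ m
          φ-fromℤ (+ n)      = 𝒪.trans (φ.×ℕ-homo n 𝒪.1#) (𝒪.×-congʳ n φ.1#-homo)
          φ-fromℤ (-[1+ n ]) = 𝒪.trans (φ.-‿homo _) (𝒪.-‿cong (𝒪.trans (φ.×ℕ-homo (suc n) 𝒪.1#) (𝒪.×-congʳ (suc n) φ.1#-homo)))
          φd≈m : δ.φ (d.value 0F) 𝒪.≈ 𝒪.fromℤ m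
          φd≈m = 𝒪.trans (φ.⟦⟧-cong (d≈m 0F)) (φ-fromℤ m)

        1<r : 1 ℕ.< ℤ.∣ m ∣
        1<r = 1<∣m∣ m m≢1 m≢-1 p∤m

        -- If `w` were zero, the norm `L` would be 1, whereas its powers are distinct.
        w≉0 : ¬ w 𝒪.≈ 𝒪.0#
        w≉0 w≈0 = L≉1 1<r (∣m∣-equation m equation) (𝒪.trans
          (𝒪.+-cong (𝒪.*-cong 1+w≈1 1+w≈1) (𝒪.trans (𝒪.*-congʳ w≈0) (𝒪.zeroˡ w)))
          (𝒪.trans (𝒪.+-identityʳ _) (𝒪.*-identityˡ 𝒪.1#)))
          where
          1+w≈1 : 𝒪.1# 𝒪.+ w 𝒪.≈ 𝒪.1#
          1+w≈1 = 𝒪.trans (𝒪.+-congˡ w≈0) (𝒪.+-identityʳ _)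

        p∤a : ¬ P 𝒪.∣ (𝒪.1# 𝒪.+ w)
        p∤a = 1+p∤ p∣w

      horizontal-subgroup-total : ∀ f → f ∈I → f A.≈ A.0#
      -- The k-th line is spanned by the k-th power of the first point, and multiplying by the
      -- scalar powers Lⁱ gives the points on it.
      horizontal-subgroup-total f f∈I = vanishing-on-G′ δ.frobeniusLift
        (slope p∤a p∣w w≉0) (slopes-distinct p∤a p∣w w≉0)
        (λ k i → L 𝒪.^ i 𝒪.* re k g₀) (scaled-distinct p∤a p∣w w≉0 (powers-distinct 1<r (∣m∣-equation m equation)))
        (λ k i → value₀ σ (Q k i)) (λ _ _ _ → 𝒪.refl)
        (λ k i → proj₁ (Q-coordinates k i))
        (λ k i → 𝒪.trans (proj₂ (Q-coordinates k i)) (𝒪.trans (𝒪.*-congˡ (𝒪.sym (re*slope p∤a p∣w w≉0 k))) (𝒪.sym (𝒪.*-assoc _ _ _))))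
        f (λ k i → RingHomomorphism.⟦⟧-cong fromᵒ (Q∈H k i f f∈I))

  module _ (q : Fin 2 → SymGL₂) (∇ : Fin 2 → Connection) (leviCivita : IsLeviCivita q ∇)
    (d : Fin 2 → Unit) (scalar : ∀ i → IsScalar (q i) (d i)) where
    private
      module d i = Unit (d i)
      module O = AtOne ∇ q (proj₁ leviCivita) d scalar

    all-G′-horizontal : ∀ i → IsHorizontal 𝒪[G′] G′⊂G (∇ i)
    all-G′-horizontal i g fg≈0 = componentwise λ n → at-≈
      (G′-horizontal (∇ i) (q i) (proj₁ leviCivita i) (d i) (scalar i)
        g (componentwise λ n → at-≈ fg≈0 n)) n

    δd≈0⇒G″-horizontal : (∀ i → δ.δ (d.value i) 𝒪.≈ 𝒪.0#) → ∀ i → IsHorizontal 𝒪[G″] G″⊂G (∇ i)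
    δd≈0⇒G″-horizontal δd≈0 i g fg≈0 = componentwise λ n → at-≈
      (G″-horizontal (∇ i) (q i) (proj₁ leviCivita i) (d i) (scalar i) (δd≈0 i)
        g (componentwise λ n → at-≈ fg≈0 n)) n

    G″-horizontal⇒δd≈0 : ∀ i → IsHorizontal 𝒪[G″] G″⊂G (∇ i) → δ.δ (d.value i) 𝒪.≈ 𝒪.0#
    G″-horizontal⇒δd≈0 i hor = O.det-1⇒δd≈0 i (G″-vanishing-at-1 (∇ i) λ g fg≈0 → componentwise λ n → at-≈ (hor g (componentwise λ n → at-≈ fg≈0 n)) n)

    no-proper-horizontal-subgroup : ∀ m → (∀ i → d.value i 𝒪.≈ 𝒪.fromℤ m) → m ≢ 1ℤ → m ≢ -1ℤ → ¬ (+ p ℤ.∣ m) →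
      ∀ I → IsSubgroup I → (∀ i → IsHorizontal (𝒪[H] I) (H⊂G I) (∇ i)) → ¬ IsProper I
    no-proper-horizontal-subgroup m d≈m m≢1 m≢-1 p∤m I subgroup horizontal proper = proper
      (horizontal-subgroup-total I subgroup ∇ q (proj₁ leviCivita) d scalar
        (λ k → componentwise λ n → at-≈ (proj₂ leviCivita 0F 1F k) n)
        (λ i g fg≈0 → componentwise λ n → at-≈ (horizontal i g (componentwise λ n → at-≈ fg≈0 n)) n) m d≈m m≢1 m≢-1 p∤m)

    results : (∀ i → IsHorizontal 𝒪[G′] G′⊂G (∇ i)) ×
      ((∀ i → δ.δ (d.value i) 𝒪.≈ 𝒪.0#) → ∀ i → IsHorizontal 𝒪[G″] G″⊂G (∇ i)) ×
      (∀ i → IsHorizontal 𝒪[G″] G″⊂G (∇ i) → δ.δ (d.value i) 𝒪.≈ 𝒪.0#) ×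
      (∀ m → (∀ i → d.value i 𝒪.≈ 𝒪.fromℤ m) → m ≢ 1ℤ → m ≢ -1ℤ → ¬ (+ p ℤ.∣ m) →
        ∀ I → IsSubgroup I → (∀ i → IsHorizontal (𝒪[H] I) (H⊂G I) (∇ i)) → ¬ IsProper I)
    results = (λ i → all-G′-horizontal i) , (λ δd≈0 i → δd≈0⇒G″-horizontal δd≈0 i) , G″-horizontal⇒δd≈0 ,
      no-proper-horizontal-subgroup

-- The metrics d₁ · 1 and d₂ · 1.

-- Connects two definitionally equal presentations of x and y without asking the
-- type checker to compare them as elements of a completion.
φ-adjust : ∀ {p} {A : CommutativeRing a ℓ} (D : PDerivation p A) → let open CommutativeRing A ; open PDerivation D using (φ) in
  ∀ {x x′ y y′} → φ x′ ≈ y′ → x ≈ x′ → y′ ≈ y → φ x ≈ y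
φ-adjust {A = A} D eq x≈x′ y′≈y =
  A.trans (IsRingHomomorphism.⟦⟧-cong (PDerivation.φ-isRingHomomorphism D) x≈x′) (A.trans eq y′≈y)
  where module A = CommutativeRing A

open import Data.Integer.Divisibility using (_∣_)

theorem2p20 : ∀ {c ℓ : Level} (p : ℕ) (p-prime : Prime p) → p ≢ 2 →
  (𝒪 : CommutativeRing c ℓ) → IsCompleteDVR p 𝒪 →
  (δ𝒪 : PDerivation p 𝒪) →
  let open CRing 𝒪 using (_≈_)
      open CRing 𝒪 using (0#)
      open CRing 𝒪 using (fromℤ)
      open PDerivation δ𝒪 using (δ)
      open Connections p p-prime 𝒪 δ𝒪
  in
  (d : Fin 2 → Unit) →
  (∇ : Fin 2 → Connection) → IsLeviCivita (λ i → scalar (d i)) ∇ →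
  (∀ i → IsHorizontal 𝒪[G′] G′⊂G (∇ i))
  ×
  ((∀ i → IsHorizontal 𝒪[G″] G″⊂G (∇ i)) ⇔
    (δ (Unit.value (d 0F)) ≈ 0# × δ (Unit.value (d 1F)) ≈ 0#))
  ×
  (∀ (m : ℤ) → (∀ i → Unit.value (d i) ≈ fromℤ m) →
    m ≢ 1ℤ → m ≢ -1ℤ → ¬ (+ p ∣ m) →
    ¬ (∃[ I ] IsSubgroup I × IsProper I × Spec.IsConnected (𝒪[H] I) ×
              (∀ i → IsHorizontal (𝒪[H] I) (H⊂G I) (∇ i))))
theorem2p20 p p-prime p≢2 𝒪 dvr δ𝒪 d ∇ leviCivita =
  (λ i g fg≈0 → componentwise λ n → at-≈ (proj₁ results i g (componentwise λ n → at-≈ fg≈0 n)) n) ,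
  mk⇔ (λ horizontal → δd≈0 0F (λ g fg≈0 → componentwise λ n → at-≈ (horizontal 0F g (componentwise λ n → at-≈ fg≈0 n)) n) ,
                      δd≈0 1F (λ g fg≈0 → componentwise λ n → at-≈ (horizontal 1F g (componentwise λ n → at-≈ fg≈0 n)) n))
      (λ { (δd₀≈0 , δd₁≈0) i g fg≈0 → componentwise λ n → at-≈
        (proj₁ (proj₂ results) (λ { 0F → δd₀≈0 ; 1F → δd₁≈0 }) i g (componentwise λ n → at-≈ fg≈0 n)) n }) ,
  λ { m d≈m m≢1 m≢-1 p∤m (I , subgroup , proper , _ , horizontal) →
    proj₂ (proj₂ (proj₂ results)) m d≈m m≢1 m≢-1 p∤m I subgroup
      (λ i g fg≈0 → componentwise λ n → at-≈ (horizontal i g (componentwise λ n → at-≈ fg≈0 n)) n) proper }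
  where
  open PAdic p using (componentwise; at-≈)
  open Connections p p-prime 𝒪 δ𝒪
  module 𝒪 = CommutativeRing 𝒪
  module Ĝ = CommutativeRing 𝒪[Ĝ]
  module ℋ i = RingHomomorphism (ℋ (scalar (d i)))
  module φ₀ = RingHomomorphism φ₀

  results = LeviCivita.results p p-prime p≢2 𝒪 dvr δ𝒪 (λ i → scalar (d i)) ∇
    ( (λ i f → φ-adjust (Connection.pDerivation (∇ i)) (proj₁ leviCivita i f)
        (componentwise λ n → at-≈ (Ĝ.refl {ℋ.⟦_⟧ i f}) n) (componentwise λ n → at-≈ (Ĝ.refl {ℋ.⟦_⟧ i φ₀.⟦ f ⟧}) n))
    , (λ i j k → componentwise λ n → at-≈ (proj₂ leviCivita i j k) n) )
    d (λ i → record { q₀₀≈ = 𝒪.refl ; q₀₁≈ = 𝒪.refl ; q₁₀≈ = 𝒪.refl ; q₁₁≈ = 𝒪.refl })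

  δd≈0 = proj₁ (proj₂ (proj₂ results))
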